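{- Let $G$ be a $2$-tree-connected graph and let $f$ be a positive integer-valued function on $V(G)$. If for all $S\subseteq V(G)$, $$\Omega_2(G\setminus S)\le\sum_{v\in S}\Big(f(v)-\frac32\Big)+2,$$ then $G$ has an $f$-trail.
   Context: All graphs are finite, without loops, multiple edges allowed. A graph is $m$-tree-connected if it has $m$ edge-disjoint spanning trees (a one-vertex graph is $m$-tree-connected; the null graph is not). The vertex set of any graph $G$ is uniquely partitioned into the vertex sets of the maximal induced $m$-tree-connected subgraphs ($m$-tree-connected components); for this partition $P$, $\Omega_m(G)=|P|-\frac1m e_G(P)$, where $e_G(P)$ is the number of edges joining different parts; $\Omega_m$ of the null graph is $0$. $G\setminus S$ is obtained by deleting the vertices of $S$. An $f$-trail is a spanning closed trail meeting each vertex $v$ at most $f(v)$ times. -}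

module Defs where

open import Data.Nat using (ℕ; zero; suc; _≤_; NonZero)
open import Data.Bool using (Bool; true; false; _∧_; not; if_then_else_)
open import Data.Fin using (Fin; inject₁) renaming (suc to fsuc; zero to fzero)
open import Data.Fin.Properties using () renaming (_≟_ to _≟ᶠ_)
open import Data.List using (List; filter; length; map; foldr)
open import Data.List.Base using (allFin)
open import Data.Product using (Σ; _×_; _,_; ∃)
open import Data.Sum using (_⊎_)
open import Data.Empty using (⊥)
open import Data.Integer using (+_)
open import Data.Rational using (ℚ; _/_; _-_; _+_; 0ℚ; 1ℚ)
open import Relation.Nullary using (¬_; does)
open import Relation.Binary.PropositionalEquality using (_≡_; _≢_)
open import Function.Definitions using (Injective)

-- Finite loopless multigraphs.
-- Vertices are Fin nV, edges are Fin nE (so parallel edges are allowed),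
-- each edge e joins src e and tgt e, and there are no loops.

record Graph : Set where
  field
    nV   : ℕ
    nE   : ℕ
    src  : Fin nE → Fin nV
    tgt  : Fin nE → Fin nV
    loopless : ∀ e → src e ≢ tgt e
open Graph public

Subset : ℕ → Set
Subset k = Fin k → Bool

_∈ˢ_ : ∀ {k} → Fin k → Subset k → Set
x ∈ˢ X = X x ≡ true

_⊆ˢ_ : ∀ {k} → Subset k → Subset k → Set
X ⊆ˢ Y = ∀ x → x ∈ˢ X → x ∈ˢ Y

card : ∀ {k} → Subset k → ℕ
card {k} X = length (filter (λ x → X x Data.Bool.≟ true) (allFin k))

module _ (G : Graph) where

  Induced : Subset (nV G) → Fin (nE G) → Set
  Induced X e = (src G e ∈ˢ X) × (tgt G e ∈ˢ X)

  data Reach (T : Subset (nE G)) : Fin (nV G) → Fin (nV G) → Set where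
    here : ∀ {u} → Reach T u u
    fwd  : ∀ e {w} → e ∈ˢ T → Reach T (tgt G e) w → Reach T (src G e) w
    bwd  : ∀ e {w} → e ∈ˢ T → Reach T (src G e) w → Reach T (tgt G e) w

  without : Subset (nE G) → Fin (nE G) → Subset (nE G)
  without T e e' = if does (e ≟ᶠ e') then false else T e'

  -- T is (the edge set of) a spanning tree of the subgraph induced by X:
  -- T uses only edges of G[X], it is connected on X, and it is acyclic
  -- (no edge of T lies on a cycle of T, i.e. the ends of an edge e of T
  -- are not joined in T - e).
  SpanningTree : Subset (nV G) → Subset (nE G) → Set
  SpanningTree X T =
    (∀ e → e ∈ˢ T → Induced X e)
    × (∀ u v → u ∈ˢ X → v ∈ˢ X → Reach T u v)
    × (∀ e → e ∈ˢ T → ¬ Reach (without T e) (src G e) (tgt G e))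

  TreeConnected : ℕ → Subset (nV G) → Set
  TreeConnected m X =
    (Σ (Fin (nV G)) λ v → v ∈ˢ X)
    × (Σ (Fin m → Subset (nE G)) λ Ts →
         (∀ i → SpanningTree X (Ts i))
         × (∀ i j e → i ≢ j → e ∈ˢ Ts i → e ∈ˢ Ts j → ⊥))

  -- The partition of a vertex set R (the vertex set of G \ S) into the
  -- vertex sets of the m-tree-connected components of G[R], given as a
  -- labelling p : vertices → Fin k of the parts (labels of vertices
  -- outside R are irrelevant).

  classOf : ∀ {k} → Subset (nV G) → (Fin (nV G) → Fin k) → Fin k → Subset (nV G)
  classOf R p i v = R v ∧ does (p v ≟ᶠ i)

  record ComponentPartition (m : ℕ) (R : Subset (nV G)) : Set where
    field
      k     : ℕ
      part  : Fin (nV G) → Fin k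
      partTC : ∀ i → TreeConnected m (classOf R part i)
      partMax : ∀ i (Y : Subset (nV G)) → Y ⊆ˢ R → classOf R part i ⊆ˢ Y →
                TreeConnected m Y → Y ⊆ˢ classOf R part i
  open ComponentPartition public

  crossEdges : ∀ {m R} → ComponentPartition m R → ℕ
  crossEdges {R = R} P =
    card (λ e → R (src G e) ∧ R (tgt G e)
                ∧ not (does (part P (src G e) ≟ᶠ part P (tgt G e))))

  Ω : ∀ {R} (m : ℕ) .{{_ : NonZero m}} → ComponentPartition m R → ℚ
  Ω m P = (+ (k P) / 1) - (+ (crossEdges P) / m)

  compl : Subset (nV G) → Subset (nV G)
  compl S v = not (S v)

  full : Subset (nV G)
  full _ = true

  sumOver : Subset (nV G) → (Fin (nV G) → ℚ) → ℚ
  sumOver S h = foldr _+_ 0ℚ (map (λ v → if S v then h v else 0ℚ) (allFin (nV G)))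

  -- f-trails.  A closed trail of length L is a cyclic sequence of
  -- vertices vs 0, …, vs L = vs 0 and pairwise distinct edges es i
  -- joining vs i and vs (i+1).  It is spanning if every vertex occurs,
  -- and meets v as many times as indices i < L with vs i = v.

  record ClosedTrail : Set where
    field
      len : ℕ
      vs  : Fin (suc len) → Fin (nV G)
      es  : Fin len → Fin (nE G)
      closed : vs fzero ≡ vs (Data.Fin.fromℕ len)
      distinctEdges : Injective _≡_ _≡_ es
      joins : ∀ i → (src G (es i) ≡ vs (inject₁ i) × tgt G (es i) ≡ vs (fsuc i))
                  ⊎ (tgt G (es i) ≡ vs (inject₁ i) × src G (es i) ≡ vs (fsuc i))
  open ClosedTrail public

  meets : ClosedTrail → Fin (nV G) → ℕ
  meets t v = card (λ i → does (vs t (inject₁ i) ≟ᶠ v))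

  FTrail : (Fin (nV G) → ℕ) → Set
  FTrail f = Σ ClosedTrail λ t →
    (∀ v → Σ (Fin (suc (len t))) λ i → vs t i ≡ v)
    × (∀ v → meets t v ≤ f v)

{-# OPTIONS --safe #-}
-- By Nash-Williams, an edge set B is a disjoint union of two forests iff it is (2,2)-sparse:
-- |B[X]| ≤ 2|X| - 2 for every nonempty X; call X tight if equality holds. Among the unions B
-- of two spanning trees take one minimising the total excess of the degrees over 2f + 1. If
-- some vertex is in excess, a local search in the style of Fürer and Raghavachari starts from
-- S = {v : d_B(v) ≥ 2f(v) + 1}: an edge e of G - S outside B whose ends lie in no common tight
-- subset of G - S can be added to B, and any edge of the circuit it closes deleted. That
-- circuit meets S; either a vertex in excess improves, contradicting minimality, or the
-- vertices of S on the circuit can be relieved and are removed from S. When no such e is left,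
-- the maximal tight subsets of G - S are the 2-tree-connected components of G - S, all edges
-- between them belong to B, and counting edges of B contradicts the hypothesis for S.
-- So some B has all degrees at most 2f + 1. A spanning tree of B together with a suitable
-- subset of the other one has even degrees, hence degrees at most 2f, and an Euler tour of it
-- is an f-trail.
-- Classical reasoning takes place under a double negation, which is removed at the end
-- because f-trails can be searched for.

module Submission where

open import Defs
open import Data.Nat as ℕ using (ℕ; zero; suc; _+_; _*_; _∸_; _≤_; _<_; z≤n; s≤s)
open import Data.Nat.Properties
  using (≤-refl; ≤-trans; ≤-reflexive; ≤-antisym; <⇒≤; n≤1+n; m≤m+n; m≤n+m;
         +-mono-≤; +-mono-<-≤; +-mono-≤-<; +-monoʳ-≤; +-monoˡ-≤; +-cancelʳ-≤; +-cancelʳ-≡;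
         +-comm; +-assoc; +-identityʳ; *-identityʳ; *-comm; *-zeroʳ; *-suc; *-monoʳ-≤; ≰⇒>; ≮⇒≥; <⇒≱; _≤?_; _<?_; ≤-pred; +-*-semiring;
         +-∸-assoc; m≤n⇒m∸n≡0; ∸-monoˡ-≤; ∸-monoʳ-≤; suc-injective)
open import Data.Nat.Induction using (<-wellFounded)
open import Data.Nat.Tactic.RingSolver using (solve; solve-∀)
open import Induction.WellFounded using (Acc; acc)
open import Algebra.Properties.Semiring.Sum +-*-semiring
  using (sum; sum-cong-≗; ∑-distrib-+; ∑-comm; *-distribˡ-sum; sum-replicate-zero)
open import Data.Bool using (Bool; true; false; _∧_; _∨_; _xor_; not; if_then_else_)
import Data.Bool as Bool
import Data.Bool.Properties as Bool
open import Data.Fin using (Fin; zero; suc; inject₁; fromℕ)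
open import Data.Fin.Properties using (_≟_; any?; all?)
open import Data.List using (List; []; _∷_; _++_; length; map; foldr; filter; tabulate)
import Data.Integer as ℤ
import Data.Integer.Properties as ℤ
open import Data.Integer.Tactic.RingSolver using () renaming (solve-∀ to ℤ-solve-∀)
open import Data.Rational as ℚ using (ℚ; 0ℚ)
import Data.Rational.Properties as ℚ
open import Data.Rational.Unnormalised as ℚᵘ using (mkℚᵘ; *≡*; *≤*)
import Data.Rational.Unnormalised.Properties as ℚᵘ
open import Data.Product using (Σ; ∃; ∃₂; _×_; _,_; proj₁; proj₂)
open import Data.Sum using (_⊎_; inj₁; inj₂; [_,_]′)
open import Data.Empty using (⊥; ⊥-elim)
open import Function using (_∘_; id; case_of_)
open import Relation.Nullary using (¬_; Dec; yes; no; does; ¬?; _×-dec_; _⊎-dec_; _→-dec_)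
open import Relation.Nullary.Decidable using (True; toWitness; dec-true; dec-false; map′; decidable-stable; ¬¬-excluded-middle)
open import Relation.Binary.PropositionalEquality
  using (_≡_; _≢_; _≗_; refl; sym; trans; cong; cong₂; subst; subst₂; module ≡-Reasoning)

-- Sums and cardinalities

-- The value `2 * f v + 1` is what the counting yields: combined with the hypothesis for S it bounds
-- the degree sum over S by the sum of `2 * f v + 1`, with nothing to spare. The trail needs only
-- `2 * f v`, and parity gains the missing unit. The obstacle in the local search is the new edge e.
-- An end of e below the bound can receive it, but a vertex taken out of S during the search may be
-- exactly at the bound, and must give up an edge first. It therefore carries a recorded exchange,
-- and the exchanges of both ends of e have to be compatible. Two facts ensure this. Exchanges are
-- confined to tight sets avoiding S, and inside a tight set the edges of B may be replaced by as
-- many edges of any other sparse set without harm elsewhere (`override-sparse`). Moreover the tight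
-- sets of the two ends are disjoint, since otherwise their union would be a common tight set.
-- During the search B itself stays fixed. Exchanges are only recorded, and are evaluated to
-- contradict minimality.

⟦_⟧ : Bool → ℕ
⟦ b ⟧ = if b then 1 else 0

∧-elim : ∀ {a b} → a ∧ b ≡ true → a ≡ true × b ≡ true
∧-elim {true} {true} _ = refl , refl

∀ᵇ? : ∀ {p} {P : Bool → Set p} → (∀ b → Dec (P b)) → Dec (∀ b → P b)
∀ᵇ? P? = map′ (λ (f , t) → λ { false → f ; true → t }) (λ h → h false , h true) (P? false ×-dec P? true)

true-or-false : ∀ b → b ≡ true ⊎ b ≡ false
true-or-false true = inj₁ refl
true-or-false false = inj₂ refl

true≢false : ∀ {b} → b ≡ true → b ≡ false → ⊥
true≢false refl ()

≢true⇒≡false : ∀ {b} → ¬ b ≡ true → b ≡ false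
≢true⇒≡false {true} h = ⊥-elim (h refl)
≢true⇒≡false {false} _ = refl

not-true : ∀ {b} → not b ≡ true → b ≡ false
not-true {false} _ = refl

⟦⟧≤1 : ∀ b → ⟦ b ⟧ ≤ 1
⟦⟧≤1 true = ≤-refl
⟦⟧≤1 false = z≤n

-- Certificate format for linear consequences: add up hypotheses a ≤ b, and
-- let the ring solver check what is left.
linear : ∀ {a b c d} → a ≤ b → c + b ≡ d + a → c ≤ d
linear {a} {b} {c} {d} a≤b eq = +-cancelʳ-≤ b c d (≤-trans (≤-reflexive eq) (+-monoʳ-≤ d a≤b))

-- The implicit `True d` is solved by evaluating the decision. Together with `∀ᵇ?` this proves the
-- Boolean identities below by truth table.
by-cases : ∀ {p} {A : Set p} (d : Dec A) {_ : True d} → A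
by-cases d {t} = toWitness t

module _ {n : ℕ} where

  _==_ : Fin n → Fin n → Bool
  i == j = does (i ≟ j)

  ==-refl : ∀ i → (i == i) ≡ true
  ==-refl i = dec-true (i ≟ i) refl

  ==⇒≡ : ∀ {i j} → (i == j) ≡ true → i ≡ j
  ==⇒≡ {i} {j} h with i ≟ j
  ... | yes p = p
  ==⇒≡ () | no _

  ≢⇒==-false : ∀ {i j} → i ≢ j → (i == j) ≡ false
  ≢⇒==-false {i} {j} = dec-false (i ≟ j)

  ==-exclusive : ∀ {j k} → j ≢ k → ∀ i → (j == i) ∧ (k == i) ≡ false
  ==-exclusive {j} {k} j≢k i with j ≟ i | k ≟ i
  ... | yes refl | yes refl = ⊥-elim (j≢k refl)
  ... | yes _    | no _     = refl
  ... | no _     | _        = refl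

opaque

  ∑ : ∀ {n} → (Fin n → ℕ) → ℕ
  ∑ = sum

  ∑-cong : ∀ {n} {f g : Fin n → ℕ} → f ≗ g → ∑ f ≡ ∑ g
  ∑-cong = sum-cong-≗

  ∑-+ : ∀ {n} (f g : Fin n → ℕ) → ∑ (λ i → f i + g i) ≡ ∑ f + ∑ g
  ∑-+ = ∑-distrib-+

  ∑-swap : ∀ {m n} (f : Fin m → Fin n → ℕ) → ∑ (λ i → ∑ (f i)) ≡ ∑ (λ j → ∑ λ i → f i j)
  ∑-swap = ∑-comm

  ∑-*ˡ : ∀ {n} c (f : Fin n → ℕ) → ∑ (λ i → c * f i) ≡ c * ∑ f
  ∑-*ˡ c f = sym (*-distribˡ-sum c f)

  ∑-empty : (f : Fin 0 → ℕ) → ∑ f ≡ 0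
  ∑-empty f = refl

  ∑-suc : ∀ {n} (f : Fin (suc n) → ℕ) → ∑ f ≡ f zero + ∑ (f ∘ suc)
  ∑-suc f = refl

  ∑-zero : ∀ {n} {f : Fin n → ℕ} → (∀ i → f i ≡ 0) → ∑ f ≡ 0
  ∑-zero {n} h = trans (sum-cong-≗ h) (sum-replicate-zero n)

  ∑-const : ∀ c n → ∑ {n} (λ _ → c) ≡ c * n
  ∑-const c zero = sym (*-zeroʳ c)
  ∑-const c (suc n) = trans (cong (λ z → c + z) (∑-const c n)) (sym (*-suc c n))

  ∑-mono : ∀ {n} {f g : Fin n → ℕ} → (∀ i → f i ≤ g i) → ∑ f ≤ ∑ g
  ∑-mono {zero} h = z≤n
  ∑-mono {suc n} h = +-mono-≤ (h zero) (∑-mono (h ∘ suc))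

  ∑-mono-< : ∀ {n} {f g : Fin n → ℕ} → (∀ i → f i ≤ g i) → ∀ i → f i < g i → ∑ f < ∑ g
  ∑-mono-< {suc n} h zero p = +-mono-<-≤ p (∑-mono (h ∘ suc))
  ∑-mono-< {suc n} h (suc i) p = +-mono-≤-< (h zero) (∑-mono-< (h ∘ suc) i p)

  ∑-lookup≤ : ∀ {n} (f : Fin n → ℕ) i → f i ≤ ∑ f
  ∑-lookup≤ f zero = m≤m+n _ _
  ∑-lookup≤ f (suc i) = ≤-trans (∑-lookup≤ (f ∘ suc) i) (m≤n+m _ _)

∑-<⇒∃ : ∀ {n} {f g : Fin n → ℕ} → ∑ f < ∑ g → ∃ λ i → f i < g i
∑-<⇒∃ {f = f} {g} h with any? (λ i → f i <? g i)
... | yes p = p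
... | no ¬p = ⊥-elim (<⇒≱ h (∑-mono λ i → ≮⇒≥ λ q → ¬p (i , q)))

∑₂-≡ : ∀ {n} {f g h k : Fin n → ℕ} → (∀ i → f i + g i ≡ h i + k i) → ∑ f + ∑ g ≡ ∑ h + ∑ k
∑₂-≡ {f = f} {g} {h} {k} p = trans (sym (∑-+ f g)) (trans (∑-cong p) (∑-+ h k))

∑₂-≤ : ∀ {n} {f g h k : Fin n → ℕ} → (∀ i → f i + g i ≤ h i + k i) → ∑ f + ∑ g ≤ ∑ h + ∑ k
∑₂-≤ {f = f} {g} {h} {k} p = subst₂ _≤_ (∑-+ f g) (∑-+ h k) (∑-mono p)

∑-δ : ∀ {n} (i : Fin n) (f : Fin n → ℕ) → ∑ (λ j → ⟦ i == j ⟧ * f j) ≡ f i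
∑-δ {suc n} zero f = trans (∑-suc _) (trans (cong₂ _+_ (+-identityʳ _) (∑-zero {n} λ _ → refl)) (+-identityʳ _))
∑-δ {suc n} (suc i) f = trans (∑-suc _) (trans (∑-cong lemma) (∑-δ i (f ∘ suc)))
  where
  lemma : ∀ j → ⟦ suc i == suc j ⟧ * f (suc j) ≡ ⟦ i == j ⟧ * f (suc j)
  lemma j with i ≟ j
  ... | yes _ = refl
  ... | no _ = refl

opaque

  count : ∀ {n} → Subset n → ℕ
  count X = ∑ λ i → ⟦ X i ⟧

  count-∑ : ∀ {n} (X : Subset n) → count X ≡ ∑ λ i → ⟦ X i ⟧
  count-∑ X = refl

  count-cong : ∀ {n} {X Y : Subset n} → X ≗ Y → count X ≡ count Y
  count-cong h = ∑-cong λ i → cong ⟦_⟧ (h i)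

  count-δ : ∀ {n} (i : Fin n) → count (i ==_) ≡ 1
  count-δ i = trans (∑-cong λ j → sym (*-identityʳ _)) (∑-δ i λ _ → 1)

  count-∈ : ∀ {n} {X : Subset n} {i} → i ∈ˢ X → 1 ≤ count X
  count-∈ {X = X} {i} h = ≤-trans (≤-reflexive (sym (cong ⟦_⟧ h))) (∑-lookup≤ (λ i → ⟦ X i ⟧) i)

  private
    ⟦⟧-mono : ∀ {a b} → (a ≡ true → b ≡ true) → ⟦ a ⟧ ≤ ⟦ b ⟧
    ⟦⟧-mono {true} h rewrite h refl = ≤-refl
    ⟦⟧-mono {false} h = z≤n

  count-mono : ∀ {n} {X Y : Subset n} → X ⊆ˢ Y → count X ≤ count Y
  count-mono h = ∑-mono λ i → ⟦⟧-mono (h i)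

  count-⊂ : ∀ {n} {X Y : Subset n} → X ⊆ˢ Y → ∀ i → X i ≡ false → i ∈ˢ Y → count X < count Y
  count-⊂ {X = X} {Y} h i p q = ∑-mono-< (λ j → ⟦⟧-mono (h j)) i (subst₂ (λ a b → ⟦ a ⟧ < ⟦ b ⟧) (sym p) (sym q) ≤-refl)

  count-∃ : ∀ {n} {X : Subset n} → 1 ≤ count X → ∃ λ i → i ∈ˢ X
  count-∃ {n} {X} h with ∑-<⇒∃ {f = λ _ → 0} {g = λ i → ⟦ X i ⟧} (≤-trans (s≤s (≤-reflexive (∑-zero {n} λ _ → refl))) h)
  ... | i , p with X i in eq
  ... | true = i , eq
  count-∃ h | i , () | false

  count-none : ∀ {n} {X : Subset n} → (∀ i → X i ≡ false) → count X ≡ 0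
  count-none h = ∑-zero λ i → cong ⟦_⟧ (h i)

_∪_ _∩_ : ∀ {n} → Subset n → Subset n → Subset n
(X ∪ Y) v = X v ∨ Y v
(X ∩ Y) v = X v ∧ Y v

∪-introˡ : ∀ {n} {X Y : Subset n} → X ⊆ˢ (X ∪ Y)
∪-introˡ x h rewrite h = refl

∪-introʳ : ∀ {n} {X Y : Subset n} → Y ⊆ˢ (X ∪ Y)
∪-introʳ {X = X} x h with X x
... | true = refl
... | false = h

∪-elim : ∀ {n} {X Y Z : Subset n} → X ⊆ˢ Z → Y ⊆ˢ Z → (X ∪ Y) ⊆ˢ Z
∪-elim {X = X} f g x h with X x in eq
... | true = f x eq
... | false = g x h

∩-intro : ∀ {n} {X Y : Subset n} {x} → x ∈ˢ X → x ∈ˢ Y → x ∈ˢ (X ∩ Y)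
∩-intro p q rewrite p | q = refl

∁ : ∀ {n} → Subset n → Subset n
∁ X v = not (X v)

insert remove : ∀ {n} → Subset n → Fin n → Subset n
insert X i j = (i == j) ∨ X j
remove X i j = not (i == j) ∧ X j

insert-∈ : ∀ {n} {X : Subset n} i → i ∈ˢ insert X i
insert-∈ i rewrite ==-refl i = refl

insert-⊆ : ∀ {n} {X : Subset n} {i} → X ⊆ˢ insert X i
insert-⊆ {i = i} = ∪-introʳ {X = i ==_}

insert-least : ∀ {n} {X Y : Subset n} {i} → X ⊆ˢ Y → i ∈ˢ Y → insert X i ⊆ˢ Y
insert-least {Y = Y} h p = ∪-elim (λ j q → subst (_∈ˢ Y) (==⇒≡ q) p) h

remove-⊆ : ∀ {n} {X : Subset n} {i} → remove X i ⊆ˢ X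
remove-⊆ x h = proj₂ (∧-elim h)

remove-∌ : ∀ {n} {X : Subset n} i → remove X i i ≡ false
remove-∌ i rewrite ==-refl i = refl

remove-∈ : ∀ {n} {X : Subset n} {i j} → i ≢ j → j ∈ˢ X → j ∈ˢ remove X i
remove-∈ p q rewrite ≢⇒==-false p | q = refl

remove-≢ : ∀ {n} {X : Subset n} {i j} → j ∈ˢ remove X i → i ≢ j
remove-≢ {X = X} {i} h refl = true≢false h (remove-∌ {X = X} i)

all : ∀ {n} → Subset n
all _ = true

opaque
  unfolding count

  -- The filter `P` is arbitrary because `ins` and `deg` are both counts of this shape, with `P`
  -- equal to `inside G X` and to `inc G v`.
  count-insert : ∀ {n} (X P : Subset n) i → X i ≡ false →
    count (insert X i ∩ P) ≡ count (X ∩ P) + ⟦ P i ⟧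
  count-insert X P i h = begin
    count (insert X i ∩ P)                                  ≡⟨ ∑-cong pointwise ⟩
    ∑ (λ j → ⟦ (X ∩ P) j ⟧ + ⟦ i == j ⟧ * ⟦ P j ⟧)          ≡⟨ ∑-+ (λ j → ⟦ (X ∩ P) j ⟧) _ ⟩
    count (X ∩ P) + ∑ (λ j → ⟦ i == j ⟧ * ⟦ P j ⟧)          ≡⟨ cong (count (X ∩ P) +_) (∑-δ i _) ⟩
    count (X ∩ P) + ⟦ P i ⟧                                 ∎
    where
    open ≡-Reasoning
    pointwise : ∀ j → ⟦ (insert X i ∩ P) j ⟧ ≡ ⟦ (X ∩ P) j ⟧ + ⟦ i == j ⟧ * ⟦ P j ⟧
    pointwise j with i ≟ j
    ... | yes refl rewrite h = sym (+-identityʳ _)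
    ... | no _ = sym (+-identityʳ _)

  count-remove : ∀ {n} (X P : Subset n) i → X i ≡ true →
    count (remove X i ∩ P) + ⟦ P i ⟧ ≡ count (X ∩ P)
  count-remove X P i h = begin
    count (remove X i ∩ P) + ⟦ P i ⟧                          ≡⟨ cong (count (remove X i ∩ P) +_) (∑-δ i _) ⟨
    count (remove X i ∩ P) + ∑ (λ j → ⟦ i == j ⟧ * ⟦ P j ⟧)   ≡⟨ ∑-+ (λ j → ⟦ (remove X i ∩ P) j ⟧) _ ⟨
    ∑ (λ j → ⟦ (remove X i ∩ P) j ⟧ + ⟦ i == j ⟧ * ⟦ P j ⟧)   ≡⟨ ∑-cong pointwise ⟩
    count (X ∩ P)                                             ∎
    where
    open ≡-Reasoning
    pointwise : ∀ j → ⟦ (remove X i ∩ P) j ⟧ + ⟦ i == j ⟧ * ⟦ P j ⟧ ≡ ⟦ (X ∩ P) j ⟧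
    pointwise j with i ≟ j
    ... | yes refl rewrite h = +-identityʳ _
    ... | no _ = +-identityʳ _

  count-∪-∩ : ∀ {n} (X Y : Subset n) → count (X ∪ Y) + count (X ∩ Y) ≡ count X + count Y
  count-∪-∩ X Y = ∑₂-≡ λ i → lemma (X i) (Y i)
    where
    lemma : ∀ a b → ⟦ a ∨ b ⟧ + ⟦ a ∧ b ⟧ ≡ ⟦ a ⟧ + ⟦ b ⟧
    lemma = by-cases (∀ᵇ? λ a → ∀ᵇ? λ b → _ ℕ.≟ _)

∩-all : ∀ {n} (X : Subset n) → count (X ∩ all) ≡ count X
∩-all X = count-cong λ i → Bool.∧-identityʳ (X i)

count-insert-1 : ∀ {n} (X : Subset n) i → X i ≡ false → count (insert X i) ≡ count X + 1
count-insert-1 X i h =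
  trans (sym (∩-all (insert X i))) (trans (count-insert X all i h) (cong (_+ 1) (∩-all X)))

count-remove-1 : ∀ {n} (X : Subset n) i → X i ≡ true → count (remove X i) + 1 ≡ count X
count-remove-1 X i h =
  trans (cong (_+ 1) (sym (∩-all (remove X i)))) (trans (count-remove X all i h) (∩-all X))

-- Sparse and tight sets

module _ (G : Graph) where

  inside : Subset (nV G) → Subset (nE G)
  inside X e = X (src G e) ∧ X (tgt G e)

  inc : Fin (nV G) → Subset (nE G)
  inc v e = (src G e == v) ∨ (tgt G e == v)

  opaque
    ins : Subset (nE G) → Subset (nV G) → ℕ
    ins B X = count (B ∩ inside X)

    deg : Subset (nE G) → Fin (nV G) → ℕ
    deg B v = count (B ∩ inc v)

    ins-count : ∀ B X → ins B X ≡ count (B ∩ inside X)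
    ins-count B X = refl

    deg-count : ∀ B v → deg B v ≡ count (B ∩ inc v)
    deg-count B v = refl

  Sparse : Subset (nE G) → Set
  Sparse B = ∀ X {v} → v ∈ˢ X → ins B X + 2 ≤ 2 * count X

  -- Only the inequality that sparsity does not supply is recorded; `tight-≡` combines the two. The
  -- point witnesses that the set is nonempty.
  record Tight (B : Subset (nE G)) (X : Subset (nV G)) : Set where
    constructor tight
    field
      {point} : Fin (nV G)
      point∈ : point ∈ˢ X
      edges≥ : 2 * count X ≤ ins B X + 2
  open Tight public

module _ {G : Graph} where

  inside-mono : ∀ {X Y} → X ⊆ˢ Y → inside G X ⊆ˢ inside G Y
  inside-mono h e p with ∧-elim p
  ... | a , b rewrite h _ a | h _ b = refl

  tight-≡ : ∀ {B X} → Sparse G B → Tight G B X → ins G B X + 2 ≡ 2 * count X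
  tight-≡ sp (tight v∈X t) = ≤-antisym (sp _ v∈X) t

  opaque
    unfolding ins count

    -- True edge by edge. An edge between a vertex of X outside Y and a vertex of Y outside X is
    -- counted on the right only.
    ins-supermodular : ∀ B X Y → ins G B X + ins G B Y ≤ ins G B (X ∪ Y) + ins G B (X ∩ Y)
    ins-supermodular B X Y =
      ∑₂-≤ λ e → lemma (B e) (X (src G e)) (X (tgt G e)) (Y (src G e)) (Y (tgt G e))
      where
      lemma : ∀ b x x′ y y′ → ⟦ b ∧ (x ∧ x′) ⟧ + ⟦ b ∧ (y ∧ y′) ⟧
        ≤ ⟦ b ∧ ((x ∨ y) ∧ (x′ ∨ y′)) ⟧ + ⟦ b ∧ ((x ∧ y) ∧ (x′ ∧ y′)) ⟧
      lemma = by-cases (∀ᵇ? λ b → ∀ᵇ? λ x → ∀ᵇ? λ x′ → ∀ᵇ? λ y → ∀ᵇ? λ y′ → _ ≤? _)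

  module _ {B : Subset (nE G)} {X Y : Subset (nV G)} (sp : Sparse G B) (tX : Tight G B X) (tY : Tight G B Y)
           {v : Fin (nV G)} (v∈X : v ∈ˢ X) (v∈Y : v ∈ˢ Y) where

    private
      v∈∩ : v ∈ˢ (X ∩ Y)
      v∈∩ = ∩-intro {X = X} {Y} v∈X v∈Y

      v∈∪ : v ∈ˢ (X ∪ Y)
      v∈∪ = ∪-introˡ {X = X} {Y} v v∈X

      arith : ∀ x y u i bx by bu bi → 2 * x ≤ bx + 2 → 2 * y ≤ by + 2 → u + i ≡ x + y →
        bx + by ≤ bu + bi → bi + 2 ≤ 2 * i → 2 * u ≤ bu + 2
      arith x y u i bx by bu bi p q r s t =
        linear (+-mono-≤ (+-mono-≤ (+-mono-≤ p q) (+-mono-≤ (≤-reflexive r) (≤-reflexive r))) (+-mono-≤ s t))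
          (solve (x ∷ y ∷ u ∷ i ∷ bx ∷ by ∷ bu ∷ bi ∷ []))

      #X #Y #∪ #∩ : ℕ
      #X = count X
      #Y = count Y
      #∪ = count (X ∪ Y)
      #∩ = count (X ∩ Y)

    -- The function `2 * count X - ins G B X` is submodular and at least 2 on nonempty sets. Where X
    -- and Y attain the minimum 2, so do their union and their intersection; `v` makes the
    -- intersection nonempty.
    tight-∪ : Tight G B (X ∪ Y)
    tight-∪ = tight v∈∪
      (arith #X #Y #∪ #∩ (ins G B X) (ins G B Y) (ins G B (X ∪ Y)) (ins G B (X ∩ Y))
        (edges≥ tX) (edges≥ tY) (count-∪-∩ X Y) (ins-supermodular B X Y) (sp _ v∈∩))

    tight-∩ : Tight G B (X ∩ Y)
    tight-∩ = tight v∈∩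
      (arith #X #Y #∩ #∪ (ins G B X) (ins G B Y) (ins G B (X ∩ Y)) (ins G B (X ∪ Y))
        (edges≥ tX) (edges≥ tY) (trans (+-comm #∩ #∪) (count-∪-∩ X Y))
        (≤-trans (ins-supermodular B X Y) (≤-reflexive (+-comm (ins G B (X ∪ Y)) (ins G B (X ∩ Y)))))
        (sp _ v∈∪))

  loop-free : ∀ e v → (src G e == v) ∧ (tgt G e == v) ≡ false
  loop-free e = ==-exclusive (loopless G e)

  tight-singleton : ∀ B v → Tight G B (v ==_)
  tight-singleton B v = tight (==-refl v) (≤-trans (≤-reflexive (cong (2 *_) (count-δ v))) (m≤n+m 2 _))

  ins-all : ∀ B → ins G B all ≡ count B
  ins-all B = trans (ins-count G B all) (∩-all B)

  ins-insert : ∀ {B e} → B e ≡ false → ∀ Y → ins G (insert B e) Y ≡ ins G B Y + ⟦ inside G Y e ⟧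
  ins-insert {B} {e} e∉B Y rewrite ins-count G B Y =
    trans (ins-count G (insert B e) Y) (count-insert B (inside G Y) e e∉B)

  insert-sparse : ∀ {B e} → Sparse G B → B e ≡ false →
    (∀ Y → Tight G B Y → ¬ e ∈ˢ inside G Y) → Sparse G (insert B e)
  insert-sparse {B} {e} sp e∉B free Y v∈Y rewrite ins-insert {B} {e} e∉B Y
    with inside G Y e in eq
  ... | false = ≤-trans (≤-reflexive (cong (_+ 2) (+-identityʳ _))) (sp Y v∈Y)
  ... | true with 2 * count Y ≤? ins G B Y + 2
  ...   | yes t = ⊥-elim (free Y (tight v∈Y t) eq)
  ...   | no ¬t = ≤-trans (≤-reflexive (a+1+2 (ins G B Y))) (≰⇒> ¬t)
    where
    a+1+2 : ∀ a → a + 1 + 2 ≡ suc (a + 2)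
    a+1+2 = solve-∀

  swap : Subset (nE G) → Fin (nE G) → Fin (nE G) → Subset (nE G)
  swap B e g = remove (insert B e) g

  module _ {B : Subset (nE G)} {e g : Fin (nE G)} (e∉B : B e ≡ false) (g∈B : B g ≡ true) where

    count-swap : ∀ P → count (swap B e g ∩ P) + ⟦ P g ⟧ ≡ count (B ∩ P) + ⟦ P e ⟧
    count-swap P = trans (count-remove (insert B e) P g (insert-⊆ {X = B} {e} g g∈B)) (count-insert B P e e∉B)

    ins-swap : ∀ Y → ins G (swap B e g) Y + ⟦ inside G Y g ⟧ ≡ ins G B Y + ⟦ inside G Y e ⟧
    ins-swap Y rewrite ins-count G (swap B e g) Y | ins-count G B Y = count-swap (inside G Y)

    -- A set that gains `e` either is not tight, and has room for one more edge, or is tight and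
    -- loses `g` at the same time. The hypothesis says that `g` lies on the circuit closed by `e`.
    swap-sparse : Sparse G B →
      (∀ Y → Tight G B Y → e ∈ˢ inside G Y → g ∈ˢ inside G Y) → Sparse G (swap B e g)
    swap-sparse sp hits Y v∈Y with inside G Y e in eq | ins-swap Y
    ... | false | c =
      ≤-trans (+-monoˡ-≤ 2 (≤-trans (m≤m+n _ _) (≤-reflexive (trans c (+-identityʳ _))))) (sp Y v∈Y)
    ... | true | c with 2 * count Y ≤? ins G B Y + 2
    ...   | yes t rewrite hits Y (tight v∈Y t) eq =
      ≤-trans (+-monoˡ-≤ 2 (≤-reflexive (+-cancelʳ-≡ _ _ _ c))) (sp Y v∈Y)
    ...   | no ¬t =
      linear (+-mono-≤ (≰⇒> ¬t) (≤-trans (m≤m+n _ _) (≤-reflexive c)))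
        (rearrange (ins G (swap B e g) Y) (ins G B Y) (2 * count Y))
      where
      rearrange : ∀ a b c → a + 2 + (c + (b + 1)) ≡ c + (suc (b + 2) + a)
      rearrange = solve-∀

-- Classical reasoning under double negation

module _ {a b} {A : Set a} {B : Set b} where

  infixl 1 _>>=_
  _>>=_ : ¬ ¬ A → (A → ¬ ¬ B) → ¬ ¬ B
  (m >>= f) k = m λ x → f x k

return : ∀ {a} {A : Set a} → A → ¬ ¬ A
return x k = k x

¬¬-∀ : ∀ {p} n {P : Fin n → Set p} → (∀ i → ¬ ¬ P i) → ¬ ¬ (∀ i → P i)
¬¬-∀ zero h k = k λ ()
¬¬-∀ (suc n) h = do
  p₀ ← h zero
  ps ← ¬¬-∀ n (h ∘ suc)
  return λ { zero → p₀ ; (suc i) → ps i }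

-- If no element were least, each one would have a smaller successor, an infinite descent in ℕ.
-- Nothing about `A` has to be decided.
minimiser : ∀ {a} {A : Set a} (μ : A → ℕ) → A → ¬ ¬ (∃ λ x → ∀ y → μ x ≤ μ y)
minimiser {A = A} μ x₀ none = go x₀ (<-wellFounded (μ x₀))
  where
  go : ∀ x → Acc _<_ (μ x) → ⊥
  go x (acc rs) = none (x , λ y → ≮⇒≥ λ y<x → go y (rs y<x))

-- Replacing edges inside a tight set

module _ {G : Graph} where

  -- For tight `X` this exchanges one basis of `G[X]` in the sparsity matroid for another. By
  -- `replaces-⊆` and `tight-→` the tightness of `X`, and of every larger set, is kept.
  record Replaces (X : Subset (nV G)) (B B′ : Subset (nE G)) : Set where
    field
      outside : ∀ e → inside G X e ≡ false → B′ e ≡ B e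
      sparse′ : Sparse G B′
      ins-≡   : ins G B′ X ≡ ins G B X
  open Replaces public

  opaque
    unfolding ins count

    ins-outside : ∀ {X W B B′} → (∀ e → inside G X e ≡ false → B′ e ≡ B e) → X ⊆ˢ W →
      ins G B′ W + ins G B X ≡ ins G B W + ins G B′ X
    ins-outside {X} {W} {B} {B′} out X⊆W = ∑₂-≡ pointwise
      where
      pointwise : ∀ e → ⟦ B′ e ∧ inside G W e ⟧ + ⟦ B e ∧ inside G X e ⟧
        ≡ ⟦ B e ∧ inside G W e ⟧ + ⟦ B′ e ∧ inside G X e ⟧
      pointwise e with inside G X e in eq
      ... | true rewrite inside-mono {G} X⊆W e eq = +-comm ⟦ B′ e ∧ true ⟧ _
      ... | false rewrite out e eq = cong (⟦ B e ∧ inside G W e ⟧ +_) (lemma (B e))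
        where
        lemma : ∀ b → ⟦ b ∧ false ⟧ ≡ ⟦ b ∧ false ⟧
        lemma _ = refl

    ins-cong : ∀ {X B B′} → (∀ e → inside G X e ≡ true → B′ e ≡ B e) → ins G B′ X ≡ ins G B X
    ins-cong {X} {B} {B′} h = ∑-cong pointwise
      where
      pointwise : ∀ e → ⟦ B′ e ∧ inside G X e ⟧ ≡ ⟦ B e ∧ inside G X e ⟧
      pointwise e with inside G X e in eq
      ... | true rewrite h e eq = refl
      ... | false with B e | B′ e
      ...   | true | true = refl
      ...   | true | false = refl
      ...   | false | true = refl
      ...   | false | false = refl

  replaces-refl : ∀ {X B} → Sparse G B → Replaces X B B
  replaces-refl sp = record { outside = λ _ _ → refl ; sparse′ = sp ; ins-≡ = refl }

  replaces-⊆ : ∀ {X W B B′} → X ⊆ˢ W → Replaces X B B′ → Replaces W B B′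
  replaces-⊆ {X} {W} {B} {B′} X⊆W r = record
    { outside = λ e e∉W → outside r e (≢true⇒≡false λ e∈X → true≢false (inside-mono {G} X⊆W e e∈X) e∉W)
    ; sparse′ = sparse′ r
    ; ins-≡ = +-cancelʳ-≡ _ _ _ (trans (ins-outside (outside r) X⊆W) (cong (ins G B W +_) (ins-≡ r)))
    }

  replaces-trans : ∀ {X B B′ B″} → Replaces X B B′ → Replaces X B′ B″ → Replaces X B B″
  replaces-trans r s = record
    { outside = λ e h → trans (outside s e h) (outside r e h)
    ; sparse′ = sparse′ s
    ; ins-≡ = trans (ins-≡ s) (ins-≡ r)
    }

  tight-→ : ∀ {X B B′} → Replaces X B B′ → Tight G B X → Tight G B′ X
  tight-→ r (tight p t) rewrite sym (ins-≡ r) = tight p t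

  tight-← : ∀ {X B B′} → Replaces X B B′ → Tight G B′ X → Tight G B X
  tight-← r (tight p t) rewrite ins-≡ r = tight p t

  override : Subset (nV G) → Subset (nE G) → Subset (nE G) → Subset (nE G)
  override Y B₁ B₂ e = if inside G Y e then B₂ e else B₁ e

  module _ {Y : Subset (nV G)} {B₁ B₂ : Subset (nE G)} (sp₁ : Sparse G B₁) (tY : Tight G B₁ Y)
           (sp₂ : Sparse G B₂) (eq : ins G B₂ Y ≡ ins G B₁ Y) where

    private
      B′ : Subset (nE G)
      B′ = override Y B₁ B₂

      B′-outside : ∀ e → inside G Y e ≡ false → B′ e ≡ B₁ e
      B′-outside e h rewrite h = refl

      B′-inside : ∀ e → inside G Y e ≡ true → B′ e ≡ B₂ e
      B′-inside e h rewrite h = refl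

      ins-Y : ins G B′ Y ≡ ins G B₁ Y
      ins-Y = trans (ins-cong B′-inside) eq

      arith : ∀ w y u i bw by bu bi → 2 * y ≤ by + 2 → u + i ≡ w + y →
        bw + by ≤ bu + bi → bi + 2 ≤ 2 * i → bu + 2 ≤ 2 * u → bw + 2 ≤ 2 * w
      arith w y u i bw by bu bi p q r s t =
        linear (+-mono-≤ (+-mono-≤ (+-mono-≤ p (≤-reflexive q)) (≤-reflexive q)) (+-mono-≤ r (+-mono-≤ s t)))
          (solve (w ∷ y ∷ u ∷ i ∷ bw ∷ by ∷ bu ∷ bi ∷ []))

    -- Uncrossing: a set W violating sparsity of B′ could be replaced by W ∪ Y or W ∩ Y,
    -- on which B′ has as many edges as B₁ resp. B₂.
    override-sparse : Sparse G B′
    override-sparse W {w} w∈W with any? (λ v → (W ∩ Y) v Bool.≟ true)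
    ... | no disjoint rewrite ins-cong {W} {B₁} {B′} (λ e e∈W → B′-outside e (≢true⇒≡false λ e∈Y →
            disjoint (src G e , ∩-intro {X = W} {Y} (proj₁ (∧-elim e∈W)) (proj₁ (∧-elim e∈Y))))) = sp₁ W w∈W
    ... | yes (v , v∈) =
      arith (count W) (count Y) (count (W ∪ Y)) (count (W ∩ Y))
        (ins G B′ W) (ins G B′ Y) (ins G B′ (W ∪ Y)) (ins G B′ (W ∩ Y))
        (subst (λ z → 2 * count Y ≤ z + 2) (sym ins-Y) (edges≥ tY))
        (count-∪-∩ W Y) (ins-supermodular B′ W Y)
        (subst (λ z → z + 2 ≤ 2 * count (W ∩ Y)) (sym ins-∩) (sp₂ _ v∈))
        (subst (λ z → z + 2 ≤ 2 * count (W ∪ Y)) (sym ins-∪) (sp₁ _ (∪-introˡ {X = W} {Y} w w∈W)))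
      where
      ins-∩ : ins G B′ (W ∩ Y) ≡ ins G B₂ (W ∩ Y)
      ins-∩ = ins-cong λ e h → B′-inside e (inside-mono {G} {W ∩ Y} {Y} (λ x → proj₂ ∘ ∧-elim) e h)
      ins-∪ : ins G B′ (W ∪ Y) ≡ ins G B₁ (W ∪ Y)
      ins-∪ = +-cancelʳ-≡ _ _ _ (trans (ins-outside B′-outside (∪-introʳ {X = W} {Y})) (cong (ins G B₁ (W ∪ Y) +_) ins-Y))

    override-replaces : Replaces Y B₁ B′
    override-replaces = record { outside = B′-outside ; sparse′ = override-sparse ; ins-≡ = ins-Y }

  -- Tight sets containing `x` and `y` are closed under intersection, so one of least size lies in
  -- all others. If an edge outside `B` joins `x` and `y`, the circuit it closes consists of it and
  -- the edges of `B` inside `D`.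
  minimal-tight : ∀ {B} → Sparse G B → Tight G B all → ∀ x y →
    ¬ ¬ (∃ λ D → Tight G B D × x ∈ˢ D × y ∈ˢ D × (∀ Y → Tight G B Y → x ∈ˢ Y → y ∈ˢ Y → D ⊆ˢ Y))
  minimal-tight {B} sp t x y = do
    ((D , tD , x∈D , y∈D) , least) ← minimiser {A = ∃ λ D → Tight G B D × x ∈ˢ D × y ∈ˢ D}
      (count ∘ proj₁) (all , t , refl , refl)
    return (D , tD , x∈D , y∈D , λ Y tY x∈Y y∈Y v v∈D →
      [ id , (λ v∉Y → ⊥-elim (<⇒≱ (count-⊂ {X = Y ∩ D} {D} (λ _ → proj₂ ∘ ∧-elim) v (cong (_∧ D v) v∉Y) v∈D)
        (least (Y ∩ D , tight-∩ {G} sp tY tD x∈Y x∈D , ∩-intro {X = Y} {D} x∈Y x∈D , ∩-intro {X = Y} {D} y∈Y y∈D)))) ]′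
      (true-or-false (Y v)))

-- Connectivity by cuts

opaque
  unfolding count

  count-split : ∀ {n} (X P : Subset n) → count (X ∩ P) + count (X ∩ ∁ P) ≡ count X
  count-split X P = trans (sym (∑-+ (λ i → ⟦ (X ∩ P) i ⟧) _)) (∑-cong λ i → lemma (X i) (P i))
    where
    lemma : ∀ a b → ⟦ a ∧ b ⟧ + ⟦ a ∧ not b ⟧ ≡ ⟦ a ⟧
    lemma = by-cases (∀ᵇ? λ a → ∀ᵇ? λ b → _ ℕ.≟ _)

count-unique : ∀ {n} {X : Subset n} → (∀ {i j} → i ∈ˢ X → j ∈ˢ X → i ≡ j) → count X ≤ 1
count-unique {X = X} uniq with any? (λ i → X i Bool.≟ true)
... | yes (i , i∈X) = ≤-trans (count-mono λ j j∈X → subst (λ k → (i == k) ≡ true) (uniq i∈X j∈X) (==-refl i))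
                              (≤-reflexive (count-δ i))
... | no none = ≤-trans (≤-reflexive (count-none λ i → ≢true⇒≡false λ h → none (i , h))) z≤n

-- Connectivity is stated through cuts c rather than paths: this survives contracting and
-- redirecting edges.
Connects : ∀ {m n} (s t : Fin m → Fin n) → Subset m → Subset n → Set
Connects s t T X = ∀ (c : Subset _) → (∀ e → e ∈ˢ T → c (s e) ≡ c (t e)) → ∀ {u v} → u ∈ˢ X → v ∈ˢ X → c u ≡ c v

module _ {m n : ℕ} (s t : Fin m → Fin n) (X : Subset n) where

  private
    -- Union-find in miniature: each of the `k` edges of `T` merges two labels and costs at most one
    -- representative. Labels are vertices because initially every vertex labels itself.
    record Labelling (T : Subset m) (k : ℕ) : Set where
      field
        label     : Fin n → Fin n
        reps      : Subset n
        many      : count X ≤ count reps + k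
        reps⊆X    : reps ⊆ˢ X
        injective : ∀ {u v} → u ∈ˢ reps → v ∈ˢ reps → label u ≡ label v → u ≡ v
        constant  : ∀ e → e ∈ˢ T → label (s e) ≡ label (t e)
    open Labelling

    labelling : ∀ k T → count T ≡ k → Labelling T k
    labelling zero T h = record
      { label = id ; reps = X ; many = m≤m+n _ _ ; reps⊆X = λ _ → id
      ; injective = λ _ _ → id
      ; constant = λ e e∈T → ⊥-elim (<⇒≱ (count-∈ {X = T} e∈T) (≤-reflexive h)) }
    labelling (suc k) T h with count-∃ {X = T} (≤-trans (s≤s z≤n) (≤-reflexive (sym h)))
    ... | e , e∈T = record
      { label = p
      ; reps = reps L ∩ ∁ merged
      ; many = arith _ _ _ _ (many L) (count-split (reps L) merged) at-most-one
      ; reps⊆X = λ v → reps⊆X L v ∘ proj₁ ∘ ∧-elim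
      ; injective = λ {u} {v} hu hv eq → injective L (proj₁ (∧-elim hu)) (proj₁ (∧-elim hv))
          (trans (sym (p-unmerged u (unmerged u hu))) (trans eq (p-unmerged v (unmerged v hv))))
      ; constant = const }
      where
      L : Labelling (remove T e) k
      L = labelling k (remove T e) (suc-injective (trans (+-comm 1 _) (trans (count-remove-1 T e e∈T) h)))
      -- The class of `t e` takes the label of `s e`, and its representative, of which there is at
      -- most one, is dropped. If both classes already agree, this is wasteful but still correct.
      merged : Subset n
      merged v = label L v == label L (t e)
      p : Fin n → Fin n
      p v = if merged v then label L (s e) else label L v
      p-unmerged : ∀ v → merged v ≡ false → p v ≡ label L v
      p-unmerged v q rewrite q = refl
      unmerged : ∀ v → v ∈ˢ (reps L ∩ ∁ merged) → merged v ≡ false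
      unmerged v q with merged v | proj₂ (∧-elim {reps L v} q)
      ... | false | _ = refl
      at-most-one : count (reps L ∩ merged) ≤ 1
      at-most-one = count-unique λ {u} {v} hu hv → injective L (proj₁ (∧-elim hu)) (proj₁ (∧-elim hv))
        (trans (==⇒≡ (proj₂ (∧-elim {reps L u} hu))) (sym (==⇒≡ (proj₂ (∧-elim {reps L v} hv)))))
      arith : ∀ x r a b → x ≤ r + k → a + b ≡ r → a ≤ 1 → x ≤ b + suc k
      arith x r a b q refl w = linear (+-mono-≤ q w) (solve (x ∷ a ∷ b ∷ k ∷ []))
      const : ∀ e′ → e′ ∈ˢ T → p (s e′) ≡ p (t e′)
      const e′ e′∈T with e ≟ e′
      ... | no e≢e′ rewrite constant L e′ (remove-∈ {X = T} e≢e′ e′∈T) = refl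
      ... | yes refl rewrite ==-refl (label L (t e)) with merged (s e)
      ...   | true = refl
      ...   | false = refl

  -- The vertices with a given label form a cut that no edge of `T` crosses. Hence all
  -- representatives share one label, and there is at most one of them.
  connects-count : ∀ {T} → Connects s t T X → count X ≤ count T + 1
  connects-count {T} conn = ≤-trans (many L) (≤-trans (+-monoˡ-≤ (count T) (count-unique unique)) (≤-reflexive (+-comm 1 _)))
    where
    L : Labelling T (count T)
    L = labelling (count T) T refl
    unique : ∀ {u v} → u ∈ˢ reps L → v ∈ˢ reps L → u ≡ v
    unique {u} {v} hu hv = injective L hu hv (sym (==⇒≡ (trans
      (conn (λ w → label L w == label L u) (λ e e∈T → cong (_== label L u) (constant L e e∈T)) (reps⊆X L v hv) (reps⊆X L u hu))
      (==-refl (label L u)))))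

==-sym : ∀ {n} (i j : Fin n) → (i == j) ≡ (j == i)
==-sym i j with i ≟ j | j ≟ i
... | yes _ | yes _ = refl
... | no _ | no _ = refl
... | yes p | no q = ⊥-elim (q (sym p))
... | no p | yes q = ⊥-elim (p (sym q))

module _ (G : Graph) {k : ℕ} (part : Fin (nV G) → Fin k) where

  split : Subset (nE G)
  split e = not (part (src G e) == part (tgt G e))

  opaque
    unfolding ins count

    count-classes : ∀ W → ∑ (λ i → count (classOf G W part i)) ≡ count W
    count-classes W = trans (∑-swap λ i v → ⟦ classOf G W part i v ⟧) (∑-cong λ v →
      trans (∑-cong λ i → lemma (W v) (part v == i)) (∑-δ (part v) λ _ → ⟦ W v ⟧))
      where
      lemma : ∀ a b → ⟦ a ∧ b ⟧ ≡ ⟦ b ⟧ * ⟦ a ⟧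
      lemma = by-cases (∀ᵇ? λ a → ∀ᵇ? λ b → _ ℕ.≟ _)

    ins-classes : ∀ B W → ∑ (λ i → ins G B (classOf G W part i)) + count (B ∩ (inside G W ∩ split)) ≡ ins G B W
    ins-classes B W = trans (cong (_+ count (B ∩ (inside G W ∩ split))) (trans
      (∑-swap λ i e → ⟦ (B ∩ inside G (classOf G W part i)) e ⟧) (∑-cong λ e →
      trans (∑-cong λ i → lemma (B e) (W (src G e)) (W (tgt G e)) (part (src G e) == i) (part (tgt G e) == i))
        (∑-δ (part (src G e)) λ i → ⟦ (B e ∧ inside G W e) ∧ (part (tgt G e) == i) ⟧))))
      (trans (sym (∑-+ (λ e → ⟦ (B e ∧ inside G W e) ∧ (part (tgt G e) == part (src G e)) ⟧) _)) (∑-cong pointwise))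
      where
      lemma : ∀ b x y p q → ⟦ b ∧ ((x ∧ p) ∧ (y ∧ q)) ⟧ ≡ ⟦ p ⟧ * ⟦ (b ∧ (x ∧ y)) ∧ q ⟧
      lemma = by-cases (∀ᵇ? λ b → ∀ᵇ? λ x → ∀ᵇ? λ y → ∀ᵇ? λ p → ∀ᵇ? λ q → _ ℕ.≟ _)
      lemma′ : ∀ b x q → ⟦ (b ∧ x) ∧ q ⟧ + ⟦ b ∧ (x ∧ not q) ⟧ ≡ ⟦ b ∧ x ⟧
      lemma′ = by-cases (∀ᵇ? λ b → ∀ᵇ? λ x → ∀ᵇ? λ q → _ ℕ.≟ _)
      pointwise : ∀ e → ⟦ (B e ∧ inside G W e) ∧ (part (tgt G e) == part (src G e)) ⟧ + ⟦ B e ∧ (inside G W e ∧ split e) ⟧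
        ≡ ⟦ B e ∧ inside G W e ⟧
      pointwise e rewrite ==-sym (part (tgt G e)) (part (src G e)) = lemma′ (B e) (inside G W e) _

-- Maximal tight sets

module _ {n : ℕ} (r : Fin n → Subset n) (R : Subset n)
  (r-refl : ∀ {u} → u ∈ˢ R → u ∈ˢ r u)
  (r-sym : ∀ {u v} → u ∈ˢ R → v ∈ˢ R → v ∈ˢ r u → u ∈ˢ r v) where

  -- A greedily built maximal independent set of the symmetric relation `r`. `P` marks the vertices
  -- treated so far, so that the set can grow vertex by vertex.
  record Representatives (P : Fin n → Set) : Set where
    field
      size        : ℕ
      rep         : Fin size → Fin n
      rep∈R       : ∀ i → rep i ∈ˢ R
      independent : ∀ {i j} → rep j ∈ˢ r (rep i) → i ≡ j
      covers      : ∀ {u} → P u → u ∈ˢ R → ∃ λ i → u ∈ˢ r (rep i)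

  private
    extend : ∀ {P Q : Fin n → Set} u → (∀ {v} → Q v → v ≡ u ⊎ P v) → Representatives P → Representatives Q
    extend {P} {Q} u Q⊆ S with R u Bool.≟ true | any? (λ i → r (Representatives.rep S i) u Bool.≟ true)
    ... | no u∉R | _ = record
      { Representatives S
      ; covers = λ q v∈R → case Q⊆ q of λ { (inj₁ refl) → ⊥-elim (u∉R v∈R) ; (inj₂ p) → Representatives.covers S p v∈R } }
    ... | yes _ | yes c = record
      { Representatives S
      ; covers = λ q v∈R → case Q⊆ q of λ { (inj₁ refl) → c ; (inj₂ p) → Representatives.covers S p v∈R } }
    ... | yes u∈R | no ¬c = record
      { size = suc (Representatives.size S)
      ; rep = rep′
      ; rep∈R = λ { zero → u∈R ; (suc i) → Representatives.rep∈R S i }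
      ; independent = λ {i} {j} → indep i j
      ; covers = λ q v∈R → case Q⊆ q of λ
          { (inj₁ refl) → zero , r-refl u∈R
          ; (inj₂ p) → case Representatives.covers S p v∈R of λ { (i , h) → suc i , h } } }
      where
      rep′ : Fin (suc (Representatives.size S)) → Fin n
      rep′ zero = u
      rep′ (suc i) = Representatives.rep S i
      indep : ∀ i j → rep′ j ∈ˢ r (rep′ i) → i ≡ j
      indep zero zero _ = refl
      indep zero (suc j) h = ⊥-elim (¬c (j , r-sym u∈R (Representatives.rep∈R S j) h))
      indep (suc i) zero h = ⊥-elim (¬c (i , h))
      indep (suc i) (suc j) h = cong suc (Representatives.independent S h)

    none : Representatives (λ _ → ⊥)
    none = record { size = 0 ; rep = λ () ; rep∈R = λ () ; independent = λ { {()} } ; covers = λ () }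

    upTo : ∀ m (f : Fin m → Fin n) → Representatives (λ v → ∃ λ i → v ≡ f i)
    upTo zero f = extend-⊥ none
      where
      extend-⊥ : Representatives (λ _ → ⊥) → Representatives (λ v → ∃ λ (i : Fin 0) → v ≡ f i)
      extend-⊥ S = record { Representatives S ; covers = λ { (() , _) } }
    upTo (suc m) f = extend (f zero) (λ { (zero , p) → inj₁ p ; (suc i , p) → inj₂ (i , p) }) (upTo m (f ∘ suc))

  representatives : Representatives (λ v → ∃ λ i → v ≡ i)
  representatives = upTo n id

module _ {G : Graph} where

  tight-cong : ∀ {B X Y} → X ⊆ˢ Y → Y ⊆ˢ X → Tight G B X → Tight G B Y
  tight-cong {B} {X} {Y} X⊆Y Y⊆X (tight p t) = tight (X⊆Y _ p)
    (≤-trans (*-monoʳ-≤ 2 (count-mono Y⊆X)) (≤-trans t (+-monoˡ-≤ 2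
      (subst₂ _≤_ (sym (ins-count G B X)) (sym (ins-count G B Y)) (count-mono λ e h →
        ∩-intro {X = B} {inside G Y} (proj₁ (∧-elim h)) (inside-mono {G} X⊆Y e (proj₂ (∧-elim {B e} h))))))))

  record Components (B : Subset (nE G)) (R : Subset (nV G)) : Set where
    field
      cells       : ℕ
      cell        : Fin (nV G) → Fin cells
      class-tight : ∀ i → Tight G B (classOf G R cell i)
      absorbs     : ∀ {Y v} → Tight G B Y → Y ⊆ˢ R → v ∈ˢ Y → Y ⊆ˢ classOf G R cell (cell v)

  MaximalTight : Subset (nE G) → Subset (nV G) → Fin (nV G) → Subset (nV G) → Set
  MaximalTight B R u Z = Tight G B Z × Z ⊆ˢ R × u ∈ˢ Z × (∀ Y → Tight G B Y → Y ⊆ˢ R → ∀ {v} → v ∈ˢ Y → v ∈ˢ Z → Y ⊆ˢ Z)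

  -- Minimising the complement makes `Z` as large as possible; a tight `Y` meeting `Z` could
  -- otherwise be joined to it by `tight-∪`.
  maximal-tight : ∀ {B} → Sparse G B → ∀ R u → u ∈ˢ R → ¬ ¬ ∃ (MaximalTight B R u)
  maximal-tight {B} sp R u u∈R = do
    ((Z , tZ , Z⊆R , u∈Z) , least) ← minimiser {A = ∃ λ Z → Tight G B Z × Z ⊆ˢ R × u ∈ˢ Z} (λ Z → count (∁ (proj₁ Z)))
      ((u ==_) , tight-singleton B u , (λ v h → subst (_∈ˢ R) (==⇒≡ h) u∈R) , ==-refl u)
    return (Z , tZ , Z⊆R , u∈Z , λ Y tY Y⊆R {_} v∈Y v∈Z w w∈Y → [ id , (λ w∉Z → ⊥-elim (<⇒≱
      (count-⊂ {X = ∁ (Z ∪ Y)} {∁ Z} (∁-anti {Z} {Y}) w (cong not (∪-introʳ {X = Z} {Y} w w∈Y)) (cong not w∉Z))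
      (least (Z ∪ Y , tight-∪ {G} sp tZ tY v∈Z v∈Y , ∪-elim {X = Z} {Y} {R} Z⊆R Y⊆R , ∪-introˡ {X = Z} {Y} u u∈Z)))) ]′
      (true-or-false (Z w)))
    where
    ∁-anti : ∀ {Z Y : Subset (nV G)} → ∁ (Z ∪ Y) ⊆ˢ ∁ Z
    ∁-anti {Z} v h with Z v
    ... | false = refl

  components : ∀ {B} → Sparse G B → ∀ R {v} → v ∈ˢ R → ¬ ¬ Components B R
  components {B} sp R {v₀} v₀∈R = do
    zs ← ¬¬-∀ _ {λ u → ∃ λ Z → u ∈ˢ R → MaximalTight B R u Z} λ u → case R u Bool.≟ true of λ
      { (yes u∈R) → maximal-tight sp R u u∈R >>= λ (Z , m) → return (Z , λ _ → m)
      ; (no u∉R) → return (all , λ u∈R → ⊥-elim (u∉R u∈R)) }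
    return (build (proj₁ ∘ zs) (λ u → proj₂ (zs u)))
    where
    build : (Z : Fin (nV G) → Subset (nV G)) → (∀ u → u ∈ˢ R → MaximalTight B R u (Z u)) → Components B R
    build Z max = record
      { cells = size
      ; cell = cell
      ; class-tight = λ i → tight-cong (Z⊆class i) (class⊆Z i) (proj₁ (max _ (rep∈R i)))
      ; absorbs = λ {Y} {v} tY Y⊆R v∈Y w w∈Y → Z⊆class (cell v) w
          (proj₂ (proj₂ (proj₂ (max _ (rep∈R (cell v))))) Y tY Y⊆R v∈Y (cell-rep v (Y⊆R _ v∈Y)) w w∈Y)
      }
      where
      Z-⊆ : ∀ {u v} → u ∈ˢ R → v ∈ˢ R → v ∈ˢ Z u → Z u ⊆ˢ Z v
      Z-⊆ {u} {v} u∈R v∈R v∈Z =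
        proj₂ (proj₂ (proj₂ (max v v∈R))) (Z u) (proj₁ (max u u∈R)) (proj₁ (proj₂ (max u u∈R))) v∈Z
          (proj₁ (proj₂ (proj₂ (max v v∈R))))
      Z-sym : ∀ {u v} → u ∈ˢ R → v ∈ˢ R → v ∈ˢ Z u → u ∈ˢ Z v
      Z-sym {u} u∈R v∈R v∈Z = Z-⊆ u∈R v∈R v∈Z u (proj₁ (proj₂ (proj₂ (max u u∈R))))
      open Representatives (representatives Z R (λ {u} u∈R → proj₁ (proj₂ (proj₂ (max u u∈R)))) Z-sym)
      pick : ∀ v → Σ (Fin size) λ i → v ∈ˢ R → v ∈ˢ Z (rep i)
      pick v with R v Bool.≟ true
      ... | yes v∈R = proj₁ (covers (v , refl) v∈R) , λ _ → proj₂ (covers (v , refl) v∈R)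
      -- The labelling is total, so vertices outside `R` borrow the label of `v₀`. This is the
      -- reason for asking that `R` be nonempty.
      ... | no v∉R = proj₁ (covers (v₀ , refl) v₀∈R) , λ v∈R → ⊥-elim (v∉R v∈R)
      cell : Fin (nV G) → Fin size
      cell v = proj₁ (pick v)
      cell-rep : ∀ v → v ∈ˢ R → v ∈ˢ Z (rep (cell v))
      cell-rep v = proj₂ (pick v)
      class⊆Z : ∀ i → classOf G R cell i ⊆ˢ Z (rep i)
      class⊆Z i v h = subst (λ j → v ∈ˢ Z (rep j)) (==⇒≡ (proj₂ (∧-elim {R v} h))) (cell-rep v (proj₁ (∧-elim h)))
      Z⊆class : ∀ i → Z (rep i) ⊆ˢ classOf G R cell i
      Z⊆class i v h = ∩-intro {X = R} {λ w → cell w == i} v∈R (subst (λ j → (cell v == j) ≡ true) cell≡ (==-refl (cell v)))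
        where
        v∈R : v ∈ˢ R
        v∈R = proj₁ (proj₂ (max _ (rep∈R i))) v h
        cell≡ : cell v ≡ i
        cell≡ = independent (Z-⊆ v∈R (rep∈R (cell v)) (Z-sym (rep∈R (cell v)) v∈R (cell-rep v v∈R)) (rep i)
          (Z-sym (rep∈R i) v∈R h))

  -- In the sparsity matroid: B contains a basis of G[R].
  Saturated : Subset (nE G) → Subset (nV G) → Set
  Saturated B R = ∀ e → e ∈ˢ inside G R → B e ≡ false → ¬ ¬ (∃ λ Y → Tight G B Y × Y ⊆ˢ R × e ∈ˢ inside G Y)

  module _ {B : Subset (nE G)} {R : Subset (nV G)} (C : Components B R) (sat : Saturated B R) where
    open Components C

    -- An edge of `G[R]` outside `B` lies in a tight subset of `R`, and such a subset is absorbed by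
    -- a single class.
    split-edge∈ : ∀ e → e ∈ˢ inside G R → e ∈ˢ split G cell → e ∈ˢ B
    split-edge∈ e e∈R cross with B e in eq
    ... | true = refl
    ... | false = ⊥-elim (sat e e∈R eq λ (Y , tY , Y⊆R , e∈Y) →
      true≢false (trans (==-sym (cell (src G e)) _)
        (proj₂ (∧-elim {R (tgt G e)} (absorbs tY Y⊆R (proj₁ (∧-elim e∈Y)) (tgt G e) (proj₂ (∧-elim {Y (src G e)} e∈Y))))))
        (not-true cross))

    module _ {Y : Subset (nV G)} (Y⊆R : Y ⊆ˢ R) {y₀ : Fin (nV G)} (y₀∈Y : y₀ ∈ˢ Y) {U₁ U₂ : Subset (nE G)}
             (in₁ : U₁ ⊆ˢ inside G Y) (in₂ : U₂ ⊆ˢ inside G Y) (disjoint : ∀ e → e ∈ˢ U₁ → e ∈ˢ U₂ → ⊥)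
             (conn₁ : Connects (src G) (tgt G) U₁ Y) (conn₂ : Connects (src G) (tgt G) U₂ Y) where

      private
        hit? : ∀ i → Dec (∃ λ v → v ∈ˢ Y × cell v ≡ i)
        hit? i = any? λ v → (Y v Bool.≟ true) ×-dec (cell v ≟ i)

        I : Subset cells
        I i = does (hit? i)

        W : Subset (nV G)
        W = R ∩ (I ∘ cell)

        Y⊆W : Y ⊆ˢ W
        Y⊆W v v∈Y = ∩-intro {X = R} {I ∘ cell} (Y⊆R v v∈Y) (dec-true (hit? (cell v)) (v , v∈Y , refl))

        quotient-connects : ∀ {U} → U ⊆ˢ inside G Y → Connects (src G) (tgt G) U Y →
          Connects (cell ∘ src G) (cell ∘ tgt G) (U ∩ split G cell) I
        quotient-connects {U} inY conn c const {i} {j} i∈I j∈I with hit? i | hit? j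
        ... | yes (u , u∈Y , refl) | yes (v , v∈Y , refl) = conn (c ∘ cell) lemma u∈Y v∈Y
          where
          lemma : ∀ e → e ∈ˢ U → c (cell (src G e)) ≡ c (cell (tgt G e))
          lemma e e∈U with cell (src G e) == cell (tgt G e) in eq
          ... | true = cong c (==⇒≡ eq)
          ... | false = const e (∩-intro {X = U} {split G cell} e∈U (cong not eq))

        crossing : Subset (nE G)
        crossing = B ∩ (inside G W ∩ split G cell)

        ⊆crossing : ∀ {U} → U ⊆ˢ inside G Y → (U ∩ split G cell) ⊆ˢ crossing
        ⊆crossing {U} inY e h = ∩-intro {X = B} {inside G W ∩ split G cell}
            (split-edge∈ e (inside-mono {G} Y⊆R e (inY e e∈U)) e∈s)
            (∩-intro {X = inside G W} {split G cell} (inside-mono {G} Y⊆W e (inY e e∈U)) e∈s)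
          where
          e∈U : e ∈ˢ U
          e∈U = proj₁ (∧-elim h)
          e∈s : e ∈ˢ split G cell
          e∈s = proj₂ (∧-elim {U e} h)

        U₁′ U₂′ : Subset (nE G)
        U₁′ = U₁ ∩ split G cell
        U₂′ = U₂ ∩ split G cell

        many-crossing : count U₁′ + count U₂′ ≤ count crossing
        many-crossing = ≤-trans (≤-trans (≤-reflexive (sym (count-∪-∩ U₁′ U₂′)))
          (≤-trans (+-monoʳ-≤ (count (U₁′ ∪ U₂′)) (≤-reflexive (count-none empty))) (≤-reflexive (+-identityʳ _))))
          (count-mono (∪-elim {X = U₁′} {U₂′} (⊆crossing in₁) (⊆crossing in₂)))
          where
          empty : ∀ e → (U₁′ ∩ U₂′) e ≡ false
          empty e = ≢true⇒≡false λ h → disjoint e (proj₁ (∧-elim (proj₁ (∧-elim {U₁′ e} h)))) (proj₁ (∧-elim (proj₂ (∧-elim {U₁′ e} h))))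

        class-bound : ∀ i → 2 * count (classOf G W cell i) ≤ ins G B (classOf G W cell i) + 2 * ⟦ I i ⟧
        class-bound i with I i in eq
        ... | true = edges≥ (tight-cong to from (class-tight i))
          where
          to : classOf G R cell i ⊆ˢ classOf G W cell i
          to v h = ∩-intro {X = W} {λ w → cell w == i} (∩-intro {X = R} {I ∘ cell} (proj₁ (∧-elim h))
            (trans (cong I (==⇒≡ (proj₂ (∧-elim {R v} h)))) eq)) (proj₂ (∧-elim {R v} h))
          from : classOf G W cell i ⊆ˢ classOf G R cell i
          from v h = ∩-intro {X = R} {λ w → cell w == i} (proj₁ (∧-elim (proj₁ (∧-elim {W v} h)))) (proj₂ (∧-elim {W v} h))
        -- A class that `Y` misses has no vertex in `W`, and contributes nothing to either side.
        ... | false = ≤-trans (≤-reflexive (cong (2 *_) (count-none λ v → ≢true⇒≡false λ h →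
            true≢false (proj₂ (∧-elim {R v} (proj₁ (∧-elim {W v} h)))) (trans (cong I (==⇒≡ (proj₂ (∧-elim {W v} h)))) eq)))) z≤n

        total : 2 * count W ≤ ∑ (λ i → ins G B (classOf G W cell i)) + 2 * count I
        total = subst₂ _≤_
          (trans (∑-*ˡ 2 λ i → count (classOf G W cell i)) (cong (2 *_) (count-classes G cell W)))
          (trans (∑-+ (λ i → ins G B (classOf G W cell i)) _)
            (cong (∑ (λ i → ins G B (classOf G W cell i)) +_)
              (trans (∑-*ˡ 2 λ i → ⟦ I i ⟧) (cong (2 *_) (sym (count-∑ I))))))
          (∑-mono class-bound)

        arith : ∀ w s i c b a₁ a₂ → 2 * w ≤ s + 2 * i → s + c ≡ b → i ≤ a₁ + 1 → i ≤ a₂ + 1 → a₁ + a₂ ≤ c → 2 * w ≤ b + 2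
        arith w s i c b a₁ a₂ p refl q₁ q₂ r =
          linear (+-mono-≤ (+-mono-≤ p q₁) (+-mono-≤ q₂ r)) (solve (w ∷ s ∷ i ∷ c ∷ a₁ ∷ a₂ ∷ []))

      -- Take the union W of the classes met by Y, say i of them. Contracting them turns `U₁` and
      -- `U₂` into connected graphs on i vertices, so each has at least i - 1 edges between classes.
      -- These are all distinct and in `B`, and each class X carries `2 * count X - 2` further edges
      -- of `B`. Together this makes W tight.
      tight-hull : ∃ λ W → Tight G B W × Y ⊆ˢ W × W ⊆ˢ R
      tight-hull = W , tight (Y⊆W _ y₀∈Y)
          (arith (count W) _ (count I) (count crossing) (ins G B W) (count U₁′) (count U₂′) total (ins-classes G cell B W)
            (connects-count _ _ I (quotient-connects in₁ conn₁)) (connects-count _ _ I (quotient-connects in₂ conn₂)) many-crossing)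
        , Y⊆W , λ _ → proj₁ ∘ ∧-elim

module _ {G : Graph} where

  reach-constant : ∀ {T} {c : Subset (nV G)} → (∀ e → e ∈ˢ T → c (src G e) ≡ c (tgt G e)) →
    ∀ {u v} → Reach G T u v → c u ≡ c v
  reach-constant h here = refl
  reach-constant h (fwd e e∈T r) = trans (h e e∈T) (reach-constant h r)
  reach-constant h (bwd e e∈T r) = trans (sym (h e e∈T)) (reach-constant h r)

  spanningTree⇒connects : ∀ {X T} → SpanningTree G X T → Connects (src G) (tgt G) T X
  spanningTree⇒connects (_ , conn , _) c h u∈X v∈X = reach-constant h (conn _ _ u∈X v∈X)

  spanningTree⇒inside : ∀ {X T} → SpanningTree G X T → T ⊆ˢ inside G X
  spanningTree⇒inside {X} (ind , _) e e∈T = ∩-intro {X = X ∘ src G} {X ∘ tgt G} (proj₁ (ind e e∈T)) (proj₂ (ind e e∈T))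

  treeConnected-hull : ∀ {B R Y} → Components B R → Saturated B R → Y ⊆ˢ R → TreeConnected G 2 Y →
    ∃ λ W → Tight G B W × Y ⊆ˢ W × W ⊆ˢ R
  treeConnected-hull C sat Y⊆R ((_ , y∈Y) , Ts , trees , disjoint) =
    tight-hull C sat Y⊆R y∈Y (spanningTree⇒inside (trees zero)) (spanningTree⇒inside (trees (suc zero)))
      (λ e → disjoint zero (suc zero) e λ ())
      (spanningTree⇒connects (trees zero)) (spanningTree⇒connects (trees (suc zero)))

  sparse-∅ : Sparse G (λ _ → false)
  sparse-∅ X v∈X rewrite ins-count G (λ _ → false) X | count-none {X = (λ _ → false) ∩ inside G X} (λ _ → refl) =
    *-monoʳ-≤ 2 (count-∈ {X = X} v∈X)

  maximal-sparse : ¬ ¬ (∃ λ B → Sparse G B × Saturated B all)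
  maximal-sparse = do
    ((B , sp) , least) ← minimiser {A = ∃ (Sparse G)} (λ B → count (∁ (proj₁ B))) (_ , sparse-∅)
    return (B , sp , λ e _ e∉B none → <⇒≱
      (count-⊂ {X = ∁ (insert B e)} {∁ B} (∁-anti B e) e (cong not (insert-∈ {X = B} e)) (cong not e∉B))
      (least (insert B e , insert-sparse {G} sp e∉B λ Y tY e∈Y → none (Y , tY , (λ _ _ → refl) , e∈Y))))
    where
    ∁-anti : ∀ B e → ∁ (insert B e) ⊆ˢ ∁ B
    ∁-anti B e g h with e == g | B g
    ... | false | false = refl

  -- The given trees enter through the hull: for a maximal sparse set, the hull of the whole vertex
  -- set is tight and can only be the whole vertex set.
  tight-base : TreeConnected G 2 (full G) → ¬ ¬ (∃ λ B → Sparse G B × Tight G B all)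
  tight-base tc@((v , _) , _) = do
    (B , sp , sat) ← maximal-sparse
    C ← components sp all {v} refl
    let (W , tW , all⊆W , _) = treeConnected-hull C sat (λ _ _ → refl) tc
    return (B , sp , tight-cong (λ _ _ → refl) all⊆W tW)

  opaque
    unfolding ins count

    -- An edge of `B` with 0, 1 or 2 ends in `S` contributes 1, 1 or 2 to each side.
    degree-sum : ∀ B S → count B + ins G B S ≡ ins G B (∁ S) + ∑ (λ v → ⟦ S v ⟧ * deg G B v)
    degree-sum B S = begin
      count B + ins G B S
        ≡⟨ ∑₂-≡ (λ e → by-ends (B e) (S (src G e)) (S (tgt G e))) ⟩
      ins G B (∁ S) + ∑ (λ e → ⟦ B e ∧ S (src G e) ⟧ + ⟦ B e ∧ S (tgt G e) ⟧)
        ≡⟨ cong (ins G B (∁ S) +_) (∑-cong λ e → cong₂ _+_ (∑-δ (src G e) λ v → ⟦ B e ∧ S v ⟧) (∑-δ (tgt G e) λ v → ⟦ B e ∧ S v ⟧)) ⟨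
      ins G B (∁ S) + ∑ (λ e → ∑ (λ v → ⟦ src G e == v ⟧ * ⟦ B e ∧ S v ⟧) + ∑ (λ v → ⟦ tgt G e == v ⟧ * ⟦ B e ∧ S v ⟧))
        ≡⟨ cong (ins G B (∁ S) +_) (∑-cong λ e → trans
             (∑-cong λ v → by-incidence (B e) (S v) (src G e == v) (tgt G e == v) (loop-free {G} e v)) (∑-+ _ _)) ⟨
      ins G B (∁ S) + ∑ (λ e → ∑ (λ v → ⟦ S v ⟧ * ⟦ (B ∩ inc G v) e ⟧))
        ≡⟨ cong (ins G B (∁ S) +_) (∑-swap _) ⟨
      ins G B (∁ S) + ∑ (λ v → ∑ (λ e → ⟦ S v ⟧ * ⟦ (B ∩ inc G v) e ⟧))
        ≡⟨ cong (ins G B (∁ S) +_) (∑-cong λ v → ∑-*ˡ ⟦ S v ⟧ _) ⟩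
      ins G B (∁ S) + ∑ (λ v → ⟦ S v ⟧ * deg G B v) ∎
      where
      open ≡-Reasoning
      by-ends : ∀ b x y → ⟦ b ⟧ + ⟦ b ∧ (x ∧ y) ⟧ ≡ ⟦ b ∧ (not x ∧ not y) ⟧ + (⟦ b ∧ x ⟧ + ⟦ b ∧ y ⟧)
      by-ends = by-cases (∀ᵇ? λ b → ∀ᵇ? λ x → ∀ᵇ? λ y → _ ℕ.≟ _)
      by-incidence : ∀ b x p q → p ∧ q ≡ false → ⟦ x ⟧ * ⟦ b ∧ (p ∨ q) ⟧ ≡ ⟦ p ⟧ * ⟦ b ∧ x ⟧ + ⟦ q ⟧ * ⟦ b ∧ x ⟧
      by-incidence = by-cases (∀ᵇ? λ b → ∀ᵇ? λ x → ∀ᵇ? λ p → ∀ᵇ? λ q → (_ Bool.≟ _) →-dec (_ ℕ.≟ _))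

    ins-remove : ∀ B {X} v → ins G B (remove X v) + count (B ∩ (inside G X ∩ inc G v)) ≡ ins G B X
    ins-remove B {X} v = trans (sym (∑-+ (λ e → ⟦ (B ∩ inside G (remove X v)) e ⟧) _)) (∑-cong pointwise)
      where
      lemma : ∀ b x y p q → ⟦ b ∧ ((not p ∧ x) ∧ (not q ∧ y)) ⟧ + ⟦ b ∧ ((x ∧ y) ∧ (p ∨ q)) ⟧ ≡ ⟦ b ∧ (x ∧ y) ⟧
      lemma = by-cases (∀ᵇ? λ b → ∀ᵇ? λ x → ∀ᵇ? λ y → ∀ᵇ? λ p → ∀ᵇ? λ q → _ ℕ.≟ _)
      pointwise : ∀ e → ⟦ (B ∩ inside G (remove X v)) e ⟧ + ⟦ (B ∩ (inside G X ∩ inc G v)) e ⟧ ≡ ⟦ (B ∩ inside G X) e ⟧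
      pointwise e rewrite ==-sym (src G e) v | ==-sym (tgt G e) v = lemma (B e) (X (src G e)) (X (tgt G e)) (v == src G e) (v == tgt G e)

  -- Sparsity of `remove X v`, nonempty because of `w`, leaves at least two of the edges inside the
  -- tight set to be incident with `v`.
  tight-degree : ∀ {B X v w} → Sparse G B → Tight G B X → v ∈ˢ X → w ∈ˢ X → v ≢ w →
    2 ≤ count (B ∩ (inside G X ∩ inc G v))
  tight-degree {B} {X} {v} {w} sp tX v∈X w∈X v≢w =
    arith (count X) (count (remove X v)) (ins G B X) (ins G B (remove X v)) (count (B ∩ (inside G X ∩ inc G v)))
      (edges≥ tX) (sp (remove X v) (remove-∈ {X = X} v≢w w∈X)) (count-remove-1 X v v∈X) (ins-remove B v)
    where
    arith : ∀ x x′ b b′ d → 2 * x ≤ b + 2 → b′ + 2 ≤ 2 * x′ → x′ + 1 ≡ x → b′ + d ≡ b → 2 ≤ d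
    arith x x′ b b′ d p q refl refl = linear (+-mono-≤ p q) (solve (x′ ∷ b′ ∷ d ∷ []))

-- Decomposition of tight sets into two trees

pick : ∀ {n k} (F : Subset n) → count F ≡ suc k → ∃ λ i → i ∈ˢ F × count (remove F i) ≡ k
pick F h with count-∃ {X = F} (≤-trans (s≤s z≤n) (≤-reflexive (sym h)))
... | i , i∈F = i , i∈F , suc-injective (trans (+-comm 1 _) (trans (count-remove-1 F i i∈F) h))

count-0 : ∀ {n} {F : Subset n} → count F ≡ 0 → ∀ i → ¬ i ∈ˢ F
count-0 {F = F} h i i∈F = <⇒≱ (count-∈ {X = F} i∈F) (≤-reflexive h)

∩-mono : ∀ {n} {X Y Z W : Subset n} → X ⊆ˢ Z → Y ⊆ˢ W → (X ∩ Y) ⊆ˢ (Z ∩ W)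
∩-mono {X = X} {Z = Z} {W} f g i h = ∩-intro {X = Z} {W} (f i (proj₁ (∧-elim h))) (g i (proj₂ (∧-elim {X i} h)))

module _ (G : Graph) where

  Joins : Fin (nE G) → Fin (nV G) → Fin (nV G) → Set
  Joins e u v = (src G e ≡ u × tgt G e ≡ v) ⊎ (tgt G e ≡ u × src G e ≡ v)

module _ {G : Graph} where

  other-end : ∀ {e v} → e ∈ˢ inc G v → ∃ λ u → Joins G e v u
  other-end {e} {v} h with src G e ≟ v | tgt G e ≟ v
  ... | yes p | _ = tgt G e , inj₁ (p , refl)
  ... | no _ | yes q = src G e , inj₂ (q , refl)
  other-end () | no _ | no _

  joins-≢ : ∀ {e u v} → Joins G e u v → u ≢ v
  joins-≢ {e} (inj₁ (refl , refl)) p = loopless G e p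
  joins-≢ {e} (inj₂ (refl , refl)) p = loopless G e (sym p)

  joins-inside : ∀ {e u v X} → Joins G e u v → e ∈ˢ inside G X → u ∈ˢ X × v ∈ˢ X
  joins-inside (inj₁ (refl , refl)) h = ∧-elim h
  joins-inside {X = X} (inj₂ (refl , refl)) h = proj₂ (∧-elim h) , proj₁ (∧-elim h)

  inside-joins : ∀ {e u v X} → Joins G e u v → u ∈ˢ X → v ∈ˢ X → e ∈ˢ inside G X
  inside-joins {X = X} (inj₁ (refl , refl)) p q = ∩-intro {X = X ∘ src G} {X ∘ tgt G} p q
  inside-joins {X = X} (inj₂ (refl , refl)) p q = ∩-intro {X = X ∘ src G} {X ∘ tgt G} q p

  joins-constant : ∀ {e u v} {c : Subset (nV G)} → Joins G e u v → c (src G e) ≡ c (tgt G e) → c u ≡ c v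
  joins-constant (inj₁ (refl , refl)) p = p
  joins-constant (inj₂ (refl , refl)) p = sym p

  ins-mono : ∀ {B B′} → B ⊆ˢ B′ → ∀ X → ins G B X ≤ ins G B′ X
  ins-mono {B} {B′} h X = subst₂ _≤_ (sym (ins-count G B X)) (sym (ins-count G B′ X))
    (count-mono (∩-mono {X = B} {inside G X} {B′} {inside G X} h λ _ → id))

  sparse-⊆ : ∀ {B B′} → B ⊆ˢ B′ → Sparse G B′ → Sparse G B
  sparse-⊆ h sp X v∈X = ≤-trans (+-monoˡ-≤ 2 (ins-mono h X)) (sp X v∈X)

  ins-⊆ : ∀ {B X} → B ⊆ˢ inside G X → ins G B X ≡ count B
  ins-⊆ {B} {X} h = ≤-antisym
    (≤-trans (≤-reflexive (ins-count G B X)) (count-mono λ _ → proj₁ ∘ ∧-elim))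
    (≤-trans (count-mono λ e e∈B → ∩-intro {X = B} {inside G X} e∈B (h e e∈B)) (≤-reflexive (sym (ins-count G B X))))

  -- The degrees sum to `2 * count B`, at most `4 * count X - 4`, so their average over `X` is below
  -- 4.
  low-degree-vertex : ∀ {B X v} → Sparse G B → B ⊆ˢ inside G X → v ∈ˢ X → ∃ λ u → u ∈ˢ X × deg G B u ≤ 3
  low-degree-vertex {B} {X} sp B⊆X v∈X with ∑-<⇒∃ {f = λ v → ⟦ X v ⟧ * deg G B v} {λ v → 4 * ⟦ X v ⟧} sum<
    where
    outside-0 : ins G B (∁ X) ≡ 0
    outside-0 = trans (ins-count G B (∁ X)) (count-none λ e → ≢true⇒≡false λ h →
      true≢false {X (src G e)} (proj₁ (∧-elim (B⊆X e (proj₁ (∧-elim h)))))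
        (not-true (proj₁ (∧-elim {not (X (src G e))} (proj₂ (∧-elim {B e} h))))))
    arith : ∀ b x s → b + b ≡ s → b + 2 ≤ 2 * x → s < 4 * x
    arith b x s refl p = ≤-trans (≤-trans (m≤m+n (suc (b + b)) 3) (≤-reflexive (shift b))) (linear (+-mono-≤ p p) (regroup b x))
      where
      shift : ∀ b → suc (b + b) + 3 ≡ b + b + 4
      shift = solve-∀
      regroup : ∀ b x → b + b + 4 + (2 * x + 2 * x) ≡ 4 * x + (b + 2 + (b + 2))
      regroup = solve-∀
    sum< : ∑ (λ v → ⟦ X v ⟧ * deg G B v) < ∑ (λ v → 4 * ⟦ X v ⟧)
    sum< = subst (∑ (λ v → ⟦ X v ⟧ * deg G B v) <_)
      (sym (trans (∑-*ˡ 4 _) (cong (4 *_) (sym (count-∑ X)))))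
      (arith (count B) (count X) _
        (trans (cong (count B +_) (sym (ins-⊆ B⊆X))) (trans (degree-sum {G} B X) (cong (_+ ∑ (λ v → ⟦ X v ⟧ * deg G B v)) outside-0)))
        (subst (λ z → z + 2 ≤ 2 * count X) (ins-⊆ B⊆X) (sp X v∈X)))
  ... | u , p with X u in eq
  ...   | true = u , eq , ≤-pred (subst (_< 4) (+-identityʳ _) p)
  low-degree-vertex sp B⊆X v∈X | u , () | false

module _ (G : Graph) where

  -- The two sets are only asked to connect `X`. That they are trees follows later from the number
  -- of edges, in `spanningTree`.
  record TreePair (B : Subset (nE G)) (X : Subset (nV G)) : Set where
    field
      T₁ T₂    : Subset (nE G)
      T₁⊆B     : T₁ ⊆ˢ B
      T₂⊆B     : T₂ ⊆ˢ B
      disjoint : ∀ e → e ∈ˢ T₁ → e ∈ˢ T₂ → ⊥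
      conn₁    : Connects (src G) (tgt G) T₁ X
      conn₂    : Connects (src G) (tgt G) T₂ X

module _ {n : ℕ} {X : Subset n} {v : Fin n} {c : Subset n} where

  constant-at : (∀ {a b} → a ∈ˢ remove X v → b ∈ˢ remove X v → c a ≡ c b) →
    ∀ {u} → u ∈ˢ remove X v → c v ≡ c u → ∀ {a b} → a ∈ˢ X → b ∈ˢ X → c a ≡ c b
  constant-at h {u} u∈ eq {a} {b} a∈X b∈X = trans (to-u a a∈X) (sym (to-u b b∈X))
    where
    to-u : ∀ a → a ∈ˢ X → c a ≡ c u
    to-u a a∈X with v ≟ a
    ... | yes refl = eq
    ... | no v≢a = h (remove-∈ {X = X} v≢a a∈X) u∈

-- The redirected edge keeps its index, so edge sets of both graphs have the same type and can be
-- compared directly.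
rewire : (G : Graph) → Fin (nE G) → (a b : Fin (nV G)) → a ≢ b → Graph
rewire G e a b a≢b = record
  { nV = nV G ; nE = nE G
  ; src = λ e′ → if e == e′ then a else src G e′
  ; tgt = λ e′ → if e == e′ then b else tgt G e′
  ; loopless = loopless′ }
  where
  loopless′ : ∀ e′ → (if e == e′ then a else src G e′) ≢ (if e == e′ then b else tgt G e′)
  loopless′ e′ with e == e′
  ... | true = a≢b
  ... | false = loopless G e′

insert-∌ : ∀ {n} {X : Subset n} {i j} → i ≢ j → X j ≡ false → insert X i j ≡ false
insert-∌ p q rewrite ≢⇒==-false p = q

module _ {G : Graph} {B : Subset (nE G)} {X : Subset (nV G)} (sp : Sparse G B) (B⊆X : B ⊆ˢ inside G X)
         {v : Fin (nV G)} (v∈X : v ∈ˢ X) where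

  private
    X′ : Subset (nV G)
    X′ = remove X v

    B₀ : Subset (nE G)
    B₀ = B ∩ ∁ (inc G v)

    B₀-inc : ∀ {e} → e ∈ˢ inc G v → B₀ e ≡ false
    B₀-inc {e} h rewrite h with B e
    ... | true = refl
    ... | false = refl

    B₀⊆B : B₀ ⊆ˢ B
    B₀⊆B _ = proj₁ ∘ ∧-elim

    sp₀ : Sparse G B₀
    sp₀ = sparse-⊆ {G} B₀⊆B sp

    B₀⊆X′ : B₀ ⊆ˢ inside G X′
    B₀⊆X′ e h = ∩-intro {X = X′ ∘ src G} {X′ ∘ tgt G}
      (remove-∈ {X = X} (λ p → true≢false (inc-src p) (not-true (proj₂ (∧-elim {B e} h)))) (proj₁ (∧-elim (B⊆X e (B₀⊆B e h)))))
      (remove-∈ {X = X} (λ p → true≢false (inc-tgt p) (not-true (proj₂ (∧-elim {B e} h)))) (proj₂ (∧-elim {X (src G e)} (B⊆X e (B₀⊆B e h)))))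
      where
      inc-src : v ≡ src G e → e ∈ˢ inc G v
      inc-src refl rewrite ==-refl (src G e) = refl
      inc-tgt : v ≡ tgt G e → e ∈ˢ inc G v
      inc-tgt refl = ∪-introʳ {X = λ e → src G e == v} {λ e → tgt G e == v} e (==-refl (tgt G e))

    count-B₀ : deg G B v + count B₀ ≡ count B
    count-B₀ = trans (cong (_+ count B₀) (deg-count G B v)) (count-split B (inc G v))

    F : Subset (nE G)
    F = B ∩ inc G v

    neighbour : ∀ {e} → e ∈ˢ F → ∃ λ u → Joins G e v u × u ∈ˢ X′
    neighbour {e} h with other-end {G} {e} {v} (proj₂ (∧-elim {B e} h))
    ... | u , j = u , j , remove-∈ {X = X} (joins-≢ {G} j) (proj₂ (joins-inside {G} {X = X} j (B⊆X e (proj₁ (∧-elim h)))))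

    -- The vertex `v` becomes a leaf of both trees, hung on by one edge each.
    degree-2 : ∀ {e₁ e₂} → e₁ ∈ˢ F → e₂ ∈ˢ F → e₁ ≢ e₂ → TreePair G B₀ X′ → TreePair G B X
    degree-2 {e₁} {e₂} h₁ h₂ e₁≢e₂ P = record
      { T₁ = insert T₁ e₁
      ; T₂ = insert T₂ e₂
      ; T₁⊆B = insert-least {X = T₁} {B} (λ e → B₀⊆B e ∘ T₁⊆B e) (proj₁ (∧-elim h₁))
      ; T₂⊆B = insert-least {X = T₂} {B} (λ e → B₀⊆B e ∘ T₂⊆B e) (proj₁ (∧-elim h₂))
      ; disjoint = disj
      ; conn₁ = attach T₁ h₁ conn₁
      ; conn₂ = attach T₂ h₂ conn₂ }
      where
      open TreePair P
      attach : ∀ T {e} → e ∈ˢ F → Connects (src G) (tgt G) T X′ → Connects (src G) (tgt G) (insert T e) X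
      attach T {e} h conn c const with neighbour {e} h
      ... | u , j , u∈X′ = constant-at {X = X} {v} {c} (conn c λ e′ e′∈T → const e′ (insert-⊆ {X = T} {e} e′ e′∈T)) u∈X′
        (joins-constant {G} {c = c} j (const e (insert-∈ {X = T} e)))
      fresh : ∀ {T} → T ⊆ˢ B₀ → ∀ {e} → e ∈ˢ F → T e ≡ false
      fresh T⊆B₀ {e} h = ≢true⇒≡false λ e∈T → true≢false (T⊆B₀ e e∈T) (B₀-inc {e} (proj₂ (∧-elim {B e} h)))
      disj : ∀ e → e ∈ˢ insert T₁ e₁ → e ∈ˢ insert T₂ e₂ → ⊥
      disj e p q with e₁ ≟ e | e₂ ≟ e
      ... | yes refl | yes refl = e₁≢e₂ refl
      ... | yes refl | no _ = true≢false q (fresh {T₂} T₂⊆B h₁)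
      ... | no _ | yes refl = true≢false p (fresh {T₁} T₁⊆B h₂)
      ... | no _ | no _ = disjoint e p q

    -- The vertex v of degree three is removed and its edge e₁ is redirected to join the
    -- other ends a and b of e₁ and e₂.
    module Degree3 {e₁ e₂ e₃ : Fin (nE G)} (h₁ : e₁ ∈ˢ F) (h₂ : e₂ ∈ˢ F) (h₃ : e₃ ∈ˢ F)
      (e₁≢e₂ : e₁ ≢ e₂) (e₁≢e₃ : e₁ ≢ e₃) (e₂≢e₃ : e₂ ≢ e₃)
      {a b : Fin (nV G)} (j₁ : Joins G e₁ v a) (j₂ : Joins G e₂ v b) (a∈X′ : a ∈ˢ X′) (b∈X′ : b ∈ˢ X′)
      (unblocked : ∀ Y → Tight G B₀ Y → a ∈ˢ Y → b ∈ˢ Y → ⊥) where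

      a≢b : a ≢ b
      -- If the two edges were parallel, the singleton of their common other end would be a tight
      -- set containing both `a` and `b`.
      a≢b refl = unblocked (a ==_) (tight-singleton {G} B₀ a) (==-refl a) (==-refl a)

      G′ : Graph
      G′ = rewire G e₁ a b a≢b

      B′ : Subset (nE G)
      B′ = insert B₀ e₁

      src-≢ : ∀ {e} → e₁ ≢ e → src G′ e ≡ src G e
      src-≢ p rewrite ≢⇒==-false p = refl

      tgt-≢ : ∀ {e} → e₁ ≢ e → tgt G′ e ≡ tgt G e
      tgt-≢ p rewrite ≢⇒==-false p = refl

      src-e₁ : src G′ e₁ ≡ a
      src-e₁ rewrite ==-refl e₁ = refl

      tgt-e₁ : tgt G′ e₁ ≡ b
      tgt-e₁ rewrite ==-refl e₁ = refl

      e₁∉B₀ : B₀ e₁ ≡ false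
      e₁∉B₀ = B₀-inc {e₁} (proj₂ (∧-elim {B e₁} h₁))

      B₀≢e₁ : ∀ {e} → e ∈ˢ B₀ → e₁ ≢ e
      B₀≢e₁ h refl = true≢false h e₁∉B₀

      ins-G′ : ∀ Y → ins G′ B₀ Y ≡ ins G B₀ Y
      ins-G′ Y = trans (ins-count G′ B₀ Y) (trans (count-cong pointwise) (sym (ins-count G B₀ Y)))
        where
        pointwise : (B₀ ∩ inside G′ Y) ≗ (B₀ ∩ inside G Y)
        pointwise e with e₁ ≟ e
        ... | yes refl rewrite e₁∉B₀ = refl
        ... | no _ = refl

      sparse-G′ : Sparse G′ B′
      sparse-G′ = insert-sparse {G′} {B₀} (λ Y v∈Y → subst (λ z → z + 2 ≤ 2 * count Y) (sym (ins-G′ Y)) (sp₀ Y v∈Y)) e₁∉B₀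
        λ Y (tight y∈Y t) e₁∈Y → unblocked Y (tight y∈Y (subst (λ z → 2 * count Y ≤ z + 2) (ins-G′ Y) t))
          (subst (_∈ˢ Y) src-e₁ (proj₁ (∧-elim e₁∈Y))) (subst (_∈ˢ Y) tgt-e₁ (proj₂ (∧-elim {Y (src G′ e₁)} e₁∈Y)))

      B′⊆X′ : B′ ⊆ˢ inside G′ X′
      B′⊆X′ = insert-least {X = B₀} {inside G′ X′}
        (λ e h → subst₂ (λ x y → X′ x ∧ X′ y ≡ true) (sym (src-≢ (B₀≢e₁ h))) (sym (tgt-≢ (B₀≢e₁ h))) (B₀⊆X′ e h))
        (subst₂ (λ x y → X′ x ∧ X′ y ≡ true) (sym src-e₁) (sym tgt-e₁) (∩-intro {X = λ _ → X′ a} {λ _ → X′ b} {x = e₁} a∈X′ b∈X′))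

      -- `A` is the set that may use the redirected edge from `a` to `b`. In `G` that edge is
      -- subdivided into the path `e₁`, `e₂` through `v`, while `C` reaches `v` by `e₃`.
      extend : ∀ {A C} → A ⊆ˢ B′ → C ⊆ˢ B′ → (∀ e → e ∈ˢ A → e ∈ˢ C → ⊥) → C e₁ ≡ false →
        Connects (src G′) (tgt G′) A X′ → Connects (src G′) (tgt G′) C X′ → TreePair G B X
      extend {A} {C} A⊆B′ C⊆B′ disj e₁∉C connA connC = record
        { T₁ = insert A₁ e₂
        ; T₂ = insert C e₃
        ; T₁⊆B = insert-least {X = A₁} {B} (insert-least {X = A} {B} (λ e → B′⊆B e ∘ A⊆B′ e) (proj₁ (∧-elim h₁))) (proj₁ (∧-elim h₂))
        ; T₂⊆B = insert-least {X = C} {B} (λ e → B′⊆B e ∘ C⊆B′ e) (proj₁ (∧-elim h₃))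
        ; disjoint = disjoint
        ; conn₁ = conn₁
        ; conn₂ = conn₂ }
        where
        A₁ : Subset (nE G)
        A₁ = insert A e₁
        B′⊆B : B′ ⊆ˢ B
        B′⊆B = insert-least {X = B₀} {B} B₀⊆B (proj₁ (∧-elim h₁))
        fresh : ∀ {T} → T ⊆ˢ B′ → ∀ {e} → e ∈ˢ F → e₁ ≢ e → T e ≡ false
        fresh T⊆B′ {e} h e₁≢e = ≢true⇒≡false λ e∈T →
          true≢false (T⊆B′ e e∈T) (insert-∌ {X = B₀} {e₁} {e} e₁≢e (B₀-inc {e} (proj₂ (∧-elim {B e} h))))
        disjoint : ∀ e → e ∈ˢ insert A₁ e₂ → e ∈ˢ insert C e₃ → ⊥
        disjoint e p q with e₂ ≟ e | e₃ ≟ e | e₁ ≟ e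
        ... | yes refl | yes refl | _ = e₂≢e₃ refl
        ... | yes refl | no _ | _ = true≢false q (fresh {C} C⊆B′ h₂ e₁≢e₂)
        ... | no _ | yes refl | yes refl = e₁≢e₃ refl
        ... | no _ | yes refl | no _ = true≢false p (fresh {A} A⊆B′ h₃ e₁≢e₃)
        ... | no _ | no _ | yes refl = true≢false q e₁∉C
        ... | no _ | no _ | no _ = disj e p q
        same-ends : ∀ {c : Subset (nV G)} {e} → e₁ ≢ e → c (src G e) ≡ c (tgt G e) → c (src G′ e) ≡ c (tgt G′ e)
        same-ends {c} p q = trans (cong c (src-≢ p)) (trans q (sym (cong c (tgt-≢ p))))
        conn₁ : Connects (src G) (tgt G) (insert A₁ e₂) X
        conn₁ c const = constant-at {X = X} {v} {c} (connA c const′) a∈X′ cv≡ca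
          where
          ⊆T : A₁ ⊆ˢ insert A₁ e₂
          ⊆T = insert-⊆ {X = A₁} {e₂}
          cv≡ca : c v ≡ c a
          cv≡ca = joins-constant {G} {c = c} j₁ (const e₁ (⊆T e₁ (insert-∈ {X = A} e₁)))
          cv≡cb : c v ≡ c b
          cv≡cb = joins-constant {G} {c = c} j₂ (const e₂ (insert-∈ {X = A₁} e₂))
          const′ : ∀ e → e ∈ˢ A → c (src G′ e) ≡ c (tgt G′ e)
          const′ e e∈A with e₁ ≟ e
          ... | yes refl = trans (sym cv≡ca) cv≡cb
          ... | no p = const e (⊆T e (insert-⊆ {X = A} {e₁} e e∈A))
        conn₂ : Connects (src G) (tgt G) (insert C e₃) X
        conn₂ c const with neighbour {e₃} h₃
        ... | u , j , u∈X′ = constant-at {X = X} {v} {c} (connC c λ e e∈C → same-ends {c} (λ { refl → true≢false e∈C e₁∉C })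
            (const e (insert-⊆ {X = C} {e₃} e e∈C))) u∈X′ (joins-constant {G} {c = c} j (const e₃ (insert-∈ {X = C} e₃)))

      degree-3 : TreePair G′ B′ X′ → TreePair G B X
      degree-3 P with true-or-false (TreePair.T₁ P e₁)
      ... | inj₂ e₁∉T₁ = extend T₂⊆B T₁⊆B (λ e p q → disjoint e q p) e₁∉T₁ conn₂ conn₁
        where open TreePair P
      ... | inj₁ e₁∈T₁ = extend T₁⊆B T₂⊆B disjoint (≢true⇒≡false (disjoint e₁ e₁∈T₁)) conn₁ conn₂
        where open TreePair P

    Blocked : Fin (nV G) → Fin (nV G) → Set
    Blocked a b = ∃ λ Y → Tight G B₀ Y × a ∈ˢ Y × b ∈ˢ Y

    -- The two blocking sets share `b`, so their union is tight, and it contains all neighbours of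
    -- `v`. Adding `v` would bring three edges with one vertex, where sparsity has room for two.
    not-both-blocked : ∀ {e₁ e₂ e₃ a b c} → deg G B v ≡ 3 → (∀ e → e ∈ˢ F → e ≡ e₁ ⊎ e ≡ e₂ ⊎ e ≡ e₃) →
      Joins G e₁ v a → Joins G e₂ v b → Joins G e₃ v c → Blocked a b → Blocked b c → ⊥
    not-both-blocked {e₁} {e₂} {e₃} {a} {b} {c} d only j₁ j₂ j₃ (Y₁ , t₁ , a∈₁ , b∈₁) (Y₂ , t₂ , b∈₂ , c∈₂) =
      arith (count Y) (count Z) (ins G B₀ Y) (ins G B Z) (edges≥ tY) (sp Z (insert-∈ {X = Y} v)) size-Z edges-Z
      where
      Y Z : Subset (nV G)
      Y = Y₁ ∪ Y₂
      Z = insert Y v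
      tY : Tight G B₀ Y
      tY = tight-∪ {G} sp₀ t₁ t₂ b∈₁ b∈₂
      Y⊆Z : Y ⊆ˢ Z
      Y⊆Z = insert-⊆ {X = Y} {v}
      size-Z : count Z ≤ count Y + 1
      size-Z = ≤-trans (≤-trans (m≤m+n _ _) (≤-reflexive (count-∪-∩ (v ==_) Y)))
        (≤-reflexive (trans (cong (_+ count Y) (count-δ v)) (+-comm 1 (count Y))))
      F⊆Z : F ⊆ˢ inside G Z
      F⊆Z e e∈F with only e e∈F
      ... | inj₁ refl = inside-joins {G} {X = Z} j₁ (insert-∈ {X = Y} v) (Y⊆Z a (∪-introˡ {X = Y₁} {Y₂} a a∈₁))
      ... | inj₂ (inj₁ refl) = inside-joins {G} {X = Z} j₂ (insert-∈ {X = Y} v) (Y⊆Z b (∪-introˡ {X = Y₁} {Y₂} b b∈₁))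
      ... | inj₂ (inj₂ refl) = inside-joins {G} {X = Z} j₃ (insert-∈ {X = Y} v) (Y⊆Z c (∪-introʳ {X = Y₁} {Y₂} c c∈₂))
      K : Subset (nE G)
      K = B₀ ∩ inside G Y
      edges-Z : ins G B₀ Y + 3 ≤ ins G B Z
      edges-Z = ≤-trans (≤-reflexive (cong₂ _+_ (ins-count G B₀ Y) (trans (sym d) (deg-count G B v))))
        (≤-trans (≤-reflexive (trans (sym (count-∪-∩ K F)) (trans (cong (count (K ∪ F) +_) (count-none disj)) (+-identityʳ _))))
        (≤-trans (count-mono (∪-elim {X = K} {F} {B ∩ inside G Z}
            (∩-mono {X = B₀} {inside G Y} {B} {inside G Z} B₀⊆B (inside-mono {G} Y⊆Z))
            λ e e∈F → ∩-intro {X = B} {inside G Z} (proj₁ (∧-elim e∈F)) (F⊆Z e e∈F)))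
          (≤-reflexive (sym (ins-count G B Z)))))
        where
        disj : ∀ e → (K ∩ F) e ≡ false
        disj e = ≢true⇒≡false λ h → true≢false (proj₁ (∧-elim (proj₁ (∧-elim {K e} h))))
          (B₀-inc {e} (proj₂ (∧-elim {B e} (proj₂ (∧-elim {K e} h)))))
      arith : ∀ y z by bz → 2 * y ≤ by + 2 → bz + 2 ≤ 2 * z → z ≤ y + 1 → by + 3 ≤ bz → ⊥
      arith y z by bz p q r s = <⇒≱ {2} {3} ≤-refl
        (linear (+-mono-≤ (+-mono-≤ p q) (+-mono-≤ (+-mono-≤ r r) s)) (regroup y z by bz))
        where
        regroup : ∀ y z by bz → 3 + ((by + 2 + 2 * z) + (y + 1 + (y + 1) + bz)) ≡ 2 + ((2 * y + (bz + 2)) + (z + z + (by + 3)))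
        regroup = solve-∀

  tree-pair-step : ∀ {w} → w ∈ˢ remove X v → 2 * count X ≤ count B + 2 → deg G B v ≤ 3 →
    (∀ {B′} → Sparse G B′ → B′ ⊆ˢ inside G (remove X v) → 2 * count (remove X v) ≤ count B′ + 2 →
      ¬ ¬ TreePair G B′ (remove X v)) →
    (∀ e a b (a≢b : a ≢ b) {B′} → let G′ = rewire G e a b a≢b in
      Sparse G′ B′ → B′ ⊆ˢ inside G′ (remove X v) → 2 * count (remove X v) ≤ count B′ + 2 →
      ¬ ¬ TreePair G′ B′ (remove X v)) →
    ¬ ¬ TreePair G B X
  tree-pair-step {w} w∈X′ many deg≤3 ih ih′ = by-degree (two-or-three _ deg≥2 deg≤3)
    where
    deg≥2 : 2 ≤ deg G B v
    deg≥2 = ≤-trans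
      (tight-degree {G} sp (tight v∈X (subst (λ z → 2 * count X ≤ z + 2) (sym (ins-⊆ {G} B⊆X)) many)) v∈X
        (remove-⊆ {X = X} {v} w w∈X′) (remove-≢ {X = X} w∈X′))
      (≤-trans (count-mono {Y = F} (∩-mono {X = B} {inside G X ∩ inc G v} {B} {inc G v} (λ _ → id) λ e → proj₂ ∘ ∧-elim {inside G X e}))
        (≤-reflexive (sym (deg-count G B v))))
    two-or-three : ∀ d → 2 ≤ d → d ≤ 3 → d ≡ 2 ⊎ d ≡ 3
    two-or-three 2 _ _ = inj₁ refl
    two-or-three 3 _ _ = inj₂ refl
    two-or-three 0 () _
    two-or-three 1 (s≤s ()) _
    two-or-three (suc (suc (suc (suc _)))) _ (s≤s (s≤s (s≤s ())))
    -- Two edges are lost together with the one vertex in both cases: either two are deleted, or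
    -- three are deleted and one comes back redirected.
    enough : ∀ x x′ b b₀ b′ d → 2 * x ≤ b + 2 → x′ + 1 ≡ x → d + b₀ ≡ b → b′ + 2 ≡ d + b₀ → 2 * x′ ≤ b′ + 2
    enough x x′ b b₀ b′ d p refl refl q =
      linear (+-mono-≤ p (≤-reflexive (sym q))) (regroup x′ b₀ b′ d)
      where
      regroup : ∀ x′ b₀ b′ d → 2 * x′ + (d + b₀ + 2 + (b′ + 2)) ≡ b′ + 2 + (2 * (x′ + 1) + (d + b₀))
      regroup = solve-∀
    by-degree : deg G B v ≡ 2 ⊎ deg G B v ≡ 3 → ¬ ¬ TreePair G B X
    by-degree (inj₁ d) with pick F (trans (sym (deg-count G B v)) d)
    ... | e₁ , h₁ , c₁ with pick (remove F e₁) c₁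
    ... | e₂ , h₂ , c₂ = do
      P ← ih sp₀ B₀⊆X′ (enough (count X) (count X′) (count B) (count B₀) (count B₀) 2 many (count-remove-1 X v v∈X)
            (trans (cong (_+ count B₀) (sym d)) count-B₀) (+-comm (count B₀) 2))
      return (degree-2 h₁ (remove-⊆ {X = F} {e₁} e₂ h₂) (remove-≢ {X = F} h₂) P)
    by-degree (inj₂ d) with pick F (trans (sym (deg-count G B v)) d)
    ... | e₁ , h₁ , c₁ with pick (remove F e₁) c₁
    ... | e₂ , h₂ , c₂ with pick (remove (remove F e₁) e₂) c₂
    ... | e₃ , h₃ , c₃ with neighbour {e₁} h₁ | neighbour {e₂} (remove-⊆ {X = F} {e₁} e₂ h₂)
                          | neighbour {e₃} (remove-⊆ {X = F} {e₁} e₃ (remove-⊆ {X = remove F e₁} {e₂} e₃ h₃))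
    ... | a , j₁ , a∈ | b , j₂ , b∈ | c , j₃ , c∈ = do
      blocked? ← ¬¬-excluded-middle {A = Blocked a b}
      case blocked? of λ
        { (no ¬ab) → finish h₁ h₂′ h₃′ e₁≢e₂ e₁≢e₃ e₂≢e₃ j₁ j₂ a∈ b∈ λ Y t p q → ¬ab (Y , t , p , q)
        -- Then the pair `b`, `c` is not blocked, and `e₃` is redirected in place of `e₁`.
        ; (yes ab) → finish h₃′ h₂′ h₁ (e₂≢e₃ ∘ sym) (e₁≢e₃ ∘ sym) (e₁≢e₂ ∘ sym) j₃ j₂ c∈ b∈
            λ Y t p q → not-both-blocked d only j₁ j₂ j₃ ab (Y , t , q , p) }
      where
      h₂′ : e₂ ∈ˢ F
      h₂′ = remove-⊆ {X = F} {e₁} e₂ h₂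
      h₃″ : e₃ ∈ˢ remove F e₁
      h₃″ = remove-⊆ {X = remove F e₁} {e₂} e₃ h₃
      h₃′ : e₃ ∈ˢ F
      h₃′ = remove-⊆ {X = F} {e₁} e₃ h₃″
      e₁≢e₂ : e₁ ≢ e₂
      e₁≢e₂ = remove-≢ {X = F} h₂
      e₁≢e₃ : e₁ ≢ e₃
      e₁≢e₃ = remove-≢ {X = F} h₃″
      e₂≢e₃ : e₂ ≢ e₃
      e₂≢e₃ = remove-≢ {X = remove F e₁} h₃
      only : ∀ e → e ∈ˢ F → e ≡ e₁ ⊎ e ≡ e₂ ⊎ e ≡ e₃
      only e e∈F with e₁ ≟ e | e₂ ≟ e | e₃ ≟ e
      ... | yes p | _ | _ = inj₁ (sym p)
      ... | no _ | yes p | _ = inj₂ (inj₁ (sym p))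
      ... | no _ | no _ | yes p = inj₂ (inj₂ (sym p))
      ... | no n₁ | no n₂ | no n₃ = ⊥-elim (count-0 {F = remove (remove (remove F e₁) e₂) e₃} c₃ e
        (remove-∈ {X = remove (remove F e₁) e₂} n₃ (remove-∈ {X = remove F e₁} n₂ (remove-∈ {X = F} n₁ e∈F))))
      finish : ∀ {e₁ e₂ e₃} → e₁ ∈ˢ F → e₂ ∈ˢ F → e₃ ∈ˢ F → e₁ ≢ e₂ → e₁ ≢ e₃ → e₂ ≢ e₃ → ∀ {a b} →
        Joins G e₁ v a → Joins G e₂ v b → a ∈ˢ X′ → b ∈ˢ X′ →
        (∀ Y → Tight G B₀ Y → a ∈ˢ Y → b ∈ˢ Y → ⊥) → ¬ ¬ TreePair G B X
      finish {e₁} h₁ h₂ h₃ n₁₂ n₁₃ n₂₃ {a} {b} j₁ j₂ a∈ b∈ free = do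
        P ← ih′ e₁ a b a≢b sparse-G′ B′⊆X′ (enough (count X) (count X′) (count B) (count B₀) (count B′) 3 many
              (count-remove-1 X v v∈X) (trans (cong (_+ count B₀) (sym d)) count-B₀)
              (trans (cong (_+ 2) (count-insert-1 B₀ e₁ e₁∉B₀)) (trans (+-assoc (count B₀) 1 2) (+-comm (count B₀) 3))))
        return (degree-3 P)
        where open Degree3 h₁ h₂ h₃ n₁₂ n₁₃ n₂₃ j₁ j₂ a∈ b∈ free

-- Nash-Williams' theorem for two trees, by Henneberg's construction: a vertex of degree at
-- most three is removed.
tree-pair : ∀ k (G : Graph) {B X v} → count X ≡ k → v ∈ˢ X → Sparse G B → B ⊆ˢ inside G X →
  2 * count X ≤ count B + 2 → ¬ ¬ TreePair G B X
tree-pair zero G {X = X} size v∈X _ _ _ = ⊥-elim (count-0 {F = X} size _ v∈X)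
tree-pair (suc k) G {B} {X} size v∈X sp B⊆X many with low-degree-vertex {G} sp B⊆X v∈X
... | v , v∈X , deg≤3 with any? (λ w → remove X v w Bool.≟ true)
... | no lone = return record
  { T₁ = λ _ → false ; T₂ = λ _ → false ; T₁⊆B = λ _ () ; T₂⊆B = λ _ () ; disjoint = λ _ ()
  ; conn₁ = constant ; conn₂ = constant }
  where
  only-v : ∀ {u} → u ∈ˢ X → v ≡ u
  only-v {u} u∈X with v ≟ u
  ... | yes p = p
  ... | no p = ⊥-elim (lone (u , remove-∈ {X = X} p u∈X))
  constant : Connects (src G) (tgt G) (λ _ → false) X
  constant c _ u∈X w∈X = cong c (trans (sym (only-v u∈X)) (only-v w∈X))
... | yes (w , w∈X′) = tree-pair-step sp B⊆X v∈X w∈X′ many deg≤3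
  (λ {B′} → tree-pair k G {B′} {remove X v} size′ w∈X′)
  (λ e a b a≢b {B′} → tree-pair k (rewire G e a b a≢b) {B′} {remove X v} size′ w∈X′)
  where
  size′ : count (remove X v) ≡ k
  size′ = suc-injective (trans (+-comm 1 _) (trans (count-remove-1 X v v∈X) size))

-- Tight sets and 2-tree-connected components

opaque
  unfolding count ∑

  card≡count : ∀ {n} (X : Subset n) → card X ≡ count X
  card≡count {n} X = go n id
    where
    go : ∀ m (g : Fin m → Fin n) → length (filter (λ x → X x Bool.≟ true) (tabulate g)) ≡ ∑ (λ i → ⟦ X (g i) ⟧)
    go zero g = refl
    go (suc m) g with X (g zero)
    ... | true = cong suc (go m (g ∘ suc))
    ... | false = go m (g ∘ suc)

module _ {G : Graph} where

  reach-trans : ∀ {T u v w} → Reach G T u v → Reach G T v w → Reach G T u w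
  reach-trans here s = s
  reach-trans (fwd e e∈T r) s = fwd e e∈T (reach-trans r s)
  reach-trans (bwd e e∈T r) s = bwd e e∈T (reach-trans r s)

  -- The vertices reachable from `u` form a cut that no edge of `T` crosses. Decidability of
  -- reachability is what turns them into a Boolean cut.
  connects⇒reach : ∀ {T X} → Connects (src G) (tgt G) T X → (∀ u v → Dec (Reach G T u v)) →
    ∀ u v → u ∈ˢ X → v ∈ˢ X → Reach G T u v
  connects⇒reach {T} conn reach? u v u∈X v∈X =
    reached (trans (sym (conn (λ w → does (reach? u w)) step u∈X v∈X)) (dec-true (reach? u u) here))
    where
    reached : ∀ {w} → does (reach? u w) ≡ true → Reach G T u w
    reached {w} h with reach? u w
    ... | yes r = r
    reached () | no _
    step : ∀ e → e ∈ˢ T → does (reach? u (src G e)) ≡ does (reach? u (tgt G e))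
    step e e∈T with reach? u (src G e) | reach? u (tgt G e)
    ... | yes _ | yes _ = refl
    ... | no _ | no _ = refl
    ... | yes r | no ¬r = ⊥-elim (¬r (reach-trans r (fwd e e∈T here)))
    ... | no ¬r | yes r = ⊥-elim (¬r (reach-trans r (bwd e e∈T here)))

  private
    without≗remove : ∀ T e → without G T e ≗ remove T e
    without≗remove T e e′ with e ≟ e′
    ... | yes _ = refl
    ... | no _ = refl

  -- A connecting set with only |X| - 1 edges is a tree: it has no edge to spare.
  spanningTree : ∀ {T X} → Connects (src G) (tgt G) T X → T ⊆ˢ inside G X → count T + 1 ≤ count X →
    ¬ ¬ SpanningTree G X T
  spanningTree {T} {X} conn T⊆X few = do
    reach? ← ¬¬-∀ _ λ u → ¬¬-∀ _ λ v → ¬¬-excluded-middle {A = Reach G T u v}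
    return ((λ e e∈T → ∧-elim (T⊆X e e∈T)) , connects⇒reach conn reach? , acyclic)
    where
    acyclic : ∀ e → e ∈ˢ T → ¬ Reach G (without G T e) (src G e) (tgt G e)
    acyclic e e∈T r = <⇒≱ {count T} {count X} (≤-trans (≤-reflexive (+-comm 1 _)) few) (≤-trans (connects-count (src G) (tgt G) X {without G T e} conn′)
      (≤-reflexive (trans (cong (_+ 1) (count-cong (without≗remove T e))) (count-remove-1 T e e∈T))))
      where
      conn′ : Connects (src G) (tgt G) (without G T e) X
      conn′ c const = conn c λ e′ e′∈T → case e ≟ e′ of λ
        { (yes refl) → reach-constant {c = c} const r
        ; (no p) → const e′ (trans (without≗remove T e e′) (remove-∈ {X = T} p e′∈T)) }

  tight⇒treePair : ∀ {B X} → Sparse G B → Tight G B X → ¬ ¬ TreePair G (B ∩ inside G X) X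
  tight⇒treePair {B} {X} sp (tight v∈X t) =
    tree-pair (count X) G refl v∈X (sparse-⊆ {G} (λ _ → proj₁ ∘ ∧-elim) sp) (λ e → proj₂ ∘ ∧-elim {B e})
      (subst (λ z → 2 * count X ≤ z + 2) (ins-count G B X) t)

  tight⇒treeConnected : ∀ {B X} → Sparse G B → Tight G B X → ¬ ¬ TreeConnected G 2 X
  tight⇒treeConnected {B} {X} sp tX@(tight {v} v∈X t) = do
    P ← tight⇒treePair sp tX
    let open TreePair P
    tree₁ ← spanningTree conn₁ (λ e → proj₂ ∘ ∧-elim {B e} ∘ T₁⊆B e) (few T₁ T₂ conn₂ (size P))
    tree₂ ← spanningTree conn₂ (λ e → proj₂ ∘ ∧-elim {B e} ∘ T₂⊆B e)
      (few T₂ T₁ conn₁ (≤-trans (≤-reflexive (+-comm (count T₂) (count T₁))) (size P)))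
    return ((v , v∈X)
      , (λ { zero → T₁ ; (suc zero) → T₂ })
      , (λ { zero → tree₁ ; (suc zero) → tree₂ })
      , λ { zero zero e i≢j _ _ → i≢j refl ; zero (suc zero) e _ p q → disjoint e p q
          ; (suc zero) zero e _ p q → disjoint e q p ; (suc zero) (suc zero) e i≢j _ _ → i≢j refl })
    where
    size : (P : TreePair G (B ∩ inside G X) X) → count (TreePair.T₁ P) + count (TreePair.T₂ P) ≤ ins G B X
    size P = ≤-trans (≤-trans (≤-reflexive (sym (count-∪-∩ T₁ T₂)))
        (≤-trans (+-monoʳ-≤ (count (T₁ ∪ T₂)) (≤-reflexive (count-none λ e → ≢true⇒≡false λ h →
          disjoint e (proj₁ (∧-elim h)) (proj₂ (∧-elim {T₁ e} h))))) (≤-reflexive (+-identityʳ _))))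
      (≤-trans (count-mono (∪-elim {X = T₁} {T₂} T₁⊆B T₂⊆B)) (≤-reflexive (sym (ins-count G B X))))
      where open TreePair P
    -- The other set has at least `count X - 1` edges, and sparsity grants both together only
    -- `2 * count X - 2`.
    few : ∀ T T′ → Connects (src G) (tgt G) T′ X → count T + count T′ ≤ ins G B X → count T + 1 ≤ count X
    few T T′ conn′ s = arith (count T) (count T′) (count X) (ins G B X) s (connects-count (src G) (tgt G) X {T′} conn′) (sp X v∈X)
      where
      arith : ∀ a a′ x b → a + a′ ≤ b → x ≤ a′ + 1 → b + 2 ≤ 2 * x → a + 1 ≤ x
      arith a a′ x b p q r = linear (+-mono-≤ p (+-mono-≤ q r)) (solve (a ∷ a′ ∷ x ∷ b ∷ []))

  module _ {B : Subset (nE G)} {R : Subset (nV G)} (sp : Sparse G B) (C : Components {G} B R) (sat : Saturated {G} B R) where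
    open Components C

    -- The tight hull of `Y` contains the class `i`, and by maximality of the class it cannot be
    -- larger.
    treeConnected-absorbed : ∀ i Y → Y ⊆ˢ R → classOf G R cell i ⊆ˢ Y → TreeConnected G 2 Y → Y ⊆ˢ classOf G R cell i
    treeConnected-absorbed i Y Y⊆R ⊆Y tc v v∈Y with treeConnected-hull C sat Y⊆R tc | class-tight i
    ... | W , tW , Y⊆W , W⊆R | tight {w} w∈ _ =
      subst (λ j → v ∈ˢ classOf G R cell j) (==⇒≡ (proj₂ (∧-elim {R w} w∈))) (absorbs tW W⊆R (Y⊆W w (⊆Y w w∈)) v (Y⊆W v v∈Y))

    -- `crossEdges` counts edges of `G`, whereas the counting argument knows about `B`;
    -- `split-edge∈` makes the two numbers equal.
    componentPartition : ¬ ¬ (Σ (ComponentPartition G 2 R) λ P →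
      k P ≡ cells × crossEdges G P ≡ count (B ∩ (inside G R ∩ split G cell)))
    componentPartition = do
      tc ← ¬¬-∀ _ λ i → tight⇒treeConnected sp (class-tight i)
      return (record { k = cells ; part = cell ; partTC = tc ; partMax = treeConnected-absorbed }
        , refl , trans (card≡count _) (count-cong cross))
      where
      lemma : ∀ b x y q → ((x ∧ y) ∧ q ≡ true → b ≡ true) → x ∧ (y ∧ q) ≡ b ∧ ((x ∧ y) ∧ q)
      lemma = by-cases (∀ᵇ? λ b → ∀ᵇ? λ x → ∀ᵇ? λ y → ∀ᵇ? λ q → ((_ Bool.≟ _) →-dec (_ Bool.≟ _)) →-dec (_ Bool.≟ _))
      cross : ∀ e → R (src G e) ∧ (R (tgt G e) ∧ split G cell e) ≡ (B ∩ (inside G R ∩ split G cell)) e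
      cross e = lemma (B e) (R (src G e)) (R (tgt G e)) (split G cell e) λ h →
        split-edge∈ C sat e (proj₁ (∧-elim h)) (proj₂ (∧-elim {inside G R e} h))

-- The bound on Ω without fractions

-- q = (x - y) / 2
record _≐½_-_ (q : ℚ) (x y : ℕ) : Set where
  constructor halves
  field
    value : ℚ.toℚᵘ q ℚᵘ.≃ mkℚᵘ (ℤ.+ x ℤ.- ℤ.+ y) 1

module _ where
  open import Data.Integer using () renaming (_+_ to _⊕_; _-_ to _⊝_; _*_ to _⊛_; -_ to neg)

  ½-/1 : ∀ n → (ℤ.+ n ℚ./ 1) ≐½ 2 * n - 0
  ½-/1 n = halves (ℚᵘ.≃-trans (ℚ.toℚᵘ-fromℚᵘ (mkℚᵘ (ℤ.+ n) 0)) (*≡* (trans (lemma (ℤ.+ n))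
    (cong (λ z → (z ⊝ ℤ.+ 0) ⊛ ℤ.+ 1) (sym (ℤ.pos-* 2 n))))))
    where
    lemma : ∀ z → z ⊛ ℤ.+ 2 ≡ (ℤ.+ 2 ⊛ z ⊝ ℤ.+ 0) ⊛ ℤ.+ 1
    lemma = ℤ-solve-∀

  ½-/2 : ∀ n → (ℤ.+ n ℚ./ 2) ≐½ n - 0
  ½-/2 n = halves (ℚᵘ.≃-trans (ℚ.toℚᵘ-fromℚᵘ (mkℚᵘ (ℤ.+ n) 1)) (*≡* (lemma (ℤ.+ n))))
    where
    lemma : ∀ z → z ⊛ ℤ.+ 2 ≡ (z ⊝ ℤ.+ 0) ⊛ ℤ.+ 2
    lemma = ℤ-solve-∀

  ½-0 : 0ℚ ≐½ 0 - 0
  ½-0 = halves (*≡* refl)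

  ½-+ : ∀ {p q x y x′ y′} → p ≐½ x - y → q ≐½ x′ - y′ → (p ℚ.+ q) ≐½ x + x′ - (y + y′)
  ½-+ {p} {q} {x} {y} {x′} {y′} (halves P) (halves Q) = halves (ℚᵘ.≃-trans (ℚ.toℚᵘ-homo-+ p q) (ℚᵘ.≃-trans (ℚᵘ.+-cong P Q)
    (*≡* (trans (lemma (ℤ.+ x) (ℤ.+ y) (ℤ.+ x′) (ℤ.+ y′))
      (cong₂ (λ a b → (a ⊝ b) ⊛ ℤ.+ 4) (sym (ℤ.pos-+ x x′)) (sym (ℤ.pos-+ y y′)))))))
    where
    lemma : ∀ x y x′ y′ → ((x ⊝ y) ⊛ ℤ.+ 2 ⊕ (x′ ⊝ y′) ⊛ ℤ.+ 2) ⊛ ℤ.+ 2 ≡ ((x ⊕ x′) ⊝ (y ⊕ y′)) ⊛ ℤ.+ 4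
    lemma = ℤ-solve-∀

  ½-neg : ∀ {p x y} → p ≐½ x - y → (ℚ.- p) ≐½ y - x
  ½-neg {p} {x} {y} (halves P) = halves (ℚᵘ.≃-trans (ℚ.toℚᵘ-homo‿- p) (ℚᵘ.≃-trans (ℚᵘ.-‿cong P) (*≡* (cong (_⊛ ℤ.+ 2) (lemma (ℤ.+ x) (ℤ.+ y))))))
    where
    lemma : ∀ x y → neg (x ⊝ y) ≡ y ⊝ x
    lemma = ℤ-solve-∀

  ½-≤ : ∀ {p q x y x′ y′} → p ≐½ x - y → q ≐½ x′ - y′ → p ℚ.≤ q → x + y′ ≤ x′ + y
  ½-≤ {p} {q} {x} {y} {x′} {y′} (halves P) (halves Q) p≤q
    with ℚᵘ.≤-respˡ-≃ P (ℚᵘ.≤-respʳ-≃ Q (ℚ.toℚᵘ-mono-≤ p≤q))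
  ... | *≤* h = ℤ.drop‿+≤+ (subst₂ ℤ._≤_ (trans (lemma (ℤ.+ x) (ℤ.+ y) (ℤ.+ y′)) (sym (ℤ.pos-+ x y′)))
      (trans (lemma′ (ℤ.+ x′) (ℤ.+ y′) (ℤ.+ y)) (sym (ℤ.pos-+ x′ y)))
    (ℤ.+-monoˡ-≤ (ℤ.+ y ⊕ ℤ.+ y′) (ℤ.*-cancelʳ-≤-pos (ℤ.+ x ⊝ ℤ.+ y) (ℤ.+ x′ ⊝ ℤ.+ y′) (ℤ.+ 2) h)))
    where
    lemma : ∀ x y y′ → (x ⊝ y) ⊕ (y ⊕ y′) ≡ x ⊕ y′
    lemma = ℤ-solve-∀
    lemma′ : ∀ x′ y′ y → (x′ ⊝ y′) ⊕ (y ⊕ y′) ≡ x′ ⊕ y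
    lemma′ = ℤ-solve-∀

opaque
  unfolding ∑

  ½-sumOver : ∀ (G : Graph) (S : Subset (nV G)) {h : Fin (nV G) → ℚ} {a b : Fin (nV G) → ℕ} → (∀ v → h v ≐½ a v - b v) →
    sumOver G S h ≐½ ∑ (λ v → ⟦ S v ⟧ * a v) - ∑ (λ v → ⟦ S v ⟧ * b v)
  ½-sumOver G S {h} {a} {b} H = go (nV G) id
    where
    summand : Fin (nV G) → ℚ
    summand v = if S v then h v else 0ℚ
    one : ∀ v → summand v ≐½ ⟦ S v ⟧ * a v - (⟦ S v ⟧ * b v)
    one v with S v
    ... | false = ½-0
    ... | true rewrite +-identityʳ (a v) | +-identityʳ (b v) = H v
    go : ∀ m (g : Fin m → Fin (nV G)) → foldr ℚ._+_ 0ℚ (map summand (tabulate g))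
      ≐½ ∑ (λ i → ⟦ S (g i) ⟧ * a (g i)) - ∑ (λ i → ⟦ S (g i) ⟧ * b (g i))
    go zero g = ½-0
    go (suc m) g = ½-+ {summand (g zero)} (one (g zero)) (go m (g ∘ suc))

module _ (G : Graph) (f : Fin (nV G) → ℕ) where

  Ω-bound : ∀ S (P : ComponentPartition G 2 (compl G S)) →
    Ω G 2 P ℚ.≤ sumOver G S (λ v → (ℤ.+ (f v) ℚ./ 1) ℚ.- (ℤ.+ 3 ℚ./ 2)) ℚ.+ (ℤ.+ 2 ℚ./ 1) →
    2 * k P + 3 * count S ≤ 2 * ∑ (λ v → ⟦ S v ⟧ * f v) + 4 + crossEdges G P
  Ω-bound S P h = subst₂ _≤_
    (trans (cong₂ _+_ (+-identityʳ (2 * k P)) refl) (cong (2 * k P +_) (trans (+-identityʳ _)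
      (trans (∑-cong λ v → *-comm ⟦ S v ⟧ 3) (trans (∑-*ˡ 3 _) (cong (3 *_) (sym (count-∑ S))))))))
    (cong₂ _+_ (cong (_+ 4) (trans (∑-cong λ v → swap-2 ⟦ S v ⟧ (f v)) (∑-*ˡ 2 _))) refl)
    (½-≤ {Ω G 2 P} (½-+ {ℤ.+ k P ℚ./ 1} (½-/1 (k P)) (½-neg (½-/2 (crossEdges G P))))
      (½-+ {sumOver G S _} (½-sumOver G S λ v → ½-+ {ℤ.+ (f v) ℚ./ 1} (½-/1 (f v)) (½-neg (½-/2 3))) (½-/1 2)) h)
    where
    swap-2 : ∀ s x → s * (2 * x + 0) ≡ 2 * (s * x)
    swap-2 = solve-∀

-- Counting the edges of a base against the hypothesis

module _ (G : Graph) (f : Fin (nV G) → ℕ) where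

  ΩCondition : Set
  ΩCondition = ∀ S (P : ComponentPartition G 2 (compl G S)) →
    Ω G 2 P ℚ.≤ sumOver G S (λ v → (ℤ.+ (f v) ℚ./ 1) ℚ.- (ℤ.+ 3 ℚ./ 2)) ℚ.+ (ℤ.+ 2 ℚ./ 1)

  bound : Fin (nV G) → ℕ
  bound v = 2 * f v + 1

  -- Let s and r be the sizes of S and its complement R, k the number of classes, c the number of
  -- crossing edges, F the sum of f over S. Tight classes give b(R) = 2r - 2k + c, and sparsity
  -- gives b(S) ≤ 2s - 2 and b ≤ 2(s + r) - 2. By `degree-sum` the degrees over S sum to b + b(S) -
  -- b(R) ≤ 4s - 4 + 2k - c. The doubled hypothesis 2k - c ≤ 2F - 3s + 4 brings this down to 2F + s,
  -- the sum of `bound` over S.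
  obstruction : ΩCondition → ∀ {B} → Sparse G B → ∀ S → Saturated B (∁ S) → ∀ {v} → v ∈ˢ ∁ S →
    (∀ u → u ∈ˢ S → bound u ≤ deg G B u) → ∀ {u} → u ∈ˢ S → bound u < deg G B u → ⊥
  obstruction cond {B} sp S sat v∈R full {u} u∈S over =
    components sp R v∈R λ C → componentPartition sp C sat λ { (P , refl , crossing) →
      arith (count S) (count R) (cells C) (∑ λ i → ins G B (classOf G R (cell C) i)) (crossEdges G P)
        (count B) (ins G B R) (ins G B S) (∑ λ v → ⟦ S v ⟧ * deg G B v) (∑ λ v → ⟦ S v ⟧ * f v)
        (classes C)
        (trans (cong (∑ (λ i → ins G B (classOf G R (cell C) i)) +_) crossing) (ins-classes G (cell C) B R))
        (degree-sum {G} B S) (sp S u∈S)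
        (subst₂ (λ b n → b + 2 ≤ 2 * n) (ins-all {G} B) (sym (count-split all S)) (sp all {u} refl))
        (Ω-bound G f S P (cond S P)) degrees }
    where
    open Components
    R : Subset (nV G)
    R = ∁ S
    classes : (C : Components B R) → 2 * count R ≡ ∑ (λ i → ins G B (classOf G R (cell C) i)) + 2 * cells C
    classes C = begin
      2 * count R
        ≡⟨ cong (2 *_) (count-classes G (cell C) R) ⟨
      2 * ∑ (λ i → count (classOf G R (cell C) i))
        ≡⟨ ∑-*ˡ 2 _ ⟨
      ∑ (λ i → 2 * count (classOf G R (cell C) i))
        ≡⟨ ∑-cong (λ i → sym (tight-≡ {G} sp (class-tight C i))) ⟩
      ∑ (λ i → ins G B (classOf G R (cell C) i) + 2)
        ≡⟨ ∑-+ _ _ ⟩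
      ∑ (λ i → ins G B (classOf G R (cell C) i)) + ∑ {cells C} (λ _ → 2)
        ≡⟨ cong (∑ (λ i → ins G B (classOf G R (cell C) i)) +_) (∑-const 2 (cells C)) ⟩
      ∑ (λ i → ins G B (classOf G R (cell C) i)) + 2 * cells C ∎
      where open ≡-Reasoning
    degrees : 2 * ∑ (λ v → ⟦ S v ⟧ * f v) + count S < ∑ (λ v → ⟦ S v ⟧ * deg G B v)
    degrees = subst (_< ∑ (λ v → ⟦ S v ⟧ * deg G B v)) sums (∑-mono-< weak u strict)
      where
      weak : ∀ v → ⟦ S v ⟧ * bound v ≤ ⟦ S v ⟧ * deg G B v
      weak v with S v in eq
      ... | true = +-monoˡ-≤ 0 (full v eq)
      ... | false = z≤n
      strict : ⟦ S u ⟧ * bound u < ⟦ S u ⟧ * deg G B u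
      strict rewrite u∈S | +-identityʳ (bound u) | +-identityʳ (deg G B u) = over
      distribute : ∀ s x → s * (2 * x + 1) ≡ 2 * (s * x) + s
      distribute = solve-∀
      sums : ∑ (λ v → ⟦ S v ⟧ * bound v) ≡ 2 * ∑ (λ v → ⟦ S v ⟧ * f v) + count S
      sums = trans (∑-cong λ v → distribute ⟦ S v ⟧ (f v)) (trans (∑-+ _ _)
        (cong₂ _+_ (∑-*ˡ 2 _) (sym (count-∑ S))))
    arith : ∀ s r k i c b bR bS D F → 2 * r ≡ i + 2 * k → i + c ≡ bR → b + bS ≡ bR + D → bS + 2 ≤ 2 * s →
      b + 2 ≤ 2 * (s + r) → 2 * k + 3 * s ≤ 2 * F + 4 + c → 2 * F + s < D → ⊥
    arith s r k i c b bR bS D F e₁ e₂ e₃ l₁ l₂ l₃ l₄ = <⇒≱ {0} {1} ≤-refl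
      (linear (+-mono-≤ (+-mono-≤ (≤-reflexive e₁) (+-mono-≤ (≤-reflexive e₂) (≤-reflexive (sym e₃))))
        (+-mono-≤ (+-mono-≤ l₁ l₂) (+-mono-≤ l₃ l₄))) (regroup s r k i c b bR bS D F))
      where
      regroup : ∀ s r k i c b bR bS D F →
        1 + ((i + 2 * k + (bR + (b + bS))) + ((2 * s + 2 * (s + r)) + (2 * F + 4 + c + D)))
        ≡ 0 + ((2 * r + (i + c + (bR + D))) + ((bS + 2 + (b + 2)) + (2 * k + 3 * s + (1 + (2 * F + s)))))
      regroup = solve-∀

-- Exchanging edges to lower degrees

does-true : ∀ {a} {A : Set a} (d : Dec A) → does d ≡ true → A
does-true (yes p) _ = p

does-false : ∀ {a} {A : Set a} (d : Dec A) → does d ≡ false → ¬ A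
does-false (no ¬p) _ = ¬p

∈-or-∉ : ∀ {n} (X : Subset n) v → v ∈ˢ X ⊎ v ∈ˢ ∁ X
∈-or-∉ X v with X v
... | true = inj₁ refl
... | false = inj₂ refl

∁-∌ : ∀ {n} {X : Subset n} {v} → v ∈ˢ ∁ X → X v ≡ false
∁-∌ = not-true

module _ {G : Graph} where

  deg-cong : ∀ {B B′ w} → (∀ e → e ∈ˢ inc G w → B′ e ≡ B e) → deg G B′ w ≡ deg G B w
  deg-cong {B} {B′} {w} h = trans (deg-count G B′ w) (trans (count-cong pointwise) (sym (deg-count G B w)))
    where
    pointwise : (B′ ∩ inc G w) ≗ (B ∩ inc G w)
    pointwise e with inc G w e in eq
    ... | true = cong (_∧ true) (h e eq)
    ... | false = trans (Bool.∧-zeroʳ (B′ e)) (sym (Bool.∧-zeroʳ (B e)))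

  inc-inside : ∀ {e w X} → e ∈ˢ inc G w → e ∈ˢ inside G X → w ∈ˢ X
  inc-inside {e} {w} {X} h i with other-end {G} {e} {w} h
  ... | _ , j = proj₁ (joins-inside {G} {X = X} j i)

  deg-swap : ∀ {B e g} → B e ≡ false → B g ≡ true → ∀ w →
    deg G (swap {G} B e g) w + ⟦ inc G w g ⟧ ≡ deg G B w + ⟦ inc G w e ⟧
  deg-swap {B} {e} {g} e∉B g∈B w rewrite deg-count G (swap {G} B e g) w | deg-count G B w =
    count-swap {G} e∉B g∈B (inc G w)

  swap-replaces : ∀ {X B e g} → B e ≡ false → B g ≡ true → e ∈ˢ inside G X → g ∈ˢ inside G X →
    Sparse G (swap {G} B e g) → Replaces {G} X B (swap {G} B e g)
  swap-replaces {X} {B} {e} {g} e∉B g∈B e∈X g∈X sp = record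
    { outside = λ e′ h → out e′ (λ { refl → true≢false e∈X h }) λ { refl → true≢false g∈X h }
    ; sparse′ = sp
    ; ins-≡ = +-cancelʳ-≡ _ _ _ (subst₂ (λ a b → ins G (swap {G} B e g) X + a ≡ ins G B X + b) (cong ⟦_⟧ g∈X) (cong ⟦_⟧ e∈X)
        (ins-swap {G} e∉B g∈B X)) }
    where
    out : ∀ e′ → e ≢ e′ → g ≢ e′ → swap {G} B e g e′ ≡ B e′
    out e′ p q rewrite ≢⇒==-false p | ≢⇒==-false q = refl

module _ (G : Graph) (h : Fin (nV G) → ℕ) where

  excess : Subset (nE G) → ℕ
  excess B = ∑ λ v → deg G B v ∸ h v

  -- In the local search v may receive one more edge: exchanges inside a tight set avoiding S
  -- make room for it.
  record Relief (B : Subset (nE G)) (S : Subset (nV G)) (v : Fin (nV G)) : Set where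
    constructor mkRelief
    field
      {region} : Subset (nV G)
      {B′}     : Subset (nE G)
      tight-region : Tight G B region
      avoids   : region ⊆ˢ ∁ S
      v∈       : v ∈ˢ region
      replaces : Replaces {G} region B B′
      low      : ∀ w → w ∈ˢ region → deg G B′ w ≤ h w
      lower    : deg G B′ v < h v

  -- The invariant of the search. `relief` allows edges outside S to be added; `overfull` and
  -- `atBound` are what `obstruction` asks for when the search ends.
  record Critical (B : Subset (nE G)) (S : Subset (nV G)) : Set where
    field
      relief   : ∀ v → v ∈ˢ ∁ S → Relief B S v
      overfull : ∀ v → h v < deg G B v → v ∈ˢ S
      atBound  : ∀ v → v ∈ˢ S → h v ≤ deg G B v

  initially-critical : ∀ {B} → Sparse G B → Critical B (λ v → does (h v ≤? deg G B v))
  initially-critical {B} sp = record { relief = relief ; overfull = λ v o → dec-true (h v ≤? _) (<⇒≤ o) ; atBound = atBound }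
    where
    S : Subset (nV G)
    S v = does (h v ≤? deg G B v)
    atBound : ∀ v → v ∈ˢ S → h v ≤ deg G B v
    atBound v = does-true (h v ≤? deg G B v)
    below : ∀ v → v ∈ˢ ∁ S → deg G B v < h v
    below v v∉S = ≰⇒> (does-false (h v ≤? deg G B v) (∁-∌ {X = S} v∉S))
    relief : ∀ v → v ∈ˢ ∁ S → Relief B S v
    -- Outside the initial S the degree is strictly below the bound, so there is room without any
    -- exchange: the region is a singleton and `B` is unchanged.
    relief v v∉S = mkRelief (tight-singleton {G} B v) (λ w p → subst (_∈ˢ ∁ S) (==⇒≡ p) v∉S) (==-refl v)
      (replaces-refl {G} sp) (λ w p → <⇒≤ (below w (subst (_∈ˢ ∁ S) (==⇒≡ p) v∉S))) (below v v∉S)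

  -- The reliefs of both ends of e, applied at once.
  record Merged (B : Subset (nE G)) (S : Subset (nV G)) (e : Fin (nE G)) : Set where
    field
      {U}      : Subset (nV G)
      {B₂}     : Subset (nE G)
      e∈U      : e ∈ˢ inside G U
      avoids   : U ⊆ˢ ∁ S
      replaces : Replaces {G} U B B₂
      e∉B₂     : B₂ e ≡ false
      tight-∪U : ∀ {D} → Tight G B₂ D → e ∈ˢ inside G D → Tight G B₂ (D ∪ U)
      low      : ∀ w → w ∈ˢ U → deg G B₂ w + ⟦ inc G w e ⟧ ≤ h w

  Unspanned : Subset (nE G) → Subset (nV G) → Fin (nE G) → Set
  Unspanned B S e = ¬ ∃ λ Y → Tight G B Y × Y ⊆ˢ ∁ S × e ∈ˢ inside G Y

  -- If the regions X and Y of the two reliefs met, their union would be a tight set avoiding S and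
  -- spanning `e`. Being disjoint they share no edge, so neither relief disturbs the degrees or the
  -- tightness in the other region.
  merge : ∀ {B S e} → Sparse G B → B e ≡ false → Unspanned B S e →
    Relief B S (src G e) → Relief B S (tgt G e) → Merged B S e
  merge {B} {S} {e} sp e∉B free (mkRelief {X} {B₁} tX X-avoids x∈X rX lowX lowerx) (mkRelief {Y} {B₁′} tY Y-avoids y∈Y rY lowY lowery) = record
    { e∈U = e∈U
    ; avoids = U-avoids
    ; replaces = rU
    ; e∉B₂ = trans (outside rY₂ e (off Y (∉Y x∈X) x∋e)) (trans (outside rX e (off X (∉X y∈Y) y∋e)) e∉B)
    -- `D` meets X in `src G e` and Y in `tgt G e`, so the two regions are joined to it one after
    -- the other.
    ; tight-∪U = λ {D} tD e∈D → tight-cong {G} (assoc-to D) (assoc-from D)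
        (tight-∪ {G} (sparse′ rU) (tight-∪ {G} (sparse′ rU) tD tX₂ (proj₁ (∧-elim e∈D)) x∈X) tY₂
          (∪-introˡ {X = D} {X} y (proj₂ (∧-elim {D x} e∈D))) y∈Y)
    ; low = low
    }
    where
    x y : Fin (nV G)
    x = src G e
    y = tgt G e
    U : Subset (nV G)
    U = X ∪ Y
    U-avoids : U ⊆ˢ ∁ S
    U-avoids = ∪-elim {X = X} {Y} {∁ S} X-avoids Y-avoids
    e∈U : e ∈ˢ inside G U
    e∈U = ∩-intro {X = U ∘ src G} {U ∘ tgt G} (∪-introˡ {X = X} {Y} x x∈X) (∪-introʳ {X = X} {Y} y y∈Y)
    assoc-to : ∀ D → ((D ∪ X) ∪ Y) ⊆ˢ (D ∪ U)
    assoc-to D v h with D v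
    ... | true = refl
    ... | false = h
    assoc-from : ∀ D → (D ∪ U) ⊆ˢ ((D ∪ X) ∪ Y)
    assoc-from D v h with D v
    ... | true = refl
    ... | false = h
    separate : ∀ {v} → v ∈ˢ X → v ∈ˢ Y → ⊥
    separate v∈X v∈Y = free (U , tight-∪ {G} sp tX tY v∈X v∈Y , U-avoids , e∈U)
    ∉X : ∀ {v} → v ∈ˢ Y → X v ≡ false
    ∉X p = ≢true⇒≡false λ q → separate q p
    ∉Y : ∀ {v} → v ∈ˢ X → Y v ≡ false
    ∉Y p = ≢true⇒≡false λ q → separate p q
    off : ∀ W {v e′} → W v ≡ false → e′ ∈ˢ inc G v → inside G W e′ ≡ false
    off W v∉W e′∋v = ≢true⇒≡false λ i → true≢false (inc-inside {G} {X = W} e′∋v i) v∉W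
    x∋e : e ∈ˢ inc G x
    x∋e rewrite ==-refl x = refl
    y∋e : e ∈ˢ inc G y
    y∋e = ∪-introʳ {X = λ e → src G e == y} {λ e → tgt G e == y} e (==-refl y)
    ins-B₁-Y : ins G B₁ Y ≡ ins G B Y
    ins-B₁-Y = ins-cong {G} {Y} λ e′ i → outside rX e′ (≢true⇒≡false λ j → separate (proj₁ (∧-elim j)) (proj₁ (∧-elim i)))
    tY₁ : Tight G B₁ Y
    tY₁ = tight (point∈ tY) (subst (λ z → 2 * count Y ≤ z + 2) (sym ins-B₁-Y) (edges≥ tY))
    -- `B₁` already contains the relief of x; its edges inside Y are replaced by those of `B₁′`, the
    -- relief of y.
    B₂ : Subset (nE G)
    B₂ = override {G} Y B₁ B₁′
    rY₂ : Replaces {G} Y B₁ B₂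
    rY₂ = override-replaces {G} (sparse′ rX) tY₁ (sparse′ rY) (trans (ins-≡ rY) (sym ins-B₁-Y))
    rU : Replaces {G} U B B₂
    rU = replaces-trans {G} (replaces-⊆ {G} (∪-introˡ {X = X} {Y}) rX) (replaces-⊆ {G} (∪-introʳ {X = X} {Y}) rY₂)
    tY₂ : Tight G B₂ Y
    tY₂ = tight-→ {G} rY₂ tY₁
    tX₂ : Tight G B₂ X
    tX₂ = tight (point∈ tX) (subst (λ z → 2 * count X ≤ z + 2)
      (sym (trans (ins-cong {G} {X} λ e′ i → outside rY₂ e′ (≢true⇒≡false λ j →
        separate (proj₁ (∧-elim i)) (proj₁ (∧-elim j)))) (ins-≡ rX))) (edges≥ tX))
    deg-X : ∀ w → w ∈ˢ X → deg G B₂ w ≡ deg G B₁ w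
    deg-X w w∈X = deg-cong {G} λ e′ i → outside rY₂ e′ (off Y (∉Y w∈X) i)
    deg-Y : ∀ w → w ∈ˢ Y → deg G B₂ w ≡ deg G B₁′ w
    deg-Y w w∈Y = deg-cong {G} λ e′ i → case true-or-false (inside G Y e′) of λ
      { (inj₁ j) → cong (λ b → if b then B₁′ e′ else B₁ e′) j
      ; (inj₂ j) → trans (outside rY₂ e′ j) (trans (outside rX e′ (off X (∉X w∈Y) i)) (sym (outside rY e′ j))) }
    end : ∀ {w} → e ∈ˢ inc G w → w ≡ x ⊎ w ≡ y
    end {w} i with other-end {G} {e} {w} i
    ... | _ , inj₁ (p , _) = inj₁ (sym p)
    ... | _ , inj₂ (p , _) = inj₂ (sym p)
    plus : ∀ {a d d′} b → a ≡ d → (b ≡ true → suc d ≤ d′) → (b ≡ false → d ≤ d′) → a + ⟦ b ⟧ ≤ d′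
    plus {a} {d′ = d′} true refl p _ = subst (λ z → z ≤ d′) (+-comm 1 a) (p refl)
    plus {a} {d′ = d′} false refl _ q = subst (λ z → z ≤ d′) (sym (+-identityʳ a)) (q refl)
    low : ∀ w → w ∈ˢ U → deg G B₂ w + ⟦ inc G w e ⟧ ≤ h w
    low w w∈ = [ in-X , (λ w∉X → in-Y (resolve w∉X w∈)) ]′ (true-or-false (X w))
      where
      resolve : X w ≡ false → w ∈ˢ U → w ∈ˢ Y
      resolve p q = subst (λ b → b ∨ Y w ≡ true) p q
      in-X : w ∈ˢ X → deg G B₂ w + ⟦ inc G w e ⟧ ≤ h w
      in-X w∈X = plus (inc G w e) (deg-X w w∈X)
        (λ i → [ (λ { refl → lowerx }) , (λ { refl → ⊥-elim (separate w∈X y∈Y) }) ]′ (end i)) λ _ → lowX w w∈X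
      in-Y : w ∈ˢ Y → deg G B₂ w + ⟦ inc G w e ⟧ ≤ h w
      in-Y w∈Y = plus (inc G w e) (deg-Y w w∈Y)
        (λ i → [ (λ { refl → ⊥-elim (separate x∈X w∈Y) }) , (λ { refl → lowery }) ]′ (end i)) λ _ → lowY w w∈Y

  -- The result of adding e and deleting an edge at s of the circuit it closes.
  record Exchanged (B : Subset (nE G)) (U Z : Subset (nV G)) (s : Fin (nV G)) : Set where
    field
      {B₃}     : Subset (nE G)
      replaces : Replaces {G} Z B B₃
      low      : ∀ w → w ∈ˢ U → deg G B₃ w ≤ h w
      no-worse : ∀ w → U w ≡ false → deg G B₃ w ≤ deg G B w
      better   : suc (deg G B₃ s) ≡ deg G B s

  -- `tight-degree` yields an edge g of `B₂` at `s` inside `D`, and minimality of `D` places g in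
  -- every tight set spanning `e`, so `swap-sparse` applies. As `s` is outside `U`, neither the
  -- reliefs nor `e` touch it, and losing g lowers its degree by exactly one.
  exchange : ∀ {B S e} (M : Merged B S e) → let open Merged M in ∀ {D} → Tight G B₂ D → e ∈ˢ inside G D →
    (∀ W → Tight G B₂ W → src G e ∈ˢ W → tgt G e ∈ˢ W → D ⊆ˢ W) →
    ∀ {s} → s ∈ˢ D → U s ≡ false → Exchanged B U (D ∪ U) s
  exchange {B} {S} {e} M {D} tD e∈D D⊆ {s} s∈D s∉U = record
    { replaces = replaces-trans {G} (replaces-⊆ {G} (∪-introʳ {X = D} {U}) M.replaces)
        (swap-replaces {G} {D ∪ U} e∉B₂ g∈B₂ (inside-mono {G} D⊆Z e e∈D) (inside-mono {G} D⊆Z g g∈D)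
          (swap-sparse {G} e∉B₂ g∈B₂ (sparse′ M.replaces) λ W tW e∈W →
            inside-mono {G} (D⊆ W tW (proj₁ (∧-elim e∈W)) (proj₂ (∧-elim {W (src G e)} e∈W))) g g∈D))
    ; low = λ w w∈ → ≤-trans (≤-trans (m≤m+n _ _) (≤-reflexive (deg₃ w))) (M.low w w∈)
    ; no-worse = λ w w∉ → ≤-trans (m≤m+n _ _) (≤-reflexive (deg₃-off w w∉))
    ; better = trans (+-comm 1 _) (trans (cong (λ b → deg G (swap {G} B₂ e g) s + ⟦ b ⟧) (sym g∋s)) (deg₃-off s s∉U))
    }
    where
    module M = Merged M
    open Merged M using (U; B₂; e∉B₂)
    D⊆Z : D ⊆ˢ (D ∪ U)
    D⊆Z = ∪-introˡ {X = D} {U}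
    edge : ∃ λ g → g ∈ˢ (B₂ ∩ (inside G D ∩ inc G s))
    edge = count-∃ (≤-trans (n≤1+n 1) (tight-degree {G} (sparse′ M.replaces) tD s∈D (proj₁ (∧-elim e∈D))
      λ { refl → true≢false (proj₁ (∧-elim M.e∈U)) s∉U }))
    g : Fin (nE G)
    g = proj₁ edge
    g∈B₂ : g ∈ˢ B₂
    g∈B₂ = proj₁ (∧-elim (proj₂ edge))
    g∈D : g ∈ˢ inside G D
    g∈D = proj₁ (∧-elim (proj₂ (∧-elim {B₂ g} (proj₂ edge))))
    g∋s : g ∈ˢ inc G s
    g∋s = proj₂ (∧-elim {inside G D g} (proj₂ (∧-elim {B₂ g} (proj₂ edge))))
    deg₃ : ∀ w → deg G (swap {G} B₂ e g) w + ⟦ inc G w g ⟧ ≡ deg G B₂ w + ⟦ inc G w e ⟧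
    deg₃ = deg-swap {G} e∉B₂ g∈B₂
    off-U : ∀ w → U w ≡ false → ∀ e′ → e′ ∈ˢ inside G U → inc G w e′ ≡ false
    off-U w w∉ e′ i = ≢true⇒≡false λ j → true≢false (inc-inside {G} {X = U} j i) w∉
    deg₃-off : ∀ w → U w ≡ false → deg G (swap {G} B₂ e g) w + ⟦ inc G w g ⟧ ≡ deg G B w
    deg₃-off w w∉ = trans (deg₃ w) (trans (cong (λ b → deg G B₂ w + ⟦ b ⟧) (off-U w w∉ e M.e∈U)) (trans (+-identityʳ _)
      (deg-cong {G} λ e′ i → outside M.replaces e′ (≢true⇒≡false λ j → true≢false i (off-U w w∉ e′ j)))))

  module _ {B : Subset (nE G)} (sp : Sparse G B) (tB : Tight G B all)
           (least : ∀ B′ → Sparse G B′ → Tight G B′ all → excess B ≤ excess B′) where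

    -- Performing the exchange would lower the total excess: vertices of `U` end within their
    -- bounds, no other degree grows, and `s` improves strictly.
    not-overfull : ∀ {U Z s} → Exchanged B U Z s → ¬ h s < deg G B s
    not-overfull {U} {Z} {s} E over = <⇒≱ (∑-mono-< weak s strict)
      (least B₃ (sparse′ replaces) (tight-→ {G} (replaces-⊆ {G} (λ _ _ → refl) replaces) tB))
      where
      open Exchanged E
      weak : ∀ w → deg G B₃ w ∸ h w ≤ deg G B w ∸ h w
      weak w = [ (λ w∈ → ≤-trans (≤-reflexive (m≤n⇒m∸n≡0 (low w w∈))) z≤n) , (λ w∉ → ∸-monoˡ-≤ (h w) (no-worse w w∉)) ]′
        (true-or-false (U w))
      strict : deg G B₃ s ∸ h s < deg G B s ∸ h s
      strict = subst (λ d → deg G B₃ s ∸ h s < d ∸ h s) better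
        (≤-reflexive (sym (+-∸-assoc 1 (≤-pred (subst (h s <_) (sym better) over)))))

    -- `D` meets S, as otherwise `D ∪ U` would be a tight set avoiding S and spanning `e`. No vertex
    -- of `D` is overfull, by `not-overfull`. So for each v in both S and `D`, the exchange at v
    -- inside `D ∪ U` keeps all degrees there within bounds and puts v strictly below its own, which
    -- is a relief of v.
    relieve : ∀ {S e} → Critical B S → Unspanned B S e → (M : Merged B S e) → let open Merged M in
      ∀ {D} → Tight G B₂ D → e ∈ˢ inside G D →
      (∀ W → Tight G B₂ W → src G e ∈ˢ W → tgt G e ∈ˢ W → D ⊆ˢ W) →
      Critical B (S ∩ ∁ D) × count (S ∩ ∁ D) < count S
    relieve {S} {e} crit free M {D} tD e∈D D⊆ = record { relief = relief′ ; overfull = overfull′ ; atBound = λ v p → atBound v (S′⊆S v p) } , smaller meets-S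
      where
      open Critical crit
      module M = Merged M
      open Merged M using (U; B₂; e∉B₂)
      S′ Z : Subset (nV G)
      S′ = S ∩ ∁ D
      Z = D ∪ U
      S′⊆S : S′ ⊆ˢ S
      S′⊆S v = proj₁ ∘ ∧-elim
      widen : ∀ v → v ∈ˢ ∁ S → v ∈ˢ ∁ S′
      widen v p with S v
      ... | false = refl
      D-avoids : D ⊆ˢ ∁ S′
      D-avoids v v∈D rewrite v∈D with S v
      ... | true = refl
      ... | false = refl
      tZ : Tight G B Z
      tZ = tight-← {G} (replaces-⊆ {G} (∪-introʳ {X = D} {U}) M.replaces) (M.tight-∪U tD e∈D)
      meets-S : ∃ λ s → s ∈ˢ (S ∩ D)
      meets-S with any? (λ s → (S ∩ D) s Bool.≟ true)
      ... | yes p = p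
      ... | no none = ⊥-elim (free (Z , tZ
          , ∪-elim {X = D} {U} {∁ S} (λ v v∈D → [ (λ v∈S → ⊥-elim (none (v , ∩-intro {X = S} {D} v∈S v∈D))) , id ]′ (∈-or-∉ S v)) M.avoids
          , inside-mono {G} (∪-introˡ {X = D} {U}) e e∈D))
      smaller : (∃ λ s → s ∈ˢ (S ∩ D)) → count S′ < count S
      smaller (s , s∈) = count-⊂ {X = S′} {S} S′⊆S s (off (S s) (D s) s∈) (proj₁ (∧-elim s∈))
        where
        off : ∀ a b → a ∧ b ≡ true → a ∧ not b ≡ false
        off true true _ = refl
      E : ∀ {v} → v ∈ˢ S → v ∈ˢ D → Exchanged B U Z v
      E v∈S v∈D = exchange M tD e∈D D⊆ v∈D (≢true⇒≡false λ i → true≢false v∈S (∁-∌ {X = S} (M.avoids _ i)))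
      ok : ∀ w → w ∈ˢ D → deg G B w ≤ h w
      ok w w∈D = ≮⇒≥ λ over → not-overfull (E (overfull w over) w∈D) over
      overfull′ : ∀ v → h v < deg G B v → v ∈ˢ S′
      overfull′ v over = ∩-intro {X = S} {∁ D} (overfull v over)
        ([ (λ v∈D → ⊥-elim (not-overfull (E (overfull v over) v∈D) over)) , id ]′ (∈-or-∉ D v))
      old : ∀ {v} → Relief B S v → Relief B S′ v
      old (mkRelief t a v∈ r l l′) = mkRelief t (λ w p → widen w (a w p)) v∈ r l l′
      new : ∀ {v} → v ∈ˢ D → Exchanged B U Z v → Relief B S′ v
      new {v} v∈D E = mkRelief tZ (∪-elim {X = D} {U} {∁ S′} D-avoids λ w p → widen w (M.avoids w p)) (∪-introˡ {X = D} {U} v v∈D)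
        replaces low-Z (subst (_≤ h v) (sym better) (ok v v∈D))
        where
        open Exchanged E
        low-Z : ∀ w → w ∈ˢ Z → deg G B₃ w ≤ h w
        low-Z w w∈Z = [ low w , (λ w∉U → ≤-trans (no-worse w w∉U) (ok w (in-D (D w) (U w) w∈Z w∉U))) ]′ (true-or-false (U w))
          where
          in-D : ∀ a b → a ∨ b ≡ true → b ≡ false → a ≡ true
          in-D true _ _ _ = refl
          in-D false _ refl ()
      relief′ : ∀ v → v ∈ˢ ∁ S′ → Relief B S′ v
      relief′ v v∉S′ with ∈-or-∉ S v | ∈-or-∉ D v
      ... | inj₂ v∉S | _ = old (relief v v∉S)
      ... | inj₁ v∈S | inj₁ v∈D = new v∈D (E v∈S v∈D)
      ... | inj₁ v∈S | inj₂ v∉D = ⊥-elim (true≢false (∩-intro {X = S} {∁ D} v∈S v∉D) (∁-∌ {X = S′} v∉S′))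

    shrink : ∀ {S e} → Critical B S → B e ≡ false → e ∈ˢ inside G (∁ S) → Unspanned B S e →
      ¬ ¬ ∃ λ S′ → Critical B S′ × count S′ < count S
    shrink {S} {e} crit e∉B e∉S free = do
      let M = merge sp e∉B free (Critical.relief crit _ (proj₁ (∧-elim e∉S))) (Critical.relief crit _ (proj₂ (∧-elim {∁ S (src G e)} e∉S)))
          r = Merged.replaces M
      (D , tD , x∈D , y∈D , D⊆) ← minimal-tight {G} (sparse′ r) (tight-→ {G} (replaces-⊆ {G} (λ _ _ → refl) r) tB) (src G e) (tgt G e)
      return (S ∩ ∁ D , relieve crit free M tD (∩-intro {X = D ∘ src G} {D ∘ tgt G} x∈D y∈D) D⊆)

    critical-set : (∀ S → Critical B S → Saturated {G} B (∁ S) → ⊥) → ⊥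
    critical-set stuck = go _ (initially-critical sp) (<-wellFounded _)
      where
      go : ∀ S → Critical B S → Acc _<_ (count S) → ⊥
      go S crit (acc rs) = ¬¬-excluded-middle {A = ∃ λ e → B e ≡ false × e ∈ˢ inside G (∁ S) × Unspanned B S e}
        λ { (yes (e , e∉B , e∉S , free)) → shrink crit e∉B e∉S free λ (S′ , crit′ , smaller) → go S′ crit′ (rs smaller)
          ; (no none) → stuck S crit λ e e∉S e∉B ¬Y → none (e , e∉B , e∉S , ¬Y) }

-- Bases of bounded degree

module _ (G : Graph) (f : Fin (nV G) → ℕ) (cond : ΩCondition G f) where

  -- The condition says nothing about the null graph, which has no labelled partition; when
  -- every vertex is critical, one vertex is kept.
  all-critical : ∀ {B S} → Sparse G B → Critical G (bound G f) B S → (∀ w → ¬ w ∈ˢ ∁ S) →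
    ∀ {u v} → u ≢ v → bound G f u < deg G B u → ⊥
  all-critical {B} {S} sp crit S-all {u} {v} u≢v over =
    obstruction G f cond sp (remove S v) sat (cong not (remove-∌ {X = S} v))
      (λ w w∈ → Critical.atBound crit w (remove-⊆ {X = S} {v} w w∈))
      (remove-∈ {X = S} (u≢v ∘ sym) (Critical.overfull crit u over)) over
    where
    only-v : ∀ w → w ∈ˢ ∁ (remove S v) → v ≡ w
    only-v w w∉ with v ≟ w
    ... | yes p = p
    ... | no _ = ⊥-elim (S-all w w∉)
    -- Only `v` remains outside, and a single vertex spans no edge.
    sat : Saturated {G} B (∁ (remove S v))
    sat e e∈ _ = ⊥-elim (loopless G e (trans (sym (only-v _ (proj₁ (∧-elim e∈))))
      (only-v _ (proj₂ (∧-elim {∁ (remove S v) (src G e)} e∈)))))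

  neighbour-of : ∀ {B u} → 1 ≤ deg G B u → ∃ λ v → u ≢ v
  neighbour-of {B} {u} d =
    let (e , e∈) = count-∃ {X = B ∩ inc G u} (≤-trans d (≤-reflexive (deg-count G B u)))
        (v , j) = other-end {G} {e} {u} (proj₂ (∧-elim {B e} e∈))
    in v , joins-≢ {G} j

  no-critical : ∀ {B} → Sparse G B → ∀ {u} → bound G f u < deg G B u →
    ∀ S → Critical G (bound G f) B S → Saturated {G} B (∁ S) → ⊥
  no-critical {B} sp {u} over S crit sat = case any? (λ v → ∁ S v Bool.≟ true) of λ
    { (yes (v , v∉S)) → obstruction G f cond sp S sat v∉S (Critical.atBound crit) (Critical.overfull crit u over) over
    ; (no S-all) → all-critical sp crit (λ w w∉ → S-all (w , w∉)) (proj₂ (neighbour-of {B} (≤-trans (s≤s z≤n) over))) over }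

  bounded-base : TreeConnected G 2 (full G) → ¬ ¬ ∃ λ B → Sparse G B × Tight G B all × (∀ v → deg G B v ≤ bound G f v)
  bounded-base tc = do
    (B₀ , sp₀ , t₀) ← tight-base tc
    ((B , sp , tB) , least) ← minimiser {A = ∃ λ B → Sparse G B × Tight G B all} (λ b → excess G (bound G f) (proj₁ b)) (B₀ , sp₀ , t₀)
    return (B , sp , tB , λ v → ≮⇒≥ λ over →
      critical-set G (bound G f) sp tB (λ B′ sp′ t′ → least (B′ , sp′ , t′)) (no-critical sp over))

-- Even subgraphs

odd : ℕ → Bool
odd zero = false
odd (suc n) = not (odd n)

odd-+ : ∀ a b → odd (a + b) ≡ odd a xor odd b
odd-+ zero b = refl
odd-+ (suc a) b rewrite odd-+ a b = Bool.not-distribˡ-xor (odd a) (odd b)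

odd-⟦⟧ : ∀ b → odd ⟦ b ⟧ ≡ b
odd-⟦⟧ true = refl
odd-⟦⟧ false = refl

odd-double : ∀ a → odd (a + a) ≡ false
odd-double a rewrite odd-+ a a = Bool.xor-same (odd a)

odd-∑-false : ∀ {n} (f : Fin n → ℕ) → (∀ i → odd (f i) ≡ false) → odd (∑ f) ≡ false
odd-∑-false {zero} f h rewrite ∑-empty f = refl
odd-∑-false {suc n} f h rewrite ∑-suc f | odd-+ (f zero) (∑ (f ∘ suc)) | h zero = odd-∑-false (f ∘ suc) (h ∘ suc)

odd-∑ : ∀ {n} (f : Fin n → ℕ) i → (∀ j → i ≢ j → odd (f j) ≡ false) → odd (∑ f) ≡ odd (f i)
odd-∑ f zero h rewrite ∑-suc f | odd-+ (f zero) (∑ (f ∘ suc)) | odd-∑-false (f ∘ suc) (λ j → h (suc j) λ ()) =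
  Bool.xor-identityʳ (odd (f zero))
odd-∑ f (suc i) h rewrite ∑-suc f | odd-+ (f zero) (∑ (f ∘ suc)) | h zero (λ ()) =
  odd-∑ (f ∘ suc) i λ j i≢j → h (suc j) λ { refl → i≢j refl }

toggle : ∀ {n} → Subset n → Fin n → Subset n
toggle X i j = (i == j) xor X j

module _ {G : Graph} where

  deg-remove : ∀ {E e} → E e ≡ true → ∀ w → deg G (remove E e) w + ⟦ inc G w e ⟧ ≡ deg G E w
  deg-remove {E} {e} h w rewrite deg-count G E w | deg-count G (remove E e) w = count-remove E (inc G w) e h

  inc-xor : ∀ w e → inc G w e ≡ (src G e == w) xor (tgt G e == w)
  inc-xor w e = lemma (src G e == w) (tgt G e == w) (loop-free {G} e w)
    where
    lemma : ∀ p q → p ∧ q ≡ false → p ∨ q ≡ p xor q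
    lemma = by-cases (∀ᵇ? λ p → ∀ᵇ? λ q → (_ Bool.≟ _) →-dec (_ Bool.≟ _))

  joins-xor : ∀ {e x y} → Joins G e x y → ∀ w → inc G w e ≡ (x == w) xor (y == w)
  joins-xor {e} (inj₁ (refl , refl)) w = inc-xor w e
  joins-xor {e} (inj₂ (refl , refl)) w = trans (inc-xor w e) (Bool.xor-comm (src G e == w) (tgt G e == w))

  odd-deg-remove : ∀ {E e} → E e ≡ true → ∀ w → odd (deg G (remove E e) w) ≡ odd (deg G E w) xor inc G w e
  odd-deg-remove {E} {e} h w = lemma _ _ _ (trans (cong (odd (deg G (remove E e) w) xor_) (sym (odd-⟦⟧ (inc G w e))))
    (trans (sym (odd-+ (deg G (remove E e) w) _)) (cong odd (deg-remove {E} h w))))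
    where
    lemma : ∀ p q r → p xor q ≡ r → p ≡ r xor q
    lemma = by-cases (∀ᵇ? λ p → ∀ᵇ? λ q → ∀ᵇ? λ r → (_ Bool.≟ _) →-dec (_ Bool.≟ _))

  odd-deg-toggle : ∀ E e w → odd (deg G (toggle E e) w) ≡ odd (deg G E w) xor inc G w e
  odd-deg-toggle E e w with true-or-false (E e)
  ... | inj₁ h = trans (cong odd (deg-cong {G} λ e′ _ → toggle≡ e′)) (odd-deg-remove {E} h w)
    where
    toggle≡ : ∀ e′ → toggle E e e′ ≡ remove E e e′
    toggle≡ e′ with e ≟ e′
    ... | yes refl rewrite h = refl
    ... | no _ = refl
  ... | inj₂ h = trans (cong odd (trans (deg-cong {G} λ e′ _ → toggle≡ e′) deg-insert))
      (trans (odd-+ (deg G E w) _) (cong (odd (deg G E w) xor_) (odd-⟦⟧ _)))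
    where
    toggle≡ : ∀ e′ → toggle E e e′ ≡ insert E e e′
    toggle≡ e′ with e ≟ e′
    ... | yes refl rewrite h = refl
    ... | no _ = refl
    deg-insert : deg G (insert E e) w ≡ deg G E w + ⟦ inc G w e ⟧
    deg-insert rewrite deg-count G E w | deg-count G (insert E e) w = count-insert E (inc G w) e h

  even-degree-sum : ∀ E → odd (∑ (deg G E)) ≡ false
  even-degree-sum E = subst (λ s → odd s ≡ false) sum≡ (odd-double (count E))
    where
    sum≡ : count E + count E ≡ ∑ (deg G E)
    sum≡ = trans (cong (count E +_) (sym (ins-all {G} E))) (trans (degree-sum {G} E all)
      (cong₂ _+_ (trans (ins-count G E (∁ all)) (count-none λ e → Bool.∧-zeroʳ (E e))) (∑-cong λ v → +-identityʳ _)))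

  second-odd : ∀ E {u} → odd (deg G E u) ≡ true → ∃ λ v → u ≢ v × odd (deg G E v) ≡ true
  second-odd E {u} h with any? (λ v → ¬? (u ≟ v) ×-dec (odd (deg G E v) Bool.≟ true))
  ... | yes p = p
  ... | no none = ⊥-elim (true≢false h (trans (sym (odd-∑ (deg G E) u λ v u≢v → ≢true⇒≡false λ q → none (v , u≢v , q)))
    (even-degree-sum E)))

  Between : Subset (nE G) → Subset (nE G) → Subset (nE G) → Set
  Between T B E = T ⊆ˢ E × E ⊆ˢ B

  -- Toggling the edges of a path in T₂ changes the parities of its two ends only.
  even-between : ∀ {T₁ T₂ B} → T₁ ⊆ˢ B → T₂ ⊆ˢ B → (∀ e → e ∈ˢ T₁ → e ∈ˢ T₂ → ⊥) → Connects (src G) (tgt G) T₂ all →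
    ¬ ¬ ∃ λ E → Between T₁ B E × (∀ w → odd (deg G E w) ≡ false)
  even-between {T₁} {T₂} {B} T₁⊆B T₂⊆B disjoint conn = do
    ((E , btw) , least) ← minimiser {A = ∃ (Between T₁ B)} (λ E → count λ w → odd (deg G (proj₁ E) w)) (T₁ , (λ _ → id) , T₁⊆B)
    return (E , btw , λ u → ≢true⇒≡false (improve btw λ E′ b → least (E′ , b)))
    where
    Flipped : Subset (nE G) → Fin (nV G) → Fin (nV G) → Set
    Flipped E u w = ∃ λ E′ → Between T₁ B E′ × (∀ z → odd (deg G E′ z) ≡ odd (deg G E z) xor ((u == z) xor (w == z)))
    along : ∀ {E u e w w′} → e ∈ˢ T₂ → Joins G e w w′ → Flipped E u w → Flipped E u w′
    along {E} {u} {e} {w} {w′} e∈ j (E′ , (T₁⊆ , ⊆B) , par) = toggle E′ e , (T₁⊆′ , ⊆B′) , λ z →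
      trans (odd-deg-toggle E′ e z) (lemma (odd (deg G E z)) (u == z) (w == z) (w′ == z) (inc G z e) _ (par z) (joins-xor j z))
      where
      T₁⊆′ : T₁ ⊆ˢ toggle E′ e
      T₁⊆′ e′ h with e ≟ e′
      ... | yes refl = ⊥-elim (disjoint e h e∈)
      ... | no _ = T₁⊆ e′ h
      ⊆B′ : toggle E′ e ⊆ˢ B
      ⊆B′ e′ h with e ≟ e′
      ... | yes refl = T₂⊆B e e∈
      ... | no _ = ⊆B e′ h
      lemma : ∀ o p q r i o′ → o′ ≡ o xor (p xor q) → i ≡ q xor r → o′ xor i ≡ o xor (p xor r)
      lemma o p q r _ _ refl refl = lemma′ o p q r
        where
        lemma′ : ∀ o p q r → (o xor (p xor q)) xor (q xor r) ≡ o xor (p xor r)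
        lemma′ = by-cases (∀ᵇ? λ o → ∀ᵇ? λ p → ∀ᵇ? λ q → ∀ᵇ? λ r → _ Bool.≟ _)
    -- The ends w for which the parities at `u` and w can be flipped form a cut. It contains `u`,
    -- and by `along` no edge of `T₂` crosses it.
    flip-any : ∀ {E} → Between T₁ B E → ∀ u v → ¬ ¬ Flipped E u v
    flip-any {E} btw u v = do
      flipped? ← ¬¬-∀ _ λ w → ¬¬-excluded-middle {A = Flipped E u w}
      return (does-true (flipped? v) (trans (sym (conn (λ w → does (flipped? w)) (stable flipped?) refl refl))
        (dec-true (flipped? u) (E , btw , λ z → unchanged (odd (deg G E z)) (u == z)))))
      where
      unchanged : ∀ o p → o ≡ o xor (p xor p)
      unchanged = by-cases (∀ᵇ? λ o → ∀ᵇ? λ p → _ Bool.≟ _)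
      stable : (d : ∀ w → Dec (Flipped E u w)) → ∀ e → e ∈ˢ T₂ → does (d (src G e)) ≡ does (d (tgt G e))
      stable d e e∈ with d (src G e) | d (tgt G e)
      ... | yes _ | yes _ = refl
      ... | no _ | no _ = refl
      ... | yes p | no q = ⊥-elim (q (along {E} {u} e∈ (inj₁ (refl , refl)) p))
      ... | no q | yes p = ⊥-elim (q (along {E} {u} e∈ (inj₂ (refl , refl)) p))
    -- An odd vertex has an odd companion by the handshake lemma, and flipping the two leaves fewer
    -- odd vertices.
    improve : ∀ {E} → Between T₁ B E →
      (∀ E′ → Between T₁ B E′ → count (λ w → odd (deg G E w)) ≤ count (λ w → odd (deg G E′ w))) →
      ∀ {u} → odd (deg G E u) ≡ true → ⊥
    improve {E} btw least {u} odd-u with second-odd E odd-u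
    ... | v , u≢v , odd-v = flip-any btw u v λ (E′ , btw′ , par) →
      <⇒≱ (count-⊂ {X = λ w → odd (deg G E′ w)} {λ w → odd (deg G E w)} (subset par) u
        (trans (par u) (at-u (odd (deg G E u)) (u == u) (v == u) odd-u (==-refl u) (≢⇒==-false (u≢v ∘ sym)))) odd-u)
      (least E′ btw′)
      where
      at-u : ∀ o p q → o ≡ true → p ≡ true → q ≡ false → o xor (p xor q) ≡ false
      at-u _ _ _ refl refl refl = refl
      subset : ∀ {E′} → (∀ z → odd (deg G E′ z) ≡ odd (deg G E z) xor ((u == z) xor (v == z))) →
        (λ w → odd (deg G E′ w)) ⊆ˢ (λ w → odd (deg G E w))
      subset par z h with u ≟ z | v ≟ z | par z
      ... | yes refl | _ | _ = odd-u
      ... | no _ | yes refl | _ = odd-v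
      ... | no _ | no _ | q = trans (sym (Bool.xor-identityʳ (odd (deg G E z)))) (trans (sym q) h)

-- Trails

module _ {G : Graph} where

  -- The traversed edges, each with the vertex it leads to.
  Walk : Set
  Walk = List (Fin (nE G) × Fin (nV G))

  IsWalk : Fin (nV G) → Walk → Fin (nV G) → Set
  IsWalk u [] w = u ≡ w
  IsWalk u ((e , z) ∷ L) w = Joins G e u z × IsWalk z L w

  uses : Walk → Fin (nE G) → ℕ
  uses [] e = 0
  uses ((e′ , _) ∷ L) e = ⟦ e′ == e ⟧ + uses L e

  -- The last vertex is left out, so that a closed walk counts its start once, in agreement with
  -- `meets`.
  visits : Fin (nV G) → Walk → Fin (nV G) → ℕ
  visits u [] w = 0
  visits u ((_ , z) ∷ L) w = ⟦ u == w ⟧ + visits z L w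

  on : Fin (nV G) → Walk → Subset (nV G)
  on u [] w = u == w
  on u ((_ , z) ∷ L) w = (u == w) ∨ on z L w

  IsWalk-++ : ∀ {u v w} L M → IsWalk u L v → IsWalk v M w → IsWalk u (L ++ M) w
  IsWalk-++ [] M refl q = q
  IsWalk-++ (_ ∷ L) M (j , p) q = j , IsWalk-++ L M p q

  uses-++ : ∀ L M e → uses (L ++ M) e ≡ uses L e + uses M e
  uses-++ [] M e = refl
  uses-++ ((e′ , _) ∷ L) M e = trans (cong (⟦ e′ == e ⟧ +_) (uses-++ L M e)) (sym (+-assoc ⟦ e′ == e ⟧ _ _))

  cut-at : ∀ {u v x} L → IsWalk u L v → x ∈ˢ on u L → ∃₂ λ L₁ L₂ → L ≡ L₁ ++ L₂ × IsWalk u L₁ x × IsWalk x L₂ v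
  cut-at [] p h = [] , [] , refl , ==⇒≡ h , trans (sym (==⇒≡ h)) p
  cut-at {u} {x = x} ((e , z) ∷ L) (j , p) h with u ≟ x
  ... | yes refl = [] , (e , z) ∷ L , refl , refl , (j , p)
  ... | no _ with cut-at L p h
  ...   | L₁ , L₂ , refl , p₁ , p₂ = (e , z) ∷ L₁ , L₂ , refl , (j , p₁) , p₂

  on-start : ∀ u L → u ∈ˢ on u L
  on-start u [] = ==-refl u
  on-start u (_ ∷ L) rewrite ==-refl u = refl

  used-on : ∀ {u v} L → IsWalk u L v → ∀ e → 1 ≤ uses L e → src G e ∈ˢ on u L × tgt G e ∈ˢ on u L
  used-on {u} ((e′ , z) ∷ L) (j , p) e h with e′ ≟ e
  ... | no _ with used-on L p e h
  ...   | a , b = ∪-introʳ {X = u ==_} {on z L} _ a , ∪-introʳ {X = u ==_} {on z L} _ b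
  used-on {u} ((e′ , z) ∷ L) (inj₁ (refl , refl) , p) e h | yes refl =
    ∪-introˡ {X = u ==_} {on z L} u (==-refl u) , ∪-introʳ {X = u ==_} {on z L} z (on-start z L)
  used-on {u} ((e′ , z) ∷ L) (inj₂ (refl , refl) , p) e h | yes refl =
    ∪-introʳ {X = u ==_} {on z L} z (on-start z L) , ∪-introˡ {X = u ==_} {on z L} u (==-refl u)

  walkDeg : Walk → Fin (nV G) → ℕ
  walkDeg L w = ∑ λ e → uses L e * ⟦ inc G w e ⟧

  walkDeg-∷ : ∀ e z L w → walkDeg ((e , z) ∷ L) w ≡ ⟦ inc G w e ⟧ + walkDeg L w
  walkDeg-∷ e z L w = trans (∑-cong λ e′ → distrib ⟦ e == e′ ⟧ (uses L e′) ⟦ inc G w e′ ⟧)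
    (trans (∑-+ _ _) (cong (_+ walkDeg L w) (∑-δ e λ e′ → ⟦ inc G w e′ ⟧)))
    where
    distrib : ∀ a b c → (a + b) * c ≡ a * c + b * c
    distrib = solve-∀

  joins-inc : ∀ {e u z} → Joins G e u z → ∀ w → ⟦ inc G w e ⟧ ≡ ⟦ u == w ⟧ + ⟦ z == w ⟧
  joins-inc {e} j w = by-ends j
    where
    lemma : ∀ p q → p ∧ q ≡ false → ⟦ p ∨ q ⟧ ≡ ⟦ p ⟧ + ⟦ q ⟧
    lemma = by-cases (∀ᵇ? λ p → ∀ᵇ? λ q → (_ Bool.≟ _) →-dec (_ ℕ.≟ _))
    by-ends : ∀ {u z} → Joins G e u z → ⟦ inc G w e ⟧ ≡ ⟦ u == w ⟧ + ⟦ z == w ⟧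
    by-ends (inj₁ (refl , refl)) = lemma (src G e == w) (tgt G e == w) (loop-free {G} e w)
    by-ends (inj₂ (refl , refl)) = trans (lemma (src G e == w) (tgt G e == w) (loop-free {G} e w)) (+-comm ⟦ src G e == w ⟧ _)

  -- Each visit is a departure. Arrivals equal departures except that the start `u` has one arrival
  -- fewer and the end `v` one more.
  walkDeg-visits : ∀ {u v} L → IsWalk u L v → ∀ w → walkDeg L w + ⟦ u == w ⟧ ≡ 2 * visits u L w + ⟦ v == w ⟧
  walkDeg-visits {u} [] refl w = cong (_+ ⟦ u == w ⟧) (∑-zero λ _ → refl)
  walkDeg-visits {u} {v} ((e , z) ∷ L) (j , p) w rewrite walkDeg-∷ e z L w | joins-inc {e} j w =
    arith ⟦ u == w ⟧ ⟦ z == w ⟧ (walkDeg L w) (visits z L w) ⟦ v == w ⟧ (walkDeg-visits L p w)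
    where
    arith : ∀ a b d m c → d + b ≡ 2 * m + c → a + b + d + a ≡ 2 * (a + m) + c
    arith a b d m c h = trans (lemma a b d) (trans (cong (a + a +_) h) (lemma′ a m c))
      where
      lemma : ∀ a b d → a + b + d + a ≡ a + a + (d + b)
      lemma = solve-∀
      lemma′ : ∀ a m c → a + a + (2 * m + c) ≡ 2 * (a + m) + c
      lemma′ = solve-∀

  uses-∷ : ∀ E L {e z} → e ∈ˢ E → (∀ e′ → uses L e′ ≤ ⟦ remove E e e′ ⟧) → ∀ e′ → uses ((e , z) ∷ L) e′ ≤ ⟦ E e′ ⟧
  uses-∷ E L {e} e∈E few e′ with e ≟ e′ | few e′
  ... | yes refl | q = subst (λ b → suc (uses L e) ≤ ⟦ b ⟧) (sym e∈E) (s≤s q)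
  ... | no _ | q = q

  -- Following unused edges: as long as the two ends differ, the current one has odd degree.
  trail-between : ∀ k E {y x} → count E ≡ k → (∀ w → odd (deg G E w) ≡ (y == w) xor (x == w)) →
    ∃ λ L → IsWalk y L x × (∀ e → uses L e ≤ ⟦ E e ⟧)
  trail-between k E {y} {x} size par with y ≟ x
  ... | yes refl = [] , refl , λ _ → z≤n
  ... | no y≢x with count-∃ {X = E ∩ inc G y} (≤-trans odd⇒≥1 (≤-reflexive (deg-count G E y)))
    where
    odd⇒≥1 : 1 ≤ deg G E y
    odd⇒≥1 with deg G E y | trans (par y) (at-y (==-refl y) (≢⇒==-false (y≢x ∘ sym)))
      where
      at-y : ∀ {p q} → p ≡ true → q ≡ false → p xor q ≡ true
      at-y refl refl = refl
    ... | suc _ | _ = s≤s z≤n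
  ...   | e , h with other-end {G} {e} {y} (proj₂ (∧-elim {E e} h))
  ...     | z , j with k
  ...       | zero = ⊥-elim (count-0 {F = E} size e (proj₁ (∧-elim h)))
  ...       | suc k with trail-between k (remove E e) {z} {x} (suc-injective (trans (+-comm 1 _) (trans (count-remove-1 E e e∈E) size))) par′
    where
    e∈E : e ∈ˢ E
    e∈E = proj₁ (∧-elim h)
    par′ : ∀ w → odd (deg G (remove E e) w) ≡ (z == w) xor (x == w)
    par′ w = trans (odd-deg-remove {G} {E} e∈E w) (lemma (y == w) (z == w) (x == w) _ _ (par w) (joins-xor {G} j w))
      where
      lemma : ∀ p q r o i → o ≡ p xor r → i ≡ p xor q → o xor i ≡ q xor r
      lemma = by-cases (∀ᵇ? λ p → ∀ᵇ? λ q → ∀ᵇ? λ r → ∀ᵇ? λ o → ∀ᵇ? λ i → (_ Bool.≟ _) →-dec ((_ Bool.≟ _) →-dec (_ Bool.≟ _)))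
  ...         | L , p , few = (e , z) ∷ L , (j , p) , uses-∷ E L {e} {z} (proj₁ (∧-elim h)) few

module _ {G : Graph} {E : Subset (nE G)} where

  private
    unused : Walk {G} → Subset (nE G)
    unused L e = E e ∧ does (uses {G} L e ℕ.≟ 0)

    unused-split : ∀ L → (∀ e → uses {G} L e ≤ ⟦ E e ⟧) → ∀ e → ⟦ unused L e ⟧ + uses {G} L e ≡ ⟦ E e ⟧
    unused-split L h e with E e | uses {G} L e | h e
    ... | true | 0 | _ = refl
    ... | true | 1 | _ = refl
    ... | true | suc (suc _) | s≤s ()
    ... | false | 0 | _ = refl

    deg-unused : ∀ L → (∀ e → uses {G} L e ≤ ⟦ E e ⟧) → ∀ w → deg G (unused L) w + walkDeg {G} L w ≡ deg G E w
    deg-unused L h w = begin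
      deg G (unused L) w + walkDeg {G} L w
        ≡⟨ cong (_+ walkDeg {G} L w) (deg-∑ (unused L)) ⟩
      ∑ (λ e → ⟦ unused L e ⟧ * ⟦ inc G w e ⟧) + walkDeg {G} L w
        ≡⟨ ∑-+ _ _ ⟨
      ∑ (λ e → ⟦ unused L e ⟧ * ⟦ inc G w e ⟧ + uses {G} L e * ⟦ inc G w e ⟧)
        ≡⟨ ∑-cong (λ e → trans (distrib ⟦ unused L e ⟧ (uses {G} L e) ⟦ inc G w e ⟧) (cong (_* ⟦ inc G w e ⟧) (unused-split L h e))) ⟩
      ∑ (λ e → ⟦ E e ⟧ * ⟦ inc G w e ⟧)
        ≡⟨ deg-∑ E ⟨
      deg G E w ∎
      where
      open ≡-Reasoning
      distrib : ∀ a b c → a * c + b * c ≡ (a + b) * c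
      distrib = solve-∀
      lemma : ∀ p q → ⟦ p ∧ q ⟧ ≡ ⟦ p ⟧ * ⟦ q ⟧
      lemma = by-cases (∀ᵇ? λ p → ∀ᵇ? λ q → _ ℕ.≟ _)
      deg-∑ : ∀ B → deg G B w ≡ ∑ (λ e → ⟦ B e ⟧ * ⟦ inc G w e ⟧)
      deg-∑ B = trans (deg-count G B w) (trans (count-∑ _) (∑-cong λ e → lemma (B e) (inc G w e)))

    closed-visits : ∀ {r} L → IsWalk {G} r L r → ∀ w → walkDeg {G} L w ≡ 2 * visits {G} r L w
    closed-visits L p w = +-cancelʳ-≡ _ _ _ (walkDeg-visits {G} L p w)

    double-even : ∀ a → odd (2 * a) ≡ false
    double-even a = trans (cong (λ b → odd (a + b)) (+-identityʳ a)) (odd-double a)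

    unused-even : (∀ w → odd (deg G E w) ≡ false) → ∀ {r} L → IsWalk {G} r L r → (∀ e → uses {G} L e ≤ ⟦ E e ⟧) →
      ∀ w → odd (deg G (unused L) w) ≡ false
    unused-even even {r} L p h w = trans (sym (Bool.xor-identityʳ (odd (deg G (unused L) w))))
      (trans (cong (odd (deg G (unused L) w) xor_) (sym (trans (cong odd (closed-visits L p w)) (double-even (visits {G} r L w)))))
      (trans (sym (odd-+ (deg G (unused L) w) _)) (trans (cong odd (deg-unused L h w)) (even w))))

    -- Hierholzer's step.
    splice : (∀ w → odd (deg G E w) ≡ false) → ∀ {r x z e} L → IsWalk {G} r L r → (∀ e → uses {G} L e ≤ ⟦ E e ⟧) →
      x ∈ˢ on {G} r L → Joins G e x z → e ∈ˢ E → uses {G} L e ≡ 0 →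
      ∃ λ L′ → IsWalk {G} r L′ r × (∀ e → uses {G} L′ e ≤ ⟦ E e ⟧) × (∀ e → uses {G} L e ≤ uses {G} L′ e) × uses {G} L′ e ≡ 1
    splice even {r} {x} {z} {e} L p h x∈ j e∈E fresh
      with cut-at {G} L p x∈
         | trail-between {G} (count (remove (unused L) e)) (remove (unused L) e) {z} {x} refl par
      where
      e∈ : e ∈ˢ unused L
      e∈ = ∩-intro {X = E} {λ e → does (uses {G} L e ℕ.≟ 0)} e∈E (dec-true (uses {G} L e ℕ.≟ 0) fresh)
      lemma : ∀ o i q r → o ≡ false → i ≡ q xor r → o xor i ≡ r xor q
      lemma = by-cases (∀ᵇ? λ o → ∀ᵇ? λ i → ∀ᵇ? λ q → ∀ᵇ? λ r → (_ Bool.≟ _) →-dec ((_ Bool.≟ _) →-dec (_ Bool.≟ _)))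
      par : ∀ w → odd (deg G (remove (unused L) e) w) ≡ (z == w) xor (x == w)
      par w = trans (odd-deg-remove {G} {unused L} e∈ w)
        (lemma (odd (deg G (unused L) w)) (inc G w e) (x == w) (z == w) (unused-even even L p h w) (joins-xor {G} j w))
    ... | L₁ , L₂ , refl , p₁ , p₂ | C , pC , hC =
      L₁ ++ ((e , z) ∷ C) ++ L₂
      , IsWalk-++ {G} L₁ _ p₁ (IsWalk-++ {G} ((e , z) ∷ C) L₂ (j , pC) p₂)
      , (λ e′ → ≤-trans (≤-reflexive (total e′)) (≤-trans (+-monoˡ-≤ _ (few e′)) (≤-reflexive (unused-split L h e′))))
      , (λ e′ → ≤-trans (m≤n+m (uses {G} L e′) _) (≤-reflexive (sym (total e′))))
      , trans (total e) (trans (cong (uses {G} ((e , z) ∷ C) e +_) fresh) (trans (+-identityʳ _) once))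
      where
      few : ∀ e′ → uses {G} ((e , z) ∷ C) e′ ≤ ⟦ unused L e′ ⟧
      few = uses-∷ {G} (unused L) C {e} {z} (∩-intro {X = E} {λ e → does (uses {G} L e ℕ.≟ 0)} e∈E (dec-true (uses {G} L e ℕ.≟ 0) fresh)) hC
      total : ∀ e′ → uses {G} (L₁ ++ ((e , z) ∷ C) ++ L₂) e′ ≡ uses {G} ((e , z) ∷ C) e′ + uses {G} (L₁ ++ L₂) e′
      total e′ = trans (uses-++ {G} L₁ _ e′) (trans (cong (uses {G} L₁ e′ +_) (uses-++ {G} ((e , z) ∷ C) L₂ e′))
        (trans (shuffle (uses {G} L₁ e′) (uses {G} ((e , z) ∷ C) e′) (uses {G} L₂ e′))
          (cong (uses {G} ((e , z) ∷ C) e′ +_) (sym (uses-++ {G} L₁ L₂ e′)))))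
        where
        shuffle : ∀ a b c → a + (b + c) ≡ b + (a + c)
        shuffle = solve-∀
      once : uses {G} ((e , z) ∷ C) e ≡ 1
      once = ≤-antisym (≤-trans (few e) (⟦⟧≤1 (unused L e))) (≤-trans (≤-reflexive (sym (cong ⟦_⟧ (==-refl e)))) (m≤m+n _ _))

    leaving-edge : ∀ {T r v} L → Connects (src G) (tgt G) T all → IsWalk {G} r L r → on {G} r L v ≡ false →
      ∃ λ e → e ∈ˢ T × uses {G} L e ≡ 0 × ∃₂ λ x z → x ∈ˢ on {G} r L × Joins G e x z
    leaving-edge {T} {r} {v} L conn p v∉ with any? (λ e → (T e Bool.≟ true) ×-dec ¬? (on {G} r L (src G e) Bool.≟ on {G} r L (tgt G e)))
    ... | no none = ⊥-elim (true≢false (on-start {G} r L) (trans (conn (on {G} r L) same refl refl) v∉))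
      where
      same : ∀ e → e ∈ˢ T → on {G} r L (src G e) ≡ on {G} r L (tgt G e)
      same e e∈ = decidable-stable (_ Bool.≟ _) λ ne → none (e , e∈ , ne)
    ... | yes (e , e∈ , differ) = e , e∈ , fresh , end
      where
      fresh : uses {G} L e ≡ 0
      fresh with uses {G} L e in eq
      ... | zero = refl
      ... | suc _ = let (a , b) = used-on {G} L p e (≤-trans (s≤s z≤n) (≤-reflexive (sym eq))) in ⊥-elim (differ (trans a (sym b)))
      end : ∃₂ λ x z → x ∈ˢ on {G} r L × Joins G e x z
      end with on {G} r L (src G e) in eq | on {G} r L (tgt G e) in eq′
      ... | true | _ = src G e , tgt G e , eq , inj₁ (refl , refl)
      ... | false | true = tgt G e , src G e , eq′ , inj₂ (refl , refl)
      ... | false | false = ⊥-elim (differ refl)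

  Trail : Fin (nV G) → Set
  Trail r = ∃ λ L → IsWalk {G} r L r × (∀ e → uses {G} L e ≤ ⟦ E e ⟧)

  euler : ∀ {T} → T ⊆ˢ E → Connects (src G) (tgt G) T all → (∀ w → odd (deg G E w) ≡ false) → ∀ r →
    ¬ ¬ ∃ λ ((L , _) : Trail r) → ∀ v → v ∈ˢ on {G} r L
  euler {T} T⊆E conn even r = do
    ((L , p , h) , least) ← minimiser {A = Trail r} (λ (L , _) → ∑ λ e → ⟦ E e ⟧ ∸ uses {G} L e) ([] , refl , λ _ → z≤n)
    return ((L , p , h) , λ v → decidable-stable (_ Bool.≟ _) λ v∉ → longer L p h least (≢true⇒≡false v∉))
    where
    longer : ∀ L → IsWalk {G} r L r → (∀ e → uses {G} L e ≤ ⟦ E e ⟧) →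
      ((t : Trail r) → ∑ (λ e → ⟦ E e ⟧ ∸ uses {G} L e) ≤ ∑ (λ e → ⟦ E e ⟧ ∸ uses {G} (proj₁ t) e)) →
      ∀ {v} → on {G} r L v ≡ false → ⊥
    longer L p h least v∉ =
      let (e , e∈T , fresh , x , z , x∈ , j) = leaving-edge L conn p v∉
          (L′ , p′ , h′ , more , once) = splice even L p h x∈ j (T⊆E e e∈T) fresh
      in <⇒≱ (∑-mono-< (λ e′ → ∸-monoʳ-≤ ⟦ E e′ ⟧ (more e′)) e
           (subst₂ (λ a b → ⟦ E e ⟧ ∸ a < ⟦ E e ⟧ ∸ b) (sym once) (sym fresh)
             (subst (λ b → ⟦ b ⟧ ∸ 1 < ⟦ b ⟧ ∸ 0) (sym (T⊆E e e∈T)) ≤-refl)))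
         (least (L′ , p′ , h′))

  trail-visits : ∀ {r} ((L , _) : Trail r) → ∀ w → 2 * visits {G} r L w ≤ deg G E w
  trail-visits (L , p , h) w = ≤-trans (≤-reflexive (sym (closed-visits L p w))) (≤-trans (m≤n+m _ _) (≤-reflexive (deg-unused L h w)))

-- Finite search for spanning walks, and their form as f-trails

module _ {m n : ℕ} where

  search : ∀ N {P : List (Fin m × Fin n) → Set} → (∀ L → Dec (P L)) → Dec (∃ λ L → length L ≤ N × P L)
  search zero P? = map′ (λ p → [] , z≤n , p) (λ { ([] , _ , p) → p }) (P? [])
  search (suc N) {P} P? = map′ to from (P? [] ⊎-dec any? λ i → any? λ j → search N λ L → P? ((i , j) ∷ L))
    where
    to : P [] ⊎ (∃ λ i → ∃ λ j → ∃ λ L → length L ≤ N × P ((i , j) ∷ L)) → ∃ λ L → length L ≤ suc N × P L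
    to (inj₁ p) = [] , z≤n , p
    to (inj₂ (i , j , L , l , p)) = (i , j) ∷ L , s≤s l , p
    from : (∃ λ L → length L ≤ suc N × P L) → P [] ⊎ (∃ λ i → ∃ λ j → ∃ λ L → length L ≤ N × P ((i , j) ∷ L))
    from ([] , _ , p) = inj₁ p
    from ((i , j) ∷ L , s≤s l , p) = inj₂ (i , j , L , l , p)

module _ {G : Graph} where

  isWalk? : ∀ u L w → Dec (IsWalk {G} u L w)
  isWalk? u [] w = u ≟ w
  isWalk? u ((e , z) ∷ L) w =
    (((src G e ≟ u) ×-dec (tgt G e ≟ z)) ⊎-dec ((tgt G e ≟ u) ×-dec (src G e ≟ z))) ×-dec isWalk? z L w

  ∑-uses : ∀ L → ∑ (uses {G} L) ≡ length L
  ∑-uses [] = ∑-zero λ _ → refl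
  ∑-uses ((e , z) ∷ L) = trans (∑-+ (λ e′ → ⟦ e == e′ ⟧) (uses {G} L)) (cong₂ _+_ (trans (sym (count-∑ (e ==_))) (count-δ e)) (∑-uses L))

  vertexAt : (u : Fin (nV G)) (L : Walk {G}) → Fin (suc (length L)) → Fin (nV G)
  vertexAt u L zero = u
  vertexAt u ((_ , z) ∷ L) (suc i) = vertexAt z L i

  edgeAt : (L : Walk {G}) → Fin (length L) → Fin (nE G)
  edgeAt ((e , _) ∷ L) zero = e
  edgeAt (_ ∷ L) (suc i) = edgeAt L i

  vertexAt-end : ∀ {u w} L → IsWalk {G} u L w → vertexAt u L (fromℕ (length L)) ≡ w
  vertexAt-end [] p = p
  vertexAt-end (_ ∷ L) (_ , p) = vertexAt-end L p

  edgeAt-joins : ∀ {u w} L → IsWalk {G} u L w → ∀ i → Joins G (edgeAt L i) (vertexAt u L (inject₁ i)) (vertexAt u L (suc i))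
  edgeAt-joins (_ ∷ L) (j , _) zero = j
  edgeAt-joins (_ ∷ L) (_ , p) (suc i) = edgeAt-joins L p i

  edgeAt-used : ∀ L i → 1 ≤ uses {G} L (edgeAt L i)
  edgeAt-used ((e , _) ∷ L) zero rewrite ==-refl e = s≤s z≤n
  edgeAt-used (_ ∷ L) (suc i) = ≤-trans (edgeAt-used L i) (m≤n+m _ _)

  edgeAt-injective : ∀ L → (∀ e → uses {G} L e ≤ 1) → ∀ {i j} → edgeAt L i ≡ edgeAt L j → i ≡ j
  edgeAt-injective (_ ∷ L) h {zero} {zero} _ = refl
  edgeAt-injective ((e , _) ∷ L) h {zero} {suc j} refl = ⊥-elim (<⇒≱ (+-mono-≤ (≤-reflexive (sym (cong ⟦_⟧ (==-refl e)))) (edgeAt-used L j)) (h e))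
  edgeAt-injective ((e , _) ∷ L) h {suc i} {zero} refl = ⊥-elim (<⇒≱ (+-mono-≤ (≤-reflexive (sym (cong ⟦_⟧ (==-refl e)))) (edgeAt-used L i)) (h e))
  edgeAt-injective (_ ∷ L) h {suc i} {suc j} eq = cong suc (edgeAt-injective L (λ e → ≤-trans (m≤n+m _ _) (h e)) eq)

  vertexAt-on : ∀ {u} L v → v ∈ˢ on {G} u L → ∃ λ i → vertexAt u L i ≡ v
  vertexAt-on [] v h = zero , ==⇒≡ h
  vertexAt-on {u} ((_ , z) ∷ L) v h with u ≟ v
  ... | yes p = zero , p
  ... | no _ = let (i , q) = vertexAt-on L v h in suc i , q

  count-vertexAt : ∀ u L v → count (λ i → vertexAt u L (inject₁ i) == v) ≡ visits {G} u L v
  count-vertexAt u [] v = trans (count-∑ {0} _) (∑-empty _)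
  count-vertexAt u ((_ , z) ∷ L) v = trans (count-∑ {suc (length L)} _) (trans (∑-suc _)
    (cong (⟦ u == v ⟧ +_) (trans (sym (count-∑ {length L} _)) (count-vertexAt z L v))))

  record SpanningWalk (f : Fin (nV G) → ℕ) (r : Fin (nV G)) (L : Walk {G}) : Set where
    field
      isWalk   : IsWalk {G} r L r
      once     : ∀ e → uses {G} L e ≤ 1
      spanning : ∀ v → v ∈ˢ on {G} r L
      bounded  : ∀ v → visits {G} r L v ≤ f v

  spanningWalk? : ∀ f r L → Dec (SpanningWalk f r L)
  spanningWalk? f r L = map′
    (λ (p , o , s , b) → record { isWalk = p ; once = o ; spanning = s ; bounded = b })
    (λ W → SpanningWalk.isWalk W , SpanningWalk.once W , SpanningWalk.spanning W , SpanningWalk.bounded W)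
    (isWalk? r L r ×-dec all? (λ e → uses {G} L e ≤? 1) ×-dec all? (λ v → on {G} r L v Bool.≟ true) ×-dec all? (λ v → visits {G} r L v ≤? f v))

  -- The length is the total number of uses, at most one for each edge. This makes the search for
  -- spanning walks finite.
  spanningWalk-short : ∀ {f r L} → SpanningWalk f r L → length L ≤ nE G
  spanningWalk-short {L = L} W = ≤-trans (≤-reflexive (sym (∑-uses L)))
    (≤-trans (∑-mono (SpanningWalk.once W)) (≤-reflexive (trans (∑-const 1 (nE G)) (+-identityʳ _))))

  spanningWalk⇒FTrail : ∀ {f r L} → SpanningWalk f r L → FTrail G f
  spanningWalk⇒FTrail {f} {r} {L} W = record
      { len = length L ; vs = vertexAt r L ; es = edgeAt L
      ; closed = sym (vertexAt-end L isWalk)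
      ; distinctEdges = edgeAt-injective L once
      ; joins = edgeAt-joins L isWalk }
    , (λ v → vertexAt-on L v (spanning v))
    , λ v → ≤-trans (≤-reflexive (trans (card≡count _) (count-vertexAt r L v))) (bounded v)
    where open SpanningWalk W

  spanningWalk : ∀ f r → TreeConnected G 2 (full G) → ΩCondition G f → ¬ ¬ ∃ (SpanningWalk f r)
  spanningWalk f r tc cond = do
    (B , sp , tB , deg≤) ← bounded-base G f cond tc
    P ← tight⇒treePair sp tB
    let open TreePair P
        B∩⊆B = λ e → proj₁ ∘ ∧-elim {B e} {inside G all e}
    (E , (T₁⊆E , E⊆B) , even) ← even-between {G} {B = B} (λ e → B∩⊆B e ∘ T₁⊆B e) (λ e → B∩⊆B e ∘ T₂⊆B e) disjoint conn₂
    ((L , p , h) , spanning) ← euler {G} {E} T₁⊆E conn₁ even r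
    return (L , record
      { isWalk = p
      ; once = λ e → ≤-trans (h e) (⟦⟧≤1 (E e))
      ; spanning = spanning
      ; bounded = λ v → half (f v) _ (≤-trans (trail-visits {G} {E} (L , p , h) v) (≤-trans (deg-mono E⊆B v) (deg≤ v))) })
    where
    deg-mono : ∀ {E B} → E ⊆ˢ B → ∀ v → deg G E v ≤ deg G B v
    deg-mono {E} {B} E⊆B v = subst₂ _≤_ (sym (deg-count G E v)) (sym (deg-count G B v))
      (count-mono (∩-mono {X = E} {inc G v} {B} {inc G v} E⊆B λ _ → id))
    -- Here the unit in `2 * f v + 1` disappears: twice the number of visits is even.
    half : ∀ a b → 2 * b ≤ 2 * a + 1 → b ≤ a
    half a b h with b ≤? a
    ... | yes p = p
    ... | no ¬p = ⊥-elim (<⇒≱ (≤-trans (≤-reflexive (shift a)) (*-monoʳ-≤ 2 (≰⇒> ¬p))) h)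
      where
      shift : ∀ a → suc (2 * a + 1) ≡ 2 * suc a
      shift = solve-∀

theorem1p10 : (G : Graph) (f : Fin (nV G) → ℕ) → (∀ v → 1 ≤ f v) →
    TreeConnected G 2 (full G) →
    (∀ (S : Subset (nV G)) (P : ComponentPartition G 2 (compl G S)) →
    Ω G 2 P ℚ.≤ (sumOver G S (λ v → ((ℤ.+ (f v)) ℚ./ 1) ℚ.- (ℤ.+ 3 ℚ./ 2)) ℚ.+ (ℤ.+ 2 ℚ./ 1))) →
    FTrail G f
theorem1p10 G f _ tc@((r , _) , _) cond = spanningWalk⇒FTrail (proj₂ (proj₂ short))
  where
  short : ∃ λ L → length L ≤ nE G × SpanningWalk f r L
  short = decidable-stable (search (nE G) (spanningWalk? f r))
    (spanningWalk f r tc cond >>= λ (L , W) → return (L , spanningWalk-short W , W))
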